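{- Let $q$ be a prime power and let $L$ be a line of $\mathrm{PG}(5,q)$ in the $K$-orbit $o_{8,1}$. Then the hyperplane-orbit distribution $OD_4(L)$ is $\left[1,\,q^2+\frac32q,\,\frac q2,\,q^3-q\right]$ if $q$ is even, and $\left[2,\,q^2+\frac{3q-1}{2},\,\frac{q-1}{2},\,q^3-q\right]$ if $q$ is odd.
   Context: A point $(y_0,\dots,y_5)$ of $\mathrm{PG}(5,q)$ is identified with the nonzero symmetric matrix $\begin{bmatrix} y_0&y_1&y_2\\ y_1&y_3&y_4\\ y_2&y_4&y_5\end{bmatrix}$ up to scalar. $K\cong\mathrm{PGL}(3,q)$ acts by $M\mapsto AMA^T$, $A\in\mathrm{GL}(3,q)$. The orbit $o_{8,1}$ is the $K$-orbit of the line $\left\{\begin{bmatrix}x&0&0\\0&y&0\\0&0&-y\end{bmatrix}:(x,y)\in\mathrm{PG}(1,q)\right\}$. Hyperplanes correspond to conics of $\mathrm{PG}(2,q)$ (nonzero quadratic forms up to scalar): $\sum_{0\le i\le j\le2}a_{ij}X_iX_j$ corresponds to $a_{00}Y_0+a_{01}Y_1+a_{02}Y_2+a_{11}Y_3+a_{12}Y_4+a_{22}Y_5=0$. $\mathcal H_1,\mathcal H_{2,r},\mathcal H_{2,i},\mathcal H_3$ are the sets of hyperplanes corresponding respectively to double lines (scalar multiples of squares of linear forms), pairs of distinct real lines (products of two non-proportional linear forms over $\mathbb F_q$), pairs of conjugate imaginary lines (scalar multiples of products of two non-proportional linear forms conjugate over $\mathbb F_{q^2}$), and non-singular conics (those with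 $4a_{00}a_{11}a_{22}+a_{01}a_{02}a_{12}-a_{00}a_{12}^2-a_{11}a_{02}^2-a_{22}a_{01}^2\ne0$). $OD_4(L)=[h_1,h_{2,r},h_{2,i},h_3]$ lists the numbers of hyperplanes in $\mathcal H_1,\mathcal H_{2,r},\mathcal H_{2,i},\mathcal H_3$ containing $L$. -}

module Defs where

open import Algebra.Bundles using (CommutativeRing; Semiring)
import Algebra.Definitions.RawSemiring
open import Algebra.Morphism.Structures using (module RingMorphisms)
open import Algebra.Structures using (IsCommutativeRing)
open import Data.Fin.Base using (Fin)
open import Data.Nat.Base using (ℕ; suc)
import Data.Nat.Base as ℕ
open import Data.Nat.Primality using (Prime)
open import Data.Product.Base using (Σ; ∃-syntax; Σ-syntax; _×_; _,_; proj₁)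
open import Data.Vec.Base using (Vec; []; _∷_; map; zipWith; lookup; replicate)
open import Data.Vec.Properties using (map-id; map-cong; map-∘)
open import Function.Bundles using (_↔_; _⇔_; Bijection)
open import Level using (0ℓ)
open import Relation.Binary.Bundles using (Setoid)
open import Relation.Binary.PropositionalEquality
  using (_≡_; _≢_; refl; sym; trans; cong; setoid; module ≡-Reasoning)
open import Relation.Nullary.Negation using (¬_)
open import Relation.Unary using (Pred; _∈_)

PrimePower : ℕ → Set
PrimePower q = ∃[ p ] ∃[ h ] (Prime p × q ≡ p ℕ.^ suc h)

-- The library's `HeytingField` only inverts elements apart from 0#, for an
-- apartness relation that may be strictly finer than ≢, so it is not used.
record FiniteField (q : ℕ) : Set₁ where
  infix  8 -_
  infixl 7 _*_
  infixl 6 _+_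
  field
    Carrier           : Set
    _+_ _*_           : Carrier → Carrier → Carrier
    -_                : Carrier → Carrier
    0# 1#             : Carrier
    isCommutativeRing : IsCommutativeRing _≡_ _+_ _*_ -_ 0# 1#
    0≢1               : 0# ≢ 1#
    inverse           : ∀ x → x ≢ 0# → ∃[ y ] x * y ≡ 1#
    enumeration       : Carrier ↔ Fin q

  commutativeRing : CommutativeRing 0ℓ 0ℓ
  commutativeRing = record { isCommutativeRing = isCommutativeRing }

  open CommutativeRing commutativeRing public
    using (rawRing; semiring; _-_; *-assoc; *-comm; *-identityˡ; zeroˡ)
  open Algebra.Definitions.RawSemiring (Semiring.rawSemiring semiring) public
    using (_^_; sum) renaming (_×_ to _•_)

module Vectors {q} (F : FiniteField q) where
  open FiniteField F

  𝟎 : ∀ {n} → Vec Carrier n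
  𝟎 = replicate _ 0#

  infixl 6 _⊕_
  infixr 7 _⊙_
  infix  4 _∼_

  _⊕_ : ∀ {n} → Vec Carrier n → Vec Carrier n → Vec Carrier n
  _⊕_ = zipWith _+_

  _⊙_ : ∀ {n} → Carrier → Vec Carrier n → Vec Carrier n
  c ⊙ v = map (c *_) v

  _∼_ : ∀ {n} → Vec Carrier n → Vec Carrier n → Set
  u ∼ v = ∃[ c ] (c ≢ 0# × v ≡ c ⊙ u)

  ⊙-assoc : ∀ {n} c d (v : Vec Carrier n) → c ⊙ (d ⊙ v) ≡ (c * d) ⊙ v
  ⊙-assoc c d v = trans (sym (map-∘ (c *_) (d *_) v))
                        (map-cong (λ x → sym (*-assoc c d x)) v)

  ⊙-identity : ∀ {n} (v : Vec Carrier n) → 1# ⊙ v ≡ v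
  ⊙-identity v = trans (map-cong *-identityˡ v) (map-id v)

  unit≢0 : ∀ {c d} → c * d ≡ 1# → c ≢ 0#
  unit≢0 {d = d} cd≡1 refl = 0≢1 (trans (sym (zeroˡ d)) cd≡1)

  ∼-refl : ∀ {n} {v : Vec Carrier n} → v ∼ v
  ∼-refl {v = v} = 1# , (λ 1≡0 → 0≢1 (sym 1≡0)) , sym (⊙-identity v)

  ∼-sym : ∀ {n} {u v : Vec Carrier n} → u ∼ v → v ∼ u
  ∼-sym {u = u} (c , c≢0 , refl) with inverse c c≢0
  ... | d , cd≡1 = d , unit≢0 dc≡1 , sym (begin
    d ⊙ (c ⊙ u)  ≡⟨ ⊙-assoc d c u ⟩
    (d * c) ⊙ u  ≡⟨ cong (_⊙ u) dc≡1 ⟩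
    1# ⊙ u       ≡⟨ ⊙-identity u ⟩
    u            ∎)
    where
    open ≡-Reasoning
    dc≡1 : d * c ≡ 1#
    dc≡1 = trans (*-comm d c) cd≡1

  ∼-trans : ∀ {n} {u v w : Vec Carrier n} → u ∼ v → v ∼ w → u ∼ w
  ∼-trans {u = u} (c , c≢0 , refl) (d , d≢0 , refl) =
    d * c , dc≢0 , ⊙-assoc d c u
    where
    open ≡-Reasoning
    dc≢0 : d * c ≢ 0#
    dc≢0 dc≡0 with inverse d d≢0
    ... | e , de≡1 = c≢0 (begin
      c            ≡⟨ sym (*-identityˡ c) ⟩
      1# * c       ≡⟨ cong (_* c) (trans (sym de≡1) (*-comm d e)) ⟩
      e * d * c    ≡⟨ *-assoc e d c ⟩
      e * (d * c)  ≡⟨ cong (e *_) dc≡0 ⟩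
      e * 0#       ≡⟨ trans (*-comm e 0#) (zeroˡ e) ⟩
      0#           ∎)

  -- The coefficients (a₀₀, a₀₁, a₀₂, a₁₁, a₁₂, a₂₂) of the product of the
  -- linear forms ∑ lᵢXᵢ and ∑ mᵢXᵢ, as a formal polynomial.
  _⊗_ : Vec Carrier 3 → Vec Carrier 3 → Vec Carrier 6
  (l₀ ∷ l₁ ∷ l₂ ∷ []) ⊗ (m₀ ∷ m₁ ∷ m₂ ∷ []) =
    l₀ * m₀ ∷ l₀ * m₁ + l₁ * m₀ ∷ l₀ * m₂ + l₂ * m₀ ∷
    l₁ * m₁ ∷ l₁ * m₂ + l₂ * m₁ ∷ l₂ * m₂ ∷ []

-- Points, lines and hyperplanes of PG(5,q). A point is given by any of its
-- homogeneous coordinate vectors.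
module Geometry {q} (F : FiniteField q) where
  open FiniteField F
  open Vectors F

  Point : Set
  Point = Σ[ y ∈ Vec Carrier 6 ] y ≢ 𝟎

  PointSet : Set₁
  PointSet = Pred Point 0ℓ

  record Line : Set where
    field
      u v         : Vec Carrier 6
      independent : ∀ s t → s ⊙ u ⊕ t ⊙ v ≡ 𝟎 → s ≡ 0# × t ≡ 0#

    points : PointSet
    points (y , _) = ∃[ s ] ∃[ t ] y ≡ s ⊙ u ⊕ t ⊙ v

  Matrix : Set
  Matrix = Fin 3 → Fin 3 → Carrier

  infixl 7 _⊠_
  _⊠_ : Matrix → Matrix → Matrix
  (A ⊠ B) i j = sum (λ k → A i k * B k j)

  _ᵀ : Matrix → Matrix
  (A ᵀ) i j = A j i

  identity : Matrix
  identity i j = lookup (lookup ((1# ∷ 0# ∷ 0# ∷ []) ∷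
                                 (0# ∷ 1# ∷ 0# ∷ []) ∷
                                 (0# ∷ 0# ∷ 1# ∷ []) ∷ []) i) j

  Invertible : Matrix → Set
  Invertible A = ∃[ B ] ((∀ i j → (A ⊠ B) i j ≡ identity i j) ×
                         (∀ i j → (B ⊠ A) i j ≡ identity i j))

  GL₃ : Set
  GL₃ = Σ Matrix Invertible

  symmetricMatrix : Vec Carrier 6 → Matrix
  symmetricMatrix (y₀ ∷ y₁ ∷ y₂ ∷ y₃ ∷ y₄ ∷ y₅ ∷ []) i j =
    lookup (lookup ((y₀ ∷ y₁ ∷ y₂ ∷ []) ∷
                    (y₁ ∷ y₃ ∷ y₄ ∷ []) ∷
                    (y₂ ∷ y₄ ∷ y₅ ∷ []) ∷ []) i) j

  image : GL₃ → PointSet → PointSet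
  image (A , _) S (y , _) =
    Σ[ m ∈ Point ] (m ∈ S × ∃[ c ] (c ≢ 0# ×
      (∀ i j → symmetricMatrix y i j
                 ≡ c * (A ⊠ symmetricMatrix (proj₁ m) ⊠ A ᵀ) i j)))

  InKOrbitOf : PointSet → PointSet → Set
  InKOrbitOf S T = ∃[ A ] (∀ (P : Point) → P ∈ T ⇔ P ∈ image A S)

  -- The points diag(x, y, -y) with (x, y) ∈ PG(1,q).
  representative₈,₁ : PointSet
  representative₈,₁ (m , _) =
    ∃[ x ] ∃[ y ] (¬ (x ≡ 0# × y ≡ 0#) ×
                   m ≡ x ∷ 0# ∷ 0# ∷ y ∷ 0# ∷ - y ∷ [])

  o₈,₁ : Pred Line 0ℓ
  o₈,₁ L = InKOrbitOf representative₈,₁ (Line.points L)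

  -- The value at (y₀, …, y₅) of the linear form whose coefficients, those of
  -- a quadratic form, are listed in the order a₀₀, a₀₁, a₀₂, a₁₁, a₁₂, a₂₂.
  evaluate : Vec Carrier 6 → Vec Carrier 6 → Carrier
  evaluate (a₀₀ ∷ a₀₁ ∷ a₀₂ ∷ a₁₁ ∷ a₁₂ ∷ a₂₂ ∷ [])
           (y₀ ∷ y₁ ∷ y₂ ∷ y₃ ∷ y₄ ∷ y₅ ∷ []) =
    a₀₀ * y₀ + a₀₁ * y₁ + a₀₂ * y₂ + a₁₁ * y₃ + a₁₂ * y₄ + a₂₂ * y₅

  Contains : Vec Carrier 6 → Line → Set
  Contains a L = ∀ (P : Point) → P ∈ Line.points L → evaluate a (proj₁ P) ≡ 0#

  -- The hyperplanes satisfying H, i.e. nonzero coefficient vectors satisfying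
  -- H with proportional ones identified.
  hyperplanes : Pred (Vec Carrier 6) 0ℓ → Setoid 0ℓ 0ℓ
  hyperplanes H = record
    { Carrier       = Σ[ a ∈ Vec Carrier 6 ] (a ≢ 𝟎 × H a)
    ; _≈_           = λ a b → proj₁ a ∼ proj₁ b
    ; isEquivalence = record { refl = ∼-refl ; sym = ∼-sym ; trans = ∼-trans }
    }

  HyperplaneCount : Pred (Vec Carrier 6) 0ℓ → ℕ → Set
  HyperplaneCount H n = Bijection (hyperplanes H) (setoid (Fin n))

record QuadraticExtension {q} (F : FiniteField q) : Set₁ where
  field
    E : FiniteField (q ℕ.^ 2)

  private
    module F = FiniteField F
    module E = FiniteField E

  field
    ι                  : F.Carrier → E.Carrier
    isRingHomomorphism :
      RingMorphisms.IsRingHomomorphism F.rawRing E.rawRing ι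

  conjugate : E.Carrier → E.Carrier
  conjugate x = x E.^ q

module Distribution {q} (F : FiniteField q) (F² : QuadraticExtension F) where
  open FiniteField F
  open Vectors F
  open Geometry F
  open QuadraticExtension F² using (E; ι; conjugate)
  private
    module E  = FiniteField E
    module VE = Vectors E

  -- The following predicates are applied to nonzero forms only.
  H₁ H₂,ᵣ H₂,ᵢ H₃ : Pred (Vec Carrier 6) 0ℓ

  H₁ a = ∃[ c ] ∃[ l ] a ≡ c ⊙ (l ⊗ l)

  H₂,ᵣ a = ∃[ l ] ∃[ m ] (¬ (l ∼ m) × a ≡ l ⊗ m)

  H₂,ᵢ a = ∃[ c ] Σ[ l ∈ Vec E.Carrier 3 ]
    (¬ (l VE.∼ map conjugate l) ×
     map ι a ≡ ι c VE.⊙ (l VE.⊗ map conjugate l))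

  H₃ (a₀₀ ∷ a₀₁ ∷ a₀₂ ∷ a₁₁ ∷ a₁₂ ∷ a₂₂ ∷ []) =
    4 • (a₀₀ * a₁₁ * a₂₂) + a₀₁ * a₀₂ * a₁₂ - a₀₀ * (a₁₂ * a₁₂)
      - a₁₁ * (a₀₂ * a₀₂) - a₂₂ * (a₀₁ * a₀₁) ≢ 0#

  HasOD₄ : Line → Vec ℕ 4 → Set
  HasOD₄ L (h₁ ∷ h₂,ᵣ ∷ h₂,ᵢ ∷ h₃ ∷ []) =
    count H₁ h₁ × count H₂,ᵣ h₂,ᵣ × count H₂,ᵢ h₂,ᵢ × count H₃ h₃
    where
    count : Pred (Vec Carrier 6) 0ℓ → ℕ → Set
    count H = HyperplaneCount (λ a → H a × Contains a L)

{-# OPTIONS --safe #-}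

-- Pulling conics back along A with L = A·o, the hyperplanes through L become
-- the nonzero forms with a₀₀ = 0 and a₁₁ = a₂₂, that is,
--   bX₀X₁ + cX₀X₂ + d(X₁² + X₂²) + eX₁X₂.
-- If (b , c) ≠ 0, then bX₁ + cX₂ splits off up to a remainder whose coefficient
-- r is minus the discriminant: r = 0 gives q² + q pairs of real lines and r ≠ 0
-- gives q³ - q conics. Otherwise the form is X₁X₂ or X₁² + eX₁X₂ + X₂², whose
-- type is decided by the number of t in F with t + t⁻¹ = e. The map t ↦ t + t⁻¹
-- on nonzero t identifies t with t⁻¹ only, so counting its fibres determines how
-- many e have 0, 1 or 2 such t from the number of t = ±1, which is 1 or 2
-- according to the parity of q.
-- For 0 such t, the form splits over the field E with q² elements into factors
-- exchanged by x ↦ x^q, since a polynomial X^n - X has at most n roots.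

module Submission where

open import Algebra.Bundles using (CommutativeRing; RawRing)
import Algebra.Properties.AbelianGroup
import Algebra.Properties.CommutativeMonoid.Sum
import Algebra.Properties.CommutativeSemiring.Binomial
import Algebra.Properties.CommutativeSemiring.Exp
import Algebra.Properties.Ring
import Algebra.Properties.Semiring.Mult
import Algebra.Properties.Semiring.Mult.TCOptimised
import Algebra.Solver.Ring
open import Algebra.Solver.Ring.AlmostCommutativeRing using (fromCommutativeRing; _-Raw-AlmostCommutative⟶_)
import Data.Integer.Base as ℤ
open import Data.Integer.Base using (ℤ; 0ℤ; 1ℤ)
import Data.Integer.Properties as ℤ
open import Data.Maybe.Base using (just; nothing)
import Data.Nat.Base as ℕ
import Data.Nat.Properties as ℕ
open import Relation.Binary.Definitions using (WeaklyDecidable; DecidableEquality)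
open import Relation.Binary.PropositionalEquality as ≡ using (_≡_)
import Relation.Binary.Reasoning.Setoid as ≈-Reasoning
open import Relation.Nullary using (¬_; Dec; yes; no; contradiction)

-- Counting pairs t, t⁻¹ works in every characteristic and shows more than the individual numbers:
-- the e without a root always exceed the e with two roots by exactly one. The numbers of real and
-- imaginary pairs therefore come from one formula, and parity enters only through the number of e
-- with a double root. A second obstacle is that E is an arbitrary field with q² elements containing
-- a copy of F, so the factors of a binary form without real factors have to be found inside a given
-- field. Uniqueness of finite fields is avoided: if E had no root, a root could be adjoined to F
-- and to E alike, and comparing the two extensions gives a contradiction. Conjugation is merely the
-- q-th power. That it is additive rests on the characteristic of E, which is extracted from the sum
-- of q² ones being zero.

module IntegerSolver {c ℓ} (R : CommutativeRing c ℓ) where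
  open CommutativeRing R
  open import Data.Integer.Base using (+_; -[1+_])
  open Algebra.Properties.Ring ring using (-‿distribˡ-*; -‿distribʳ-*)
  open Algebra.Properties.AbelianGroup +-abelianGroup using (⁻¹-∙-comm; ε⁻¹≈ε; ⁻¹-involutive)
  open Algebra.Properties.Semiring.Mult.TCOptimised semiring
    using (_×_; 1+×; ×-homo-+; ×1-homo-*)
  open ≈-Reasoning setoid

  -- Polynomials are normalised with integer coefficients, whose equality computes, so that `refl`
  -- settles identities over an abstract field of any characteristic. With the optimised multiple,
  -- the images of `0ℤ` and `1ℤ` are `0#` and `1#` by computation.
  fromℤ : ℤ → Carrier
  fromℤ (+ n)      = n × 1#
  fromℤ -[1+ n ]   = - (ℕ.suc n × 1#)

  fromℤ-neg : ∀ i → fromℤ (ℤ.- i) ≈ - fromℤ i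
  fromℤ-neg (+ ℕ.zero)  = sym ε⁻¹≈ε
  fromℤ-neg (+ ℕ.suc n) = refl
  fromℤ-neg -[1+ n ]    = sym (⁻¹-involutive _)

  fromℤ-⊖ : ∀ m n → fromℤ (m ℤ.⊖ n) ≈ m × 1# - n × 1#
  fromℤ-⊖ m ℕ.zero = begin
    m × 1#        ≈⟨ +-identityʳ _ ⟨
    m × 1# + 0#   ≈⟨ +-congˡ ε⁻¹≈ε ⟨
    m × 1# - 0#   ∎
  fromℤ-⊖ ℕ.zero (ℕ.suc n) = sym (+-identityˡ _)
  fromℤ-⊖ (ℕ.suc m) (ℕ.suc n) = begin
    fromℤ (ℕ.suc m ℤ.⊖ ℕ.suc n)          ≡⟨ ≡.cong fromℤ (ℤ.[1+m]⊖[1+n]≡m⊖n m n) ⟩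
    fromℤ (m ℤ.⊖ n)                      ≈⟨ fromℤ-⊖ m n ⟩
    m × 1# - n × 1#                      ≈⟨ +-congʳ (+-identityʳ _) ⟨
    m × 1# + 0# - n × 1#                 ≈⟨ +-congʳ (+-congˡ (-‿inverseʳ 1#)) ⟨
    m × 1# + (1# - 1#) - n × 1#          ≈⟨ +-congʳ (+-assoc _ _ _) ⟨
    m × 1# + 1# - 1# - n × 1#            ≈⟨ +-assoc _ _ _ ⟩
    m × 1# + 1# + (- 1# - n × 1#)        ≈⟨ +-cong (+-comm _ _) (⁻¹-∙-comm _ _) ⟩
    1# + m × 1# - (1# + n × 1#)          ≈⟨ +-cong (1+× m 1#) (-‿cong (1+× n 1#)) ⟨
    ℕ.suc m × 1# - ℕ.suc n × 1#          ∎

  fromℤ-+ : ∀ i j → fromℤ (i ℤ.+ j) ≈ fromℤ i + fromℤ j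
  fromℤ-+ (+ m)    (+ n)    = ×-homo-+ 1# m n
  fromℤ-+ (+ m)    -[1+ n ] = fromℤ-⊖ m (ℕ.suc n)
  fromℤ-+ -[1+ m ] (+ n)    = trans (fromℤ-⊖ n (ℕ.suc m)) (+-comm _ _)
  fromℤ-+ -[1+ m ] -[1+ n ] = begin
    - (ℕ.suc (ℕ.suc (m ℕ.+ n)) × 1#)     ≡⟨ ≡.cong (λ k → - (ℕ.suc k × 1#)) (ℕ.+-suc m n) ⟨
    - ((ℕ.suc m ℕ.+ ℕ.suc n) × 1#)       ≈⟨ -‿cong (×-homo-+ 1# (ℕ.suc m) (ℕ.suc n)) ⟩
    - (ℕ.suc m × 1# + ℕ.suc n × 1#)      ≈⟨ ⁻¹-∙-comm _ _ ⟨
    - (ℕ.suc m × 1#) - ℕ.suc n × 1#      ∎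

  fromℤ-*-pos : ∀ m j → fromℤ (+ m ℤ.* j) ≈ m × 1# * fromℤ j
  fromℤ-*-pos m (+ n) = begin
    fromℤ (+ m ℤ.* + n)   ≡⟨ ≡.cong fromℤ (ℤ.pos-* m n) ⟨
    (m ℕ.* n) × 1#        ≈⟨ ×1-homo-* m n ⟩
    m × 1# * n × 1#       ∎
  fromℤ-*-pos m -[1+ n ] = begin
    fromℤ (+ m ℤ.* -[1+ n ])          ≡⟨ ≡.cong fromℤ (ℤ.neg-distribʳ-* (+ m) (+ ℕ.suc n)) ⟨
    fromℤ (ℤ.- (+ m ℤ.* + ℕ.suc n))   ≈⟨ fromℤ-neg (+ m ℤ.* + ℕ.suc n) ⟩
    - fromℤ (+ m ℤ.* + ℕ.suc n)       ≈⟨ -‿cong (fromℤ-*-pos m (+ ℕ.suc n)) ⟩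
    - (m × 1# * ℕ.suc n × 1#)         ≈⟨ -‿distribʳ-* _ _ ⟩
    m × 1# * - (ℕ.suc n × 1#)         ∎

  fromℤ-* : ∀ i j → fromℤ (i ℤ.* j) ≈ fromℤ i * fromℤ j
  fromℤ-* (+ m)    j = fromℤ-*-pos m j
  fromℤ-* -[1+ m ] j = begin
    fromℤ (-[1+ m ] ℤ.* j)            ≡⟨ ≡.cong fromℤ (ℤ.neg-distribˡ-* (+ ℕ.suc m) j) ⟨
    fromℤ (ℤ.- (+ ℕ.suc m ℤ.* j))     ≈⟨ fromℤ-neg (+ ℕ.suc m ℤ.* j) ⟩
    - fromℤ (+ ℕ.suc m ℤ.* j)         ≈⟨ -‿cong (fromℤ-*-pos (ℕ.suc m) j) ⟩
    - (ℕ.suc m × 1# * fromℤ j)        ≈⟨ -‿distribˡ-* _ _ ⟩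
    - (ℕ.suc m × 1#) * fromℤ j        ∎

  morphism : ℤ.+-*-rawRing -Raw-AlmostCommutative⟶ fromCommutativeRing R
  morphism = record
    { ⟦_⟧ = fromℤ ; +-homo = fromℤ-+ ; *-homo = fromℤ-* ; -‿homo = fromℤ-neg
    ; 0-homo = refl ; 1-homo = refl }

  -- Only positive answers are possible: in positive characteristic, different integers may have the
  -- same image.
  fromℤ-≟ : WeaklyDecidable (λ i j → fromℤ i ≈ fromℤ j)
  fromℤ-≟ i j with i ℤ.≟ j
  ... | yes i≡j = just (reflexive (≡.cong fromℤ i≡j))
  ... | no  _   = nothing

  open Algebra.Solver.Ring ℤ.+-*-rawRing (fromCommutativeRing R) morphism fromℤ-≟ public

open import Defs
open import Algebra.Morphism.Structures using (module RingMorphisms)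
open import Algebra.Structures using (IsCommutativeRing)
open import Data.Empty using (⊥-elim)
open import Data.Fin.Base as Fin using (Fin; zero; suc; toℕ; fromℕ; inject₁; punchIn; combine; _↑ˡ_; _↑ʳ_)
open import Data.Fin.Patterns
import Data.Fin.Properties as Fin
open import Data.Fin.Properties
  using (+↔⊎; *↔×; injective⇒≤; toℕ-fromℕ; toℕ-inject₁; toℕ<n; punchInᵢ≢i)
open import Data.List.Base as List using (List)
open import Data.List.Membership.Propositional.Properties using (∈-filter⁺; ∈-filter⁻; ∈-allFin; ∈-lookup)
import Data.List.Relation.Unary.All as All
open import Data.List.Relation.Unary.AllPairs using (_∷_)
import Data.List.Relation.Unary.Any as Any
open import Data.List.Relation.Unary.Any.Properties using (lookup-index)
open import Data.List.Relation.Unary.Unique.Propositional using (Unique)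
import Data.List.Relation.Unary.Unique.Propositional.Properties as Unique
open import Data.Nat.Base using (ℕ; zero; suc; z≤n; s≤s; s<s; _≤_; _<_; _!)
open import Data.Nat.Combinatorics using (_C_; nCn≡1; k![n∸k]!∣n!)
open import Data.Nat.Combinatorics.Specification using (nCk≡n!/k![n-k]!)
open import Data.Nat.Divisibility using (_∣_; divides; m∣m*n; ∣⇒≤)
open import Data.Nat.DivMod using (_/_; m/n*n≡m; m*n/n≡m)
open import Data.Nat.Primality using (Prime; euclidsLemma; prime⇒nonTrivial)
import Data.Nat.Solver
open import Data.Product as Product using (∃; ∃-syntax; Σ-syntax; _×_; _,_; proj₁; proj₂)
open import Data.Product.Function.NonDependent.Propositional using (_×-↔_)
open import Data.Sum as Sum using (_⊎_; inj₁; inj₂; [_,_]′)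
open import Data.Sum.Properties using (inj₁-injective; inj₂-injective)
open import Data.Unit using (⊤; tt)
open import Data.Vec.Base using (Vec; []; _∷_; _++_; map; concat; tabulate; lookup; replicate)
open import Data.Vec.Properties using (∷-injectiveˡ; ∷-injectiveʳ; ≡-dec; tabulate-cong)
open import Function using (_∘_; _↔_; Inverse; Injective; Equivalence; mk↔ₛ′)
open import Function.Properties.Inverse using (↔-sym; ↔-trans; Inverse⇒Injection)
open import Level using (0ℓ)
open import Relation.Binary.PropositionalEquality hiding (_≡_)
open import Relation.Nullary.Decidable using (_×-dec_; ¬?; map′; via-injection)
open import Relation.Unary using (Pred; Decidable; _∈_; _⊆_; _≐_; _⊥_; _∪_; ∅; U; _⟨×⟩_; _⟨⊎⟩_)

-- Cardinalities

module Cardinality where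
  -- Injectivity compares elements of `A`, never proofs of `P`. This matters because the proofs
  -- carry choices: an `e` with two roots satisfies `TwoRoots` in two ways and must count once.
  record HasSize {A : Set} (P : Pred A 0ℓ) (n : ℕ) : Set where
    field
      element   : Fin n → A
      sound     : ∀ i → P (element i)
      injective : Injective _≡_ _≡_ element
      complete  : ∀ {a} → P a → ∃[ i ] element i ≡ a

  open HasSize

  private variable
    A B I : Set
    P Q : Pred A 0ℓ
    m n : ℕ

  size-family : I ↔ Fin n → (f : I → A) → (∀ i → P (f i)) → Injective _≡_ _≡_ f →
                (∀ {a} → P a → ∃[ i ] f i ≡ a) → HasSize P n
  size-family I↔Fin f fP inj comp = record
    { element   = f ∘ from
    ; sound     = fP ∘ from
    ; injective = λ {i} {j} eq → begin
        i            ≡⟨ strictlyInverseˡ i ⟨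
        to (from i)  ≡⟨ cong to (inj eq) ⟩
        to (from j)  ≡⟨ strictlyInverseˡ j ⟩
        j            ∎
    ; complete  = λ p → let i , fi≡a = comp p in to i , trans (cong f (strictlyInverseʳ i)) fi≡a
    }
    where
    open Inverse I↔Fin
    open ≡-Reasoning

  size-cong : P ≐ Q → HasSize P n → HasSize Q n
  size-cong (P⊆Q , Q⊆P) s = record
    { element = element s ; sound = P⊆Q ∘ sound s ; injective = injective s ; complete = complete s ∘ Q⊆P }

  size-∅ : HasSize (∅ {A = A}) 0
  size-∅ = record { element = λ () ; sound = λ () ; injective = λ { {()} } ; complete = λ () }

  size-singleton : (a : A) → HasSize (a ≡_) 1
  size-singleton a = record
    { element = λ _ → a ; sound = λ _ → refl ; injective = λ { {zero} {zero} _ → refl }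
    ; complete = zero ,_ }

  size-∪ : P ⊥ Q → HasSize P m → HasSize Q n → HasSize (P ∪ Q) (m ℕ.+ n)
  size-∪ {P = P} {Q = Q} P⊥Q s t = size-family (↔-sym +↔⊎) [ element s , element t ]′
    (λ { (inj₁ i) → inj₁ (sound s i) ; (inj₂ j) → inj₂ (sound t j) })
    (λ { {inj₁ i} {inj₁ j} eq → cong inj₁ (injective s eq)
       ; {inj₁ i} {inj₂ j} eq → ⊥-elim (P⊥Q (sound s i , subst Q (sym eq) (sound t j)))
       ; {inj₂ i} {inj₁ j} eq → ⊥-elim (P⊥Q (sound s j , subst Q eq (sound t i)))
       ; {inj₂ i} {inj₂ j} eq → cong inj₂ (injective t eq) })
    (λ { (inj₁ p) → let i , eq = complete s p in inj₁ i , eq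
       ; (inj₂ q) → let i , eq = complete t q in inj₂ i , eq })

  size-⟨⊎⟩ : HasSize P m → HasSize Q n → HasSize (P ⟨⊎⟩ Q) (m ℕ.+ n)
  size-⟨⊎⟩ s t = size-family (↔-sym +↔⊎) (Sum.map (element s) (element t))
    (λ { (inj₁ i) → sound s i ; (inj₂ j) → sound t j })
    (λ { {inj₁ i} {inj₁ j} eq → cong inj₁ (injective s (inj₁-injective eq))
       ; {inj₂ i} {inj₂ j} eq → cong inj₂ (injective t (inj₂-injective eq)) })
    (λ { {inj₁ _} p → let i , eq = complete s p in inj₁ i , cong inj₁ eq
       ; {inj₂ _} q → let i , eq = complete t q in inj₂ i , cong inj₂ eq })

  size-⟨×⟩ : HasSize P m → HasSize Q n → HasSize (P ⟨×⟩ Q) (m ℕ.* n)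
  size-⟨×⟩ s t = size-family (↔-sym *↔×) (Product.map (element s) (element t))
    (λ (i , j) → sound s i , sound t j)
    (λ eq → cong₂ _,_ (injective s (cong proj₁ eq)) (injective t (cong proj₂ eq)))
    (λ (p , q) → let i , eq = complete s p ; j , eq′ = complete t q in (i , j) , cong₂ _,_ eq eq′)

  size-image : (f : A → B) → (∀ {a b} → P a → P b → f a ≡ f b → a ≡ b) →
               HasSize P n → HasSize (λ b → ∃[ a ] P a × f a ≡ b) n
  size-image f inj s = record
    { element   = f ∘ element s
    ; sound     = λ i → element s i , sound s i , refl
    ; injective = λ {i} {j} eq → injective s (inj (sound s i) (sound s j) eq)
    ; complete  = λ (a , p , fa≡b) → let i , eq = complete s p in i , trans (cong f eq) fa≡b
    }

  size-≤ : P ⊆ Q → HasSize P m → HasSize Q n → m ≤ n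
  size-≤ P⊆Q s t = injective⇒≤ {f = λ i → proj₁ (located i)} λ {i} {j} eq → injective s (begin
    element s i                    ≡⟨ proj₂ (located i) ⟨
    element t (proj₁ (located i))  ≡⟨ cong (element t) eq ⟩
    element t (proj₁ (located j))  ≡⟨ proj₂ (located j) ⟩
    element s j                    ∎)
    where
    open ≡-Reasoning
    located : ∀ i → ∃[ j ] element t j ≡ element s i
    located i = complete t (P⊆Q (sound s i))

  size-unique : HasSize P m → HasSize P n → m ≡ n
  size-unique s t = ℕ.≤-antisym (size-≤ (λ p → p) s t) (size-≤ (λ p → p) t s)

  lookup-injective : ∀ {xs : List A} → Unique xs → ∀ i j → List.lookup xs i ≡ List.lookup xs j → i ≡ j
  lookup-injective (_   ∷ _)   zero    zero    _  = refl
  lookup-injective (x∉ ∷ _)   zero    (suc j) eq = ⊥-elim (All.lookup x∉ (∈-lookup j) eq)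
  lookup-injective (x∉ ∷ _)   (suc i) zero    eq = ⊥-elim (All.lookup x∉ (∈-lookup i) (sym eq))
  lookup-injective (_   ∷ xs!) (suc i) (suc j) eq = cong suc (lookup-injective xs! i j eq)

  -- Supplies a size that is still unknown; equations between sizes determine it later.
  size-decidable : {P : Pred A 0ℓ} → HasSize (U {A = A}) n → Decidable P → ∃[ m ] HasSize P m
  size-decidable {n = n} {P = P} s P? = List.length is , record
    { element   = element s ∘ List.lookup is
    ; sound     = λ i → proj₂ (∈-filter⁻ (P? ∘ element s) {xs = List.allFin n} (∈-lookup i))
    ; injective = λ {i} {j} eq → lookup-injective
        (Unique.filter⁺ (P? ∘ element s) (Unique.allFin⁺ n)) i j (injective s eq)
    ; complete  = λ {a} p →
        let i , eq = complete s _
            i∈is = ∈-filter⁺ (P? ∘ element s) (∈-allFin i) (subst P (sym eq) p)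
        in Any.index i∈is , trans (cong (element s) (sym (lookup-index i∈is))) eq
    }
    where is = List.filter (P? ∘ element s) (List.allFin n)

open Cardinality

-- Finite fields

prime∤! : ∀ {p} → Prime p → ∀ m → m < p → ¬ p ∣ m !
prime∤! {p} pr zero 0<p p∣1 =
  ℕ.<⇒≱ (ℕ.nonTrivial⇒n>1 p {{prime⇒nonTrivial pr}}) (∣⇒≤ p∣1)
prime∤! pr (suc m) m<p p∣ with euclidsLemma (suc m) (m !) pr p∣
... | inj₁ p∣1+m = ℕ.<⇒≱ m<p (∣⇒≤ p∣1+m)
... | inj₂ p∣m!  = prime∤! pr m (ℕ.<-trans (ℕ.n<1+n m) m<p) p∣m!

n∣n! : ∀ n → 0 < n → n ∣ n !
n∣n! (suc n) _ = m∣m*n (n !)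

-- The prime divides `p ! = (p C k) * k ! * (p - k) !`, but neither factorial on the right, since
-- both are of numbers below `p`.
prime∣C : ∀ {p} → Prime p → ∀ k → 0 < k → k < p → p ∣ p C k
prime∣C {p} pr k 0<k k<p with euclidsLemma (p C k) (k ! ℕ.* (p ℕ.∸ k) !) pr p∣
  where
  p∣ : p ∣ (p C k) ℕ.* (k ! ℕ.* (p ℕ.∸ k) !)
  p∣ = subst (p ∣_) (sym (trans (cong (λ c → c ℕ.* (k ! ℕ.* (p ℕ.∸ k) !)) (nCk≡n!/k![n-k]! (ℕ.<⇒≤ k<p)))
         (m/n*n≡m {{ℕ._!*_!≢0 k (p ℕ.∸ k)}} (k![n∸k]!∣n! (ℕ.<⇒≤ k<p))))) (n∣n! p (ℕ.<-trans 0<k k<p))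
... | inj₁ p∣C = p∣C
... | inj₂ p∣! with euclidsLemma (k !) ((p ℕ.∸ k) !) pr p∣!
... | inj₁ p∣k! = contradiction p∣k! (prime∤! pr k k<p)
... | inj₂ p∣[p-k]! = contradiction p∣[p-k]!
        (prime∤! pr (p ℕ.∸ k) (ℕ.∸-monoʳ-< 0<k (ℕ.<⇒≤ k<p)))

module FieldProperties {q : ℕ} (F : FiniteField q) where
  open FiniteField F public
  open CommutativeRing commutativeRing public
    using (+-assoc; +-comm; +-identityˡ; +-identityʳ; -‿inverseˡ; -‿inverseʳ; zeroʳ; *-identityʳ;
           distribʳ; +-commutativeMonoid; *-commutativeMonoid; commutativeSemiring; +-abelianGroup)
  open IntegerSolver commutativeRing public
    using (Polynomial; var; con; _:+_; _:*_; _:-_; :-_; _:=_; solve; prove)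
  open Algebra.Properties.Semiring.Mult semiring using (×1-homo-*; ×-assoc-*; ×-assocˡ)
  open Algebra.Properties.CommutativeSemiring.Exp commutativeSemiring public
    using (^-assocʳ; ^-distrib-*)
  module AG = Algebra.Properties.AbelianGroup +-abelianGroup
  open ≡-Reasoning

  infix 4 _≟_
  _≟_ : DecidableEquality Carrier
  _≟_ = via-injection (Inverse⇒Injection enumeration) Fin._≟_

  size-Carrier : HasSize (U {A = Carrier}) q
  size-Carrier = size-family enumeration (λ x → x) (λ _ → _) (λ eq → eq) (λ {x} _ → x , refl)

  any? : {P : Pred Carrier 0ℓ} → Decidable P → Dec (∃ P)
  any? {P} P? = map′ (λ (i , p) → from i , p)
                     (λ (x , p) → to x , subst P (sym (strictlyInverseʳ x)) p)
                     (Fin.any? (P? ∘ from))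
    where open Inverse enumeration

  1≢0 : 1# ≢ 0#
  1≢0 = 0≢1 ∘ sym

  x-y≡0⇒x≡y : ∀ {x y} → x - y ≡ 0# → x ≡ y
  x-y≡0⇒x≡y = AG.x∙y⁻¹≈ε⇒x≈y _ _

  x≡y⇒x-y≡0 : ∀ {x y} → x ≡ y → x - y ≡ 0#
  x≡y⇒x-y≡0 = AG.x≈y⇒x∙y⁻¹≈ε

  x[yz]≡z : ∀ {x y} → x * y ≡ 1# → ∀ z → x * (y * z) ≡ z
  x[yz]≡z {x} {y} xy≡1 z = begin
    x * (y * z)    ≡⟨ *-assoc x y z ⟨
    x * y * z      ≡⟨ cong (_* z) xy≡1 ⟩
    1# * z         ≡⟨ *-identityˡ z ⟩
    z              ∎

  *-cancelˡ : ∀ {x y z} → x ≢ 0# → x * y ≡ x * z → y ≡ z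
  *-cancelˡ {x} {y} {z} x≢0 eq with x⁻¹ , xx⁻¹≡1 ← inverse x x≢0 = begin
    y                ≡⟨ x[yz]≡z x⁻¹x≡1 y ⟨
    x⁻¹ * (x * y)    ≡⟨ cong (x⁻¹ *_) eq ⟩
    x⁻¹ * (x * z)    ≡⟨ x[yz]≡z x⁻¹x≡1 z ⟩
    z                ∎
    where x⁻¹x≡1 = trans (*-comm x⁻¹ x) xx⁻¹≡1

  *-zero⇒ : ∀ x y → x * y ≡ 0# → x ≡ 0# ⊎ y ≡ 0#
  *-zero⇒ x y xy≡0 with x ≟ 0#
  ... | yes x≡0 = inj₁ x≡0
  ... | no  x≢0 = inj₂ (*-cancelˡ x≢0 (trans xy≡0 (sym (zeroʳ x))))

  *-≢0 : ∀ {x y} → x ≢ 0# → y ≢ 0# → x * y ≢ 0#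
  *-≢0 {x} {y} x≢0 y≢0 xy≡0 = [ x≢0 , y≢0 ]′ (*-zero⇒ x y xy≡0)

  square-zero : ∀ {x} → x * x ≡ 0# → x ≡ 0#
  square-zero {x} eq = [ (λ z → z) , (λ z → z) ]′ (*-zero⇒ x x eq)

  ^-zero : ∀ {x} n → x ^ n ≡ 0# → x ≡ 0#
  ^-zero zero 1≡0 = contradiction 1≡0 1≢0
  ^-zero {x} (suc n) eq = [ (λ z → z) , ^-zero n ]′ (*-zero⇒ x _ eq)

  1^n≡1 : ∀ n → 1# ^ n ≡ 1#
  1^n≡1 zero    = refl
  1^n≡1 (suc n) = trans (*-identityˡ _) (1^n≡1 n)

  •1-^ : ∀ p n → (p ℕ.^ n) • 1# ≡ (p • 1#) ^ n
  •1-^ p zero    = +-identityʳ 1#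
  •1-^ p (suc n) = trans (×1-homo-* p (p ℕ.^ n)) (cong (p • 1# *_) (•1-^ p n))

  module Additive = Algebra.Properties.CommutativeMonoid.Sum +-commutativeMonoid
  -- In this instance `sum` is the product of a finite family.
  module Multiplicative = Algebra.Properties.CommutativeMonoid.Sum *-commutativeMonoid

  open Inverse enumeration using (to; from; strictlyInverseʳ; strictlyInverseˡ)

  reindex : Carrier ↔ Carrier → Fin q ↔ Fin q
  reindex π = ↔-trans (↔-sym enumeration) (↔-trans π enumeration)

  translation : Carrier → Carrier ↔ Carrier
  translation a = mk↔ₛ′ (_+ a) (_- a)
    (λ x → solve 2 (λ x a → x :- a :+ a := x) refl x a)
    (λ x → solve 2 (λ x a → x :+ a :- a := x) refl x a)

  dilation : ∀ {a b} → a * b ≡ 1# → Carrier ↔ Carrier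
  dilation {a} {b} ab≡1 = mk↔ₛ′ (a *_) (b *_) (x[yz]≡z ab≡1) (x[yz]≡z (trans (*-comm b a) ab≡1))

  -- Translation by `1#` permutes the field, so adding `1#` to each of the `q` elements leaves their
  -- sum unchanged.
  q•1≡0 : q • 1# ≡ 0#
  q•1≡0 = AG.identityʳ-unique _ _ (begin
    Additive.sum from + q • 1#
      ≡⟨ cong (Additive.sum from +_) (Additive.sum-replicate q) ⟨
    Additive.sum from + Additive.sum {q} (λ _ → 1#)             ≡⟨ Additive.∑-distrib-+ from (λ _ → 1#) ⟨
    Additive.sum {q} (λ i → from i + 1#)
      ≡⟨ Additive.sum-cong-≗ (λ i → strictlyInverseʳ (from i + 1#)) ⟨
    Additive.sum {q} (λ i → from (Inverse.to π i))         ≡⟨ Additive.sum-permute from π ⟨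
    Additive.sum from                                      ∎)
    where π = reindex (translation 1#)

  private
    -- The extra factor `x` takes the place of the `1#` at index `i`, which keeps the exponent free
    -- of subtraction.
    product-const-except : ∀ {n} (i : Fin n) (g : Fin n → Carrier) x →
      g i ≡ 1# → (∀ j → j ≢ i → g j ≡ x) → x * Multiplicative.sum g ≡ x ^ n
    product-const-except {suc n} i g x gi≡1 gj≡x = cong (x *_) (begin
      Multiplicative.sum g                                 ≡⟨ Multiplicative.sum-remove {i = i} g ⟩
      g i * Multiplicative.sum (g ∘ punchIn i)
        ≡⟨ cong₂ _*_ gi≡1 (Multiplicative.sum-cong-≗ λ j → gj≡x _ (punchInᵢ≢i i j)) ⟩
      1# * Multiplicative.sum {n} (λ _ → x)                ≡⟨ *-identityˡ _ ⟩
      Multiplicative.sum {n} (λ _ → x)                     ≡⟨ Multiplicative.sum-replicate n ⟩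
      x ^ n                                      ∎)

    product-≢0 : ∀ {n} (g : Fin n → Carrier) → (∀ i → g i ≢ 0#) → Multiplicative.sum g ≢ 0#
    product-≢0 {zero}  g g≢0 = 1≢0
    product-≢0 {suc n} g g≢0 = *-≢0 (g≢0 zero) (product-≢0 (g ∘ suc) (g≢0 ∘ suc))

    -- Replacing zero by `1#` lets a product over all of `Fin q` stand for the product of the
    -- nonzero elements.
    nonzeroPart : Carrier → Carrier
    nonzeroPart y with y ≟ 0#
    ... | yes _ = 1#
    ... | no  _ = y

    nonzeroPart≢0 : ∀ y → nonzeroPart y ≢ 0#
    nonzeroPart≢0 y with y ≟ 0#
    ... | yes _   = 1≢0
    ... | no  y≢0 = y≢0

    -- The factor by which `nonzeroPart y` changes when `y` is multiplied by a nonzero `x`.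
    ratio : Carrier → Carrier → Carrier
    ratio x y with y ≟ 0#
    ... | yes _ = 1#
    ... | no  _ = x

    ratio-0 : ∀ x {y} → y ≡ 0# → ratio x y ≡ 1#
    ratio-0 x {y} y≡0 with y ≟ 0#
    ... | yes _   = refl
    ... | no  y≢0 = contradiction y≡0 y≢0

    ratio-≢0 : ∀ x {y} → y ≢ 0# → ratio x y ≡ x
    ratio-≢0 x {y} y≢0 with y ≟ 0#
    ... | yes y≡0 = contradiction y≡0 y≢0
    ... | no  _   = refl

    nonzeroPart-* : ∀ x → x ≢ 0# → ∀ y → nonzeroPart (x * y) ≡ ratio x y * nonzeroPart y
    nonzeroPart-* x x≢0 y with x * y ≟ 0# | y ≟ 0#
    ... | yes _    | yes _    = sym (*-identityˡ 1#)
    ... | yes xy≡0 | no  y≢0  = contradiction xy≡0 (*-≢0 x≢0 y≢0)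
    ... | no  xy≢0 | yes refl = contradiction (zeroʳ x) xy≢0
    ... | no  _    | no  _    = refl

  -- Multiplication by x permutes the nonzero elements, so their product is
  -- x^(q-1) times itself.
  x^q≡x : ∀ x → x ^ q ≡ x
  x^q≡x x with x ≟ 0#
  ... | yes refl = 0^q (to 0#)
    where
    0^q : ∀ {n} → Fin n → 0# ^ n ≡ 0#
    0^q {suc n} _ = zeroˡ _
  ... | no x≢0 with x⁻¹ , xx⁻¹≡1 ← inverse x x≢0 = begin
    x ^ q                        ≡⟨ product-const-except (to 0#) (ratio x ∘ from) x
                                      (ratio-0 x (strictlyInverseʳ 0#)) (λ j j≢ → ratio-≢0 x (from≢0 j j≢)) ⟨
    x * Multiplicative.sum (ratio x ∘ from) ≡⟨ cong (x *_) ∏ratio≡1 ⟩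
    x * 1#                       ≡⟨ *-identityʳ x ⟩
    x                            ∎
    where
    from≢0 : ∀ j → j ≢ to 0# → from j ≢ 0#
    from≢0 j j≢ eq = j≢ (trans (sym (strictlyInverseˡ j)) (cong to eq))
    π = reindex (dilation xx⁻¹≡1)
    ∏ratio≡1 : Multiplicative.sum (ratio x ∘ from) ≡ 1#
    ∏ratio≡1 = *-cancelˡ (product-≢0 (nonzeroPart ∘ from) (nonzeroPart≢0 ∘ from)) (begin
      Multiplicative.sum (nonzeroPart ∘ from) * Multiplicative.sum (ratio x ∘ from)
        ≡⟨ *-comm _ _ ⟩
      Multiplicative.sum (ratio x ∘ from) * Multiplicative.sum (nonzeroPart ∘ from)
        ≡⟨ Multiplicative.∑-distrib-+ (ratio x ∘ from) (nonzeroPart ∘ from) ⟨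
      Multiplicative.sum (λ i → ratio x (from i) * nonzeroPart (from i))
        ≡⟨ Multiplicative.sum-cong-≗ (λ i → trans (cong nonzeroPart (strictlyInverseʳ (x * from i))) (nonzeroPart-* x x≢0 (from i))) ⟨
      Multiplicative.sum (λ i → nonzeroPart (from (Inverse.to π i)))
        ≡⟨ Multiplicative.sum-permute (nonzeroPart ∘ from) π ⟨
      Multiplicative.sum (nonzeroPart ∘ from)
        ≡⟨ *-identityʳ _ ⟨
      Multiplicative.sum (nonzeroPart ∘ from) * 1# ∎)

  module _ {p} (p-prime : Prime p) (p•1≡0 : p • 1# ≡ 0#) where
    module B = Algebra.Properties.CommutativeSemiring.Binomial commutativeSemiring

    ∣⇒•≡0 : ∀ {n} x → p ∣ n → n • x ≡ 0#
    ∣⇒•≡0 {n} x (divides k refl) = begin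
      (k ℕ.* p) • x            ≡⟨ ×-assocˡ x k p ⟨
      k • (p • x)              ≡⟨ cong (λ z → k • (p • z)) (*-identityˡ x) ⟨
      k • (p • (1# * x))       ≡⟨ cong (k •_) (×-assoc-* p 1# x) ⟨
      k • (p • 1# * x)         ≡⟨ cong (λ z → k • (z * x)) p•1≡0 ⟩
      k • (0# * x)             ≡⟨ ×-assoc-* k 0# x ⟨
      k • 0# * x               ≡⟨ cong (_* x) (k•0 k) ⟩
      0# * x                   ≡⟨ zeroˡ x ⟩
      0#                       ∎
      where
      k•0 : ∀ k → k • 0# ≡ 0#
      k•0 zero    = refl
      k•0 (suc k) = trans (+-identityˡ _) (k•0 k)

    -- All binomial coefficients except the two outer ones are divisible by `p`, and multiples of
    -- `p` annihilate the field.
    frobenius : ∀ x y → (x + y) ^ p ≡ x ^ p + y ^ p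
    frobenius x y = trans (B.theorem p x y) (expand p refl)
      where
      -- Stated for every `n` equal to `p`, so that matching exposes the exponent as a successor.
      expand : ∀ n → n ≡ p → B.binomialExpansion x y n ≡ x ^ n + y ^ n
      expand zero    0≡p = contradiction (subst (1 <_) (sym 0≡p) (ℕ.nonTrivial⇒n>1 p {{prime⇒nonTrivial p-prime}})) λ ()
      expand (suc n) refl = begin
        t zero + Additive.sum (t ∘ suc)
          ≡⟨ cong (t zero +_) (Additive.sum-init-last (t ∘ suc)) ⟩
        t zero + (Additive.sum (t ∘ suc ∘ inject₁) + t (fromℕ (suc n)))
          ≡⟨ cong (λ z → t zero + (z + t (fromℕ (suc n)))) (trans (Additive.sum-cong-≗ middle) (Additive.sum-replicate-zero n)) ⟩
        t zero + (0# + t (fromℕ (suc n)))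
          ≡⟨ cong₂ (λ u v → u + (0# + v)) first last ⟩
        y ^ suc n + (0# + x ^ suc n)
          ≡⟨ solve 2 (λ a b → b :+ (con 0ℤ :+ a) := a :+ b) refl (x ^ suc n) (y ^ suc n) ⟩
        x ^ suc n + y ^ suc n ∎
        where
        t = B.binomialTerm x y (suc n)
        first : t zero ≡ y ^ suc n
        first = trans (+-identityʳ _) (*-identityˡ _)
        middle : ∀ i → t (suc (inject₁ i)) ≡ 0#
        middle i = ∣⇒•≡0 _ (prime∣C p-prime _ (s≤s z≤n) (s<s (subst (ℕ._< n) (sym (toℕ-inject₁ i)) (toℕ<n i))))
        last : t (fromℕ (suc n)) ≡ x ^ suc n
        last = begin
          (suc n C toℕ (fromℕ (suc n))) • (x ^ toℕ (fromℕ (suc n)) * y ^ (suc n ℕ.∸ toℕ (fromℕ (suc n))))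
            ≡⟨ cong (λ k → (suc n C k) • (x ^ k * y ^ (suc n ℕ.∸ k))) (toℕ-fromℕ (suc n)) ⟩
          (suc n C suc n) • (x ^ suc n * y ^ (n ℕ.∸ n))
            ≡⟨ cong₂ (λ c k → c • (x ^ suc n * y ^ k)) (nCn≡1 (suc n)) (ℕ.n∸n≡0 n) ⟩
          1 • (x ^ suc n * 1#)  ≡⟨ trans (+-identityʳ _) (*-identityʳ _) ⟩
          x ^ suc n ∎

    frobenius-^ : ∀ k x y → (x + y) ^ (p ℕ.^ k) ≡ x ^ (p ℕ.^ k) + y ^ (p ℕ.^ k)
    frobenius-^ zero    x y = trans (*-identityʳ _) (sym (cong₂ _+_ (*-identityʳ x) (*-identityʳ y)))
    frobenius-^ (suc k) x y = begin
      (x + y) ^ (p ℕ.* p ℕ.^ k)                          ≡⟨ ^-assocʳ (x + y) p (p ℕ.^ k) ⟨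
      ((x + y) ^ p) ^ (p ℕ.^ k)                          ≡⟨ cong (_^ (p ℕ.^ k)) (frobenius x y) ⟩
      (x ^ p + y ^ p) ^ (p ℕ.^ k)                        ≡⟨ frobenius-^ k (x ^ p) (y ^ p) ⟩
      (x ^ p) ^ (p ℕ.^ k) + (y ^ p) ^ (p ℕ.^ k)
        ≡⟨ cong₂ _+_ (^-assocʳ x p (p ℕ.^ k)) (^-assocʳ y p (p ℕ.^ k)) ⟩
      x ^ (p ℕ.* p ℕ.^ k) + y ^ (p ℕ.* p ℕ.^ k)          ∎

  -- ⟦ a₀ ∷ … ∷ aₙ₋₁ ∷ [] ⟧ is the monic polynomial a₀ + … + aₙ₋₁Xⁿ⁻¹ + Xⁿ.
  ⟦_⟧ : ∀ {n} → Vec Carrier n → Carrier → Carrier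
  ⟦ [] ⟧    x = 1#
  ⟦ a ∷ p ⟧ x = a + x * ⟦ p ⟧ x

  -- Synthetic division by `X - r`: the coefficients of the quotient are the values at `r` of the
  -- proper tails of `p`, and the quotient is again monic.
  deflate : ∀ {n} (p : Vec Carrier (suc n)) r →
            Σ[ p′ ∈ Vec Carrier n ] ∀ x → ⟦ p ⟧ x ≡ ⟦ p ⟧ r + (x - r) * ⟦ p′ ⟧ x
  deflate (a ∷ [])        r = [] , λ x →
    solve 3 (λ a x r → a :+ x :* con 1ℤ := a :+ r :* con 1ℤ :+ (x :- r) :* con 1ℤ) refl a x r
  deflate (a ∷ p@(_ ∷ _)) r with p′ , eq ← deflate p r = ⟦ p ⟧ r ∷ p′ , λ x → begin
    a + x * ⟦ p ⟧ x
      ≡⟨ cong (λ z → a + x * z) (eq x) ⟩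
    a + x * (⟦ p ⟧ r + (x - r) * ⟦ p′ ⟧ x)
      ≡⟨ solve 5 (λ a x r u v → a :+ x :* (u :+ (x :- r) :* v) := a :+ r :* u :+ (x :- r) :* (u :+ x :* v))
           refl a x r (⟦ p ⟧ r) (⟦ p′ ⟧ x) ⟩
    a + r * ⟦ p ⟧ r + (x - r) * (⟦ p ⟧ r + x * ⟦ p′ ⟧ x) ∎

  -- Each root lowers the degree by one, and the last quotient is the constant 1. Monic polynomials
  -- spare any discussion of vanishing leading coefficients.
  tooManyRoots : ∀ {n} (p : Vec Carrier n) (root : Fin (suc n) → Carrier) →
                 Injective _≡_ _≡_ root → ¬ (∀ i → ⟦ p ⟧ (root i) ≡ 0#)
  tooManyRoots []          root inj p≡0 = 1≢0 (p≡0 zero)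
  tooManyRoots p@(_ ∷ _) root inj p≡0 with p′ , eq ← deflate p (root zero) =
    tooManyRoots p′ (root ∘ suc) (Fin.suc-injective ∘ inj) λ i →
      [ (λ x≡r → contradiction (inj (x-y≡0⇒x≡y x≡r)) λ ()) , (λ z → z) ]′
        (*-zero⇒ _ _ (begin
          (root (suc i) - root zero) * ⟦ p′ ⟧ (root (suc i))                    ≡⟨ +-identityˡ _ ⟨
          0# + (root (suc i) - root zero) * ⟦ p′ ⟧ (root (suc i))
            ≡⟨ cong (_+ (root (suc i) - root zero) * ⟦ p′ ⟧ (root (suc i))) (p≡0 zero) ⟨
          ⟦ p ⟧ (root zero) + (root (suc i) - root zero) * ⟦ p′ ⟧ (root (suc i)) ≡⟨ eq _ ⟨
          ⟦ p ⟧ (root (suc i))                                                  ≡⟨ p≡0 (suc i) ⟩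
          0#                                                                    ∎))

  -- The bound `1 < n` makes `X^n - X` monic of degree `n`; its coefficients are 0, -1 and then
  -- zeros.
  tooManyFixedPoints : ∀ {n} → 1 < n → (root : Fin (suc n) → Carrier) →
                       Injective _≡_ _≡_ root → ¬ (∀ i → root i ^ n ≡ root i)
  tooManyFixedPoints {suc (suc n)} _ root inj fixed =
    tooManyRoots (0# ∷ - 1# ∷ replicate n 0#) root inj λ i → begin
      0# + root i * (- 1# + root i * ⟦ replicate n 0# ⟧ (root i))
        ≡⟨ cong (λ z → 0# + root i * (- 1# + root i * z)) (⟦0⟧ n) ⟩
      0# + root i * (- 1# + root i * root i ^ n)
        ≡⟨ solve 2 (λ x y → con 0ℤ :+ x :* (:- con 1ℤ :+ x :* y) := x :* (x :* y) :- x) refl (root i) (root i ^ n) ⟩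
      root i ^ suc (suc n) - root i
        ≡⟨ x≡y⇒x-y≡0 (fixed i) ⟩
      0# ∎
    where
    ⟦0⟧ : ∀ k {x} → ⟦ replicate k 0# ⟧ x ≡ x ^ k
    ⟦0⟧ zero    = refl
    ⟦0⟧ (suc k) = trans (+-identityˡ _) (cong (_ *_) (⟦0⟧ k))
  tooManyFixedPoints {suc zero} (s≤s ())

  1<q : 1 < q
  1<q = bound (to 0#) (to 1#) (λ eq → 0≢1 (trans (sym (strictlyInverseʳ 0#)) (trans (cong from eq) (strictlyInverseʳ 1#))))
    where
    bound : ∀ {n} (i j : Fin n) → i ≢ j → 1 < n
    bound {suc zero}    zero zero i≢j = contradiction refl i≢j
    bound {suc (suc n)} _    _    _   = s≤s (s≤s z≤n)

-- Quadratic extensions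

module Adjoin {q} (K : FiniteField q) (e : FiniteField.Carrier K) where
  open FieldProperties K
  open ≡-Reasoning

  -- A pair (a , b) stands for a + bt, where t² = et - 1.
  Ext : Set
  Ext = Carrier × Carrier

  infixl 6 _⊞_
  infixl 7 _⊡_

  _⊞_ _⊡_ : Ext → Ext → Ext
  (a , b) ⊞ (c , d) = a + c , b + d
  (a , b) ⊡ (c , d) = a * c - b * d , a * d + b * c + e * (b * d)

  ⊟_ : Ext → Ext
  ⊟ (a , b) = - a , - b

  ⊡-comm : ∀ x y → x ⊡ y ≡ y ⊡ x
  ⊡-comm (a , b) (c , d) = cong₂ _,_
    (solve 4 (λ a b c d → a :* c :- b :* d := c :* a :- d :* b) refl a b c d)
    (solve 5 (λ a b c d e → a :* d :+ b :* c :+ e :* (b :* d) := c :* b :+ d :* a :+ e :* (d :* b)) refl a b c d e)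

  ⊡-identityˡ : ∀ x → (1# , 0#) ⊡ x ≡ x
  ⊡-identityˡ (a , b) = cong₂ _,_
    (solve 2 (λ a b → con 1ℤ :* a :- con 0ℤ :* b := a) refl a b)
    (solve 3 (λ a b e → con 1ℤ :* b :+ con 0ℤ :* a :+ e :* (con 0ℤ :* b) := b) refl a b e)

  ⊡-assoc : ∀ x y z → (x ⊡ y) ⊡ z ≡ x ⊡ (y ⊡ z)
  ⊡-assoc (a , b) (c , d) (f , g) = cong₂ _,_
    (solve 7 (λ a b c d f g e →
      (a :* c :- b :* d) :* f :- (a :* d :+ b :* c :+ e :* (b :* d)) :* g
      := a :* (c :* f :- d :* g) :- b :* (c :* g :+ d :* f :+ e :* (d :* g))) refl a b c d f g e)
    (solve 7 (λ a b c d f g e →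
      (a :* c :- b :* d) :* g :+ (a :* d :+ b :* c :+ e :* (b :* d)) :* f :+ e :* ((a :* d :+ b :* c :+ e :* (b :* d)) :* g)
      := a :* (c :* g :+ d :* f :+ e :* (d :* g)) :+ b :* (c :* f :- d :* g) :+ e :* (b :* (c :* g :+ d :* f :+ e :* (d :* g))))
      refl a b c d f g e)

  ⊡-distribˡ : ∀ x y z → x ⊡ (y ⊞ z) ≡ x ⊡ y ⊞ x ⊡ z
  ⊡-distribˡ (a , b) (c , d) (f , g) = cong₂ _,_
    (solve 6 (λ a b c d f g → a :* (c :+ f) :- b :* (d :+ g) := (a :* c :- b :* d) :+ (a :* f :- b :* g)) refl a b c d f g)
    (solve 7 (λ a b c d f g e →
      a :* (d :+ g) :+ b :* (c :+ f) :+ e :* (b :* (d :+ g))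
      := (a :* d :+ b :* c :+ e :* (b :* d)) :+ (a :* g :+ b :* f :+ e :* (b :* g))) refl a b c d f g e)

  isCommutativeRing′ : IsCommutativeRing _≡_ _⊞_ _⊡_ ⊟_ (0# , 0#) (1# , 0#)
  isCommutativeRing′ = record
    { isRing = record
      { +-isAbelianGroup = record
        { isGroup = record
          { isMonoid = record
            { isSemigroup = record
              { isMagma = record { isEquivalence = isEquivalence ; ∙-cong = cong₂ _⊞_ }
              ; assoc = λ (a , b) (c , d) (f , g) → cong₂ _,_ (+-assoc a c f) (+-assoc b d g) }
            ; identity = (λ (a , b) → cong₂ _,_ (+-identityˡ a) (+-identityˡ b))
                       , (λ (a , b) → cong₂ _,_ (+-identityʳ a) (+-identityʳ b)) }
          ; inverse = (λ (a , b) → cong₂ _,_ (-‿inverseˡ a) (-‿inverseˡ b))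
                    , (λ (a , b) → cong₂ _,_ (-‿inverseʳ a) (-‿inverseʳ b))
          ; ⁻¹-cong = cong ⊟_ }
        ; comm = λ (a , b) (c , d) → cong₂ _,_ (+-comm a c) (+-comm b d) }
      ; *-cong = cong₂ _⊡_
      ; *-assoc = ⊡-assoc
      ; *-identity = ⊡-identityˡ , λ x → trans (⊡-comm x _) (⊡-identityˡ x)
      ; distrib = ⊡-distribˡ , λ x y z → begin
          (y ⊞ z) ⊡ x       ≡⟨ ⊡-comm (y ⊞ z) x ⟩
          x ⊡ (y ⊞ z)       ≡⟨ ⊡-distribˡ x y z ⟩
          x ⊡ y ⊞ x ⊡ z     ≡⟨ cong₂ _⊞_ (⊡-comm x y) (⊡-comm x z) ⟩
          y ⊡ x ⊞ z ⊡ x     ∎ }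
    ; *-comm = ⊡-comm }

  -- The product of `a + bt` and its conjugate `a + b(e - t)`, computed with `t(e - t) = 1`.
  norm : Ext → Carrier
  norm (a , b) = a * a + e * (a * b) + b * b

  module _ (noRoot : ∀ t → t * t + 1# ≢ e * t) where

    -- For nonzero `b` the norm is `b²` times the value of `X² - eX + 1` at `-a/b`, which is nonzero
    -- because the polynomial has no root.
    norm≢0 : ∀ x → x ≢ (0# , 0#) → norm x ≢ 0#
    norm≢0 (a , b) x≢0 N≡0 with b ≟ 0#
    ... | yes refl = x≢0 (cong (_, 0#) (square-zero (begin
      a * a
        ≡⟨ solve 2 (λ a e → a :* a := a :* a :+ e :* (a :* con 0ℤ) :+ con 0ℤ :* con 0ℤ) refl a e ⟩
      norm (a , 0#)                ≡⟨ N≡0 ⟩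
      0#                           ∎)))
    ... | no b≢0 with b⁻¹ , bb⁻¹≡1 ← inverse b b≢0 = noRoot (- (a * b⁻¹)) (x-y≡0⇒x≡y (begin
      - (a * b⁻¹) * - (a * b⁻¹) + 1# - e * - (a * b⁻¹)
        ≡⟨ solve 3 (λ a c e → (:- (a :* c)) :* (:- (a :* c)) :+ con 1ℤ :- e :* (:- (a :* c))
             := c :* c :* (a :* a) :+ e :* (a :* c) :* con 1ℤ :+ con 1ℤ :* con 1ℤ) refl a b⁻¹ e ⟩
      b⁻¹ * b⁻¹ * (a * a) + e * (a * b⁻¹) * 1# + 1# * 1#
        ≡⟨ cong (λ o → b⁻¹ * b⁻¹ * (a * a) + e * (a * b⁻¹) * o + o * o) bb⁻¹≡1 ⟨
      b⁻¹ * b⁻¹ * (a * a) + e * (a * b⁻¹) * (b * b⁻¹) + (b * b⁻¹) * (b * b⁻¹)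
        ≡⟨ solve 4 (λ a b c e → c :* c :* (a :* a) :+ e :* (a :* c) :* (b :* c) :+ (b :* c) :* (b :* c)
             := c :* c :* (a :* a :+ e :* (a :* b) :+ b :* b)) refl a b b⁻¹ e ⟩
      b⁻¹ * b⁻¹ * norm (a , b)     ≡⟨ cong (b⁻¹ * b⁻¹ *_) N≡0 ⟩
      b⁻¹ * b⁻¹ * 0#               ≡⟨ zeroʳ _ ⟩
      0#                           ∎))

    inverse′ : ∀ x → x ≢ (0# , 0#) → ∃[ y ] x ⊡ y ≡ (1# , 0#)
    inverse′ x@(a , b) x≢0 with n , Nn≡1 ← inverse (norm x) (norm≢0 x x≢0) =
      -- The conjugate `(a + eb) - bt` divided by the norm.
      ((a + e * b) * n , - b * n) , cong₂ _,_
        (trans (solve 4 (λ a b e n → a :* ((a :+ e :* b) :* n) :- b :* ((:- b) :* n)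
                            := (a :* a :+ e :* (a :* b) :+ b :* b) :* n) refl a b e n) Nn≡1)
        (solve 4 (λ a b e n → a :* ((:- b) :* n) :+ b :* ((a :+ e :* b) :* n) :+ e :* (b :* ((:- b) :* n)) := con 0ℤ)
           refl a b e n)

    field′ : FiniteField (q ℕ.* q)
    field′ = record
      { isCommutativeRing = isCommutativeRing′
      ; 0≢1 = 0≢1 ∘ cong proj₁
      ; inverse = inverse′
      ; enumeration = ↔-trans (enumeration ×-↔ enumeration) (↔-sym *↔×)
      }

module Extension {q} (F : FiniteField q) (F² : QuadraticExtension F) where
  open QuadraticExtension F²
  open RingMorphisms.IsRingHomomorphism isRingHomomorphism public
    using () renaming (+-homo to ι-+; *-homo to ι-*; 0#-homo to ι-0; 1#-homo to ι-1; -‿homo to ι-neg)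
  module F = FieldProperties F
  module E = FieldProperties E
  open ≡-Reasoning

  ι-- : ∀ x y → ι (x F.- y) ≡ ι x E.- ι y
  ι-- x y = trans (ι-+ x _) (cong (ι x E.+_) (ι-neg y))

  ι-≡0 : ∀ {x} → ι x ≡ E.0# → x ≡ F.0#
  ι-≡0 {x} ιx≡0 with x F.≟ F.0#
  ... | yes x≡0 = x≡0
  ... | no  x≢0 with y , xy≡1 ← F.inverse x x≢0 = contradiction (begin
    E.1#              ≡⟨ ι-1 ⟨
    ι F.1#            ≡⟨ cong ι xy≡1 ⟨
    ι (x F.* y)       ≡⟨ ι-* x y ⟩
    ι x E.* ι y       ≡⟨ cong (E._* ι y) ιx≡0 ⟩
    E.0# E.* ι y      ≡⟨ E.zeroˡ _ ⟩
    E.0#              ∎) E.1≢0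

  ι-injective : ∀ {x y} → ι x ≡ ι y → x ≡ y
  ι-injective {x} {y} eq = F.x-y≡0⇒x≡y (ι-≡0 (trans (ι-- x y) (E.x≡y⇒x-y≡0 eq)))

  ι-^ : ∀ x n → ι (x F.^ n) ≡ ι x E.^ n
  ι-^ x zero    = ι-1
  ι-^ x (suc n) = trans (ι-* x _) (cong (ι x E.*_) (ι-^ x n))

  conjugate-ι : ∀ x → conjugate (ι x) ≡ ι x
  conjugate-ι x = trans (sym (ι-^ x q)) (cong ι (F.x^q≡x x))

  conjugate-* : ∀ x y → conjugate (x E.* y) ≡ conjugate x E.* conjugate y
  conjugate-* x y = E.^-distrib-* x y q

  -- If X² - eX + 1 had a root neither in F nor in E, then X^(q²) - X would have
  -- too many roots in E[t]: all elements of E, and t, which lies in F[t].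
  root-in-E : ∀ e → (∀ t → t F.* t F.+ F.1# ≢ e F.* t) →
              ∃[ η ] η E.* η E.+ E.1# ≡ ι e E.* η
  root-in-E e noRoot with E.any? (λ η → η E.* η E.+ E.1# E.≟ ι e E.* η)
  ... | yes root   = root
  ... | no  noRoot′ = contradiction fixed (E′.tooManyFixedPoints 1<q² elements injective)
    where
    F[t] = Adjoin.field′ F e noRoot
    E[t] = Adjoin.field′ E (ι e) (λ t eq → noRoot′ (t , eq))
    module F′ = FieldProperties F[t]
    module E′ = FieldProperties E[t]

    φ : F′.Carrier → E′.Carrier
    φ (a , b) = ι a , ι b

    φ-* : ∀ x y → φ (x F′.* y) ≡ φ x E′.* φ y
    φ-* (a , b) (c , d) = cong₂ _,_
      (trans (ι-- _ _) (cong₂ E._-_ (ι-* a c) (ι-* b d)))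
      (trans (ι-+ _ _) (cong₂ E._+_ (trans (ι-+ _ _) (cong₂ E._+_ (ι-* a d) (ι-* b c)))
                                    (trans (ι-* e _) (cong (ι e E.*_) (ι-* b d)))))

    φ-^ : ∀ x n → φ (x F′.^ n) ≡ φ x E′.^ n
    φ-^ x zero    = cong₂ _,_ ι-1 ι-0
    φ-^ x (suc n) = trans (φ-* x _) (cong (φ x E′.*_) (φ-^ x n))

    embed-^ : ∀ x n → (x , E.0#) E′.^ n ≡ (x E.^ n , E.0#)
    embed-^ x zero    = refl
    embed-^ x (suc n) = trans (cong ((x , E.0#) E′.*_) (embed-^ x n)) (cong₂ _,_
      (E.solve 2 (λ x y → x E.:* y E.:- E.con 0ℤ E.:* E.con 0ℤ E.:= x E.:* y) refl x (x E.^ n))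
      (E.solve 3 (λ x y e → x E.:* E.con 0ℤ E.:+ E.con 0ℤ E.:* y E.:+ e E.:* (E.con 0ℤ E.:* E.con 0ℤ) E.:= E.con 0ℤ)
        refl x (x E.^ n) (ι e)))

    1<q² : 1 ℕ.< q ℕ.^ 2
    1<q² = E.1<q

    element = Inverse.from E.enumeration

    elements : Fin (suc (q ℕ.^ 2)) → E′.Carrier
    elements zero    = φ (F.0# , F.1#)
    elements (suc i) = element i , E.0#

    injective : Injective _≡_ _≡_ elements
    injective {zero}  {zero}  eq = refl
    injective {zero}  {suc j} eq = contradiction (ι-≡0 (cong proj₂ eq)) F.1≢0
    injective {suc i} {zero}  eq = contradiction (ι-≡0 (sym (cong proj₂ eq))) F.1≢0
    injective {suc i} {suc j} eq = cong suc (begin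
      i                                     ≡⟨ Inverse.strictlyInverseˡ E.enumeration i ⟨
      Inverse.to E.enumeration (element i)  ≡⟨ cong (Inverse.to E.enumeration ∘ proj₁) eq ⟩
      Inverse.to E.enumeration (element j)  ≡⟨ Inverse.strictlyInverseˡ E.enumeration j ⟩
      j                                     ∎)

    fixed : ∀ i → elements i E′.^ (q ℕ.^ 2) ≡ elements i
    fixed zero = begin
      φ t E′.^ (q ℕ.^ 2)     ≡⟨ φ-^ t (q ℕ.^ 2) ⟨
      φ (t F′.^ (q ℕ.^ 2))   ≡⟨ cong (λ n → φ (t F′.^ (q ℕ.* n))) (ℕ.*-identityʳ q) ⟩
      φ (t F′.^ (q ℕ.* q))   ≡⟨ cong φ (F′.x^q≡x t) ⟩
      φ t                    ∎
      where t = F.0# , F.1#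
    fixed (suc i) = trans (embed-^ (element i) (q ℕ.^ 2)) (cong (_, E.0#) (E.x^q≡x (element i)))

  -- Otherwise `X^q - X` would have `q + 1` roots in `E`, namely `η` and the images of the elements
  -- of `F`.
  conjugate-fixed : ∀ η → conjugate η ≡ η → ∃[ x ] ι x ≡ η
  conjugate-fixed η η^q≡η with F.any? (λ x → ι x E.≟ η)
  ... | yes fixed = fixed
  ... | no  η∉F = contradiction fixed (E.tooManyFixedPoints F.1<q elements injective)
    where
    element = Inverse.from F.enumeration

    elements : Fin (suc q) → E.Carrier
    elements zero    = η
    elements (suc i) = ι (element i)

    injective : Injective _≡_ _≡_ elements
    injective {zero}  {zero}  eq = refl
    injective {zero}  {suc j} eq = contradiction (_ , sym eq) η∉F
    injective {suc i} {zero}  eq = contradiction (_ , eq) η∉F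
    injective {suc i} {suc j} eq = cong suc (begin
      i                                     ≡⟨ Inverse.strictlyInverseˡ F.enumeration i ⟨
      Inverse.to F.enumeration (element i)  ≡⟨ cong (Inverse.to F.enumeration) (ι-injective eq) ⟩
      Inverse.to F.enumeration (element j)  ≡⟨ Inverse.strictlyInverseˡ F.enumeration j ⟩
      j                                     ∎)

    fixed : ∀ i → elements i E.^ q ≡ elements i
    fixed zero    = η^q≡η
    fixed (suc i) = conjugate-ι (element i)

  module _ (primePower : PrimePower q) where

    -- In `E` the sum of q² ones is zero. It is also a power of `p • 1#`, since q² is a power of
    -- `p`; hence `p • 1#` vanishes, and the q-th power is an iterate of the Frobenius map.
    conjugate-+ : ∀ x y → conjugate (x E.+ y) ≡ conjugate x E.+ conjugate y
    conjugate-+ x y =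
      subst (λ n → (x E.+ y) E.^ n ≡ x E.^ n E.+ y E.^ n) (sym q≡pʰ) (E.frobenius-^ p-prime p•1≡0 (suc h) x y)
      where
      p = proj₁ primePower
      h = proj₁ (proj₂ primePower)
      p-prime = proj₁ (proj₂ (proj₂ primePower))
      q≡pʰ = proj₂ (proj₂ (proj₂ primePower))

      p•1≡0 : p E.• E.1# ≡ E.0#
      p•1≡0 = E.^-zero (suc h) (E.^-zero 2 (begin
        ((p E.• E.1#) E.^ suc h) E.^ 2          ≡⟨ cong (E._^ 2) (E.•1-^ p (suc h)) ⟨
        ((p ℕ.^ suc h) E.• E.1#) E.^ 2          ≡⟨ E.•1-^ (p ℕ.^ suc h) 2 ⟨
        ((p ℕ.^ suc h) ℕ.^ 2) E.• E.1#          ≡⟨ cong (λ n → (n ℕ.^ 2) E.• E.1#) q≡pʰ ⟨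
        (q ℕ.^ 2) E.• E.1#                      ≡⟨ E.q•1≡0 ⟩
        E.0#                                    ∎))

    -- The coefficients lie in `F`, so `η̄` is a root along with `η`. It differs from `η`, since a
    -- fixed root would come from `F`. Subtracting the two equations and cancelling `η̄ - η` gives
    -- the sum, and the sum gives the product.
    conjugate-root : ∀ e → (∀ t → t F.* t F.+ F.1# ≢ e F.* t) →
      ∃[ η ] conjugate η ≢ η × η E.+ conjugate η ≡ ι e × η E.* conjugate η ≡ E.1#
    conjugate-root e noRoot with η , root ← root-in-E e noRoot = η , η̄≢η , η+η̄≡e , (begin
      η E.* η̄
        ≡⟨ E.solve 2 (λ x y → x E.:* y E.:= (x E.:+ y) E.:* x E.:- x E.:* x) refl η η̄ ⟩
      (η E.+ η̄) E.* η E.- η E.* η    ≡⟨ cong (λ z → z E.* η E.- η E.* η) η+η̄≡e ⟩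
      ι e E.* η E.- η E.* η           ≡⟨ cong (E._- η E.* η) root ⟨
      η E.* η E.+ E.1# E.- η E.* η
        ≡⟨ E.solve 1 (λ x → x E.:* x E.:+ E.con 1ℤ E.:- x E.:* x E.:= E.con 1ℤ) refl η ⟩
      E.1#                            ∎)
      where
      η̄ = conjugate η

      η̄≢η : η̄ ≢ η
      η̄≢η η̄≡η with t , refl ← conjugate-fixed η η̄≡η = noRoot t (ι-injective (begin
        ι (t F.* t F.+ F.1#)       ≡⟨ trans (ι-+ _ _) (cong₂ E._+_ (ι-* t t) ι-1) ⟩
        ι t E.* ι t E.+ E.1#       ≡⟨ root ⟩
        ι e E.* ι t                ≡⟨ ι-* e t ⟨
        ι (e F.* t)                ∎))

      conjugateRoot : η̄ E.* η̄ E.+ E.1# ≡ ι e E.* η̄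
      conjugateRoot = begin
        η̄ E.* η̄ E.+ E.1#                      ≡⟨ cong₂ E._+_ (conjugate-* η η) (E.1^n≡1 q) ⟨
        conjugate (η E.* η) E.+ conjugate E.1#  ≡⟨ conjugate-+ _ _ ⟨
        conjugate (η E.* η E.+ E.1#)            ≡⟨ cong conjugate root ⟩
        conjugate (ι e E.* η)                   ≡⟨ conjugate-* _ _ ⟩
        conjugate (ι e) E.* η̄                   ≡⟨ cong (E._* η̄) (conjugate-ι e) ⟩
        ι e E.* η̄                               ∎

      η+η̄≡e : η E.+ η̄ ≡ ι e
      η+η̄≡e = sym (E.x-y≡0⇒x≡y ([ (λ η̄-η≡0 → contradiction (E.x-y≡0⇒x≡y η̄-η≡0) η̄≢η) , (λ z → z) ]′
        (E.*-zero⇒ (η̄ E.- η) (ι e E.- (η E.+ η̄)) (begin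
          (η̄ E.- η) E.* (ι e E.- (η E.+ η̄))
            ≡⟨ E.solve 3 (λ x y e → (y E.:- x) E.:* (e E.:- (x E.:+ y)) E.:=
                 (e E.:* y E.:- (y E.:* y E.:+ E.con 1ℤ)) E.:- (e E.:* x E.:- (x E.:* x E.:+ E.con 1ℤ))) refl η η̄ (ι e) ⟩
          (ι e E.* η̄ E.- (η̄ E.* η̄ E.+ E.1#)) E.- (ι e E.* η E.- (η E.* η E.+ E.1#))
            ≡⟨ cong₂ E._-_ (E.x≡y⇒x-y≡0 (sym conjugateRoot)) (E.x≡y⇒x-y≡0 (sym root)) ⟩
          E.0# E.- E.0#   ≡⟨ E.-‿inverseʳ E.0# ⟩
          E.0#            ∎))))

-- Quadratic forms in three variables

-- Over any raw ring, so that the same formulas can be read both in a field,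
-- where they unfold to the definitions of Geometry and Distribution, and as
-- expressions of the ring solver.
module Forms {a ℓ} (R : RawRing a ℓ) where
  open RawRing R

  Matrix₃ : Set a
  Matrix₃ = Fin 3 → Fin 3 → Carrier

  column : Matrix₃ → Fin 3 → Fin 3 → Carrier
  column A j i = A i j

  quadratic : Vec Carrier 6 → (Fin 3 → Carrier) → Carrier
  quadratic (a₀₀ ∷ a₀₁ ∷ a₀₂ ∷ a₁₁ ∷ a₁₂ ∷ a₂₂ ∷ []) x =
    a₀₀ * (x 0F * x 0F) + a₀₁ * (x 0F * x 1F) + a₀₂ * (x 0F * x 2F)
      + a₁₁ * (x 1F * x 1F) + a₁₂ * (x 1F * x 2F) + a₂₂ * (x 2F * x 2F)

  -- The polarisation `f(x + y) - f(x) - f(y)`, which gives the mixed coefficients in characteristic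
  -- 2 as well.
  polar : Vec Carrier 6 → (x y : Fin 3 → Carrier) → Carrier
  polar (a₀₀ ∷ a₀₁ ∷ a₀₂ ∷ a₁₁ ∷ a₁₂ ∷ a₂₂ ∷ []) x y =
    (a₀₀ + a₀₀) * (x 0F * y 0F) + a₀₁ * (x 0F * y 1F + x 1F * y 0F) + a₀₂ * (x 0F * y 2F + x 2F * y 0F)
      + (a₁₁ + a₁₁) * (x 1F * y 1F) + a₁₂ * (x 1F * y 2F + x 2F * y 1F) + (a₂₂ + a₂₂) * (x 2F * y 2F)

  -- The coefficients of the quadratic form X ↦ f(AX).
  pull : Matrix₃ → Vec Carrier 6 → Vec Carrier 6
  pull A f =
    quadratic f (α 0F) ∷ polar f (α 0F) (α 1F) ∷ polar f (α 0F) (α 2F) ∷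
    quadratic f (α 1F) ∷ polar f (α 1F) (α 2F) ∷ quadratic f (α 2F) ∷ []
    where α = column A

  pullLinear : Matrix₃ → Vec Carrier 3 → Vec Carrier 3
  pullLinear A (l₀ ∷ l₁ ∷ l₂ ∷ []) = value 0F ∷ value 1F ∷ value 2F ∷ []
    where
    value : Fin 3 → Carrier
    value j = l₀ * A 0F j + l₁ * A 1F j + l₂ * A 2F j

  infixl 7 _∙_
  -- Bracketed to the right and ended by `0#`, as `sum` over `Fin 3` unfolds, so that it agrees with
  -- `_⊠_` by computation.
  _∙_ : Matrix₃ → Matrix₃ → Matrix₃
  (A ∙ B) i j = A i 0F * B 0F j + (A i 1F * B 1F j + (A i 2F * B 2F j + 0#))

  product : Vec Carrier 3 → Vec Carrier 3 → Vec Carrier 6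
  product (l₀ ∷ l₁ ∷ l₂ ∷ []) (m₀ ∷ m₁ ∷ m₂ ∷ []) =
    l₀ * m₀ ∷ l₀ * m₁ + l₁ * m₀ ∷ l₀ * m₂ + l₂ * m₀ ∷
    l₁ * m₁ ∷ l₁ * m₂ + l₂ * m₁ ∷ l₂ * m₂ ∷ []

  -- Half the determinant of the matrix of `polar`, with the factor 2 divided out formally, so that
  -- it stays meaningful in characteristic 2.
  discriminant : Vec Carrier 6 → Carrier
  discriminant (a₀₀ ∷ a₀₁ ∷ a₀₂ ∷ a₁₁ ∷ a₁₂ ∷ a₂₂ ∷ []) =
    (d + (d + (d + (d + 0#)))) + a₀₁ * a₀₂ * a₁₂ + - (a₀₀ * (a₁₂ * a₁₂))
      + - (a₁₁ * (a₀₂ * a₀₂)) + - (a₂₂ * (a₀₁ * a₀₁))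
    where d = a₀₀ * a₁₁ * a₂₂

  determinant : Matrix₃ → Carrier
  determinant A =
    A 0F 0F * (A 1F 1F * A 2F 2F + - (A 1F 2F * A 2F 1F)) +
    A 0F 1F * (A 1F 2F * A 2F 0F + - (A 1F 0F * A 2F 2F)) +
    A 0F 2F * (A 1F 0F * A 2F 1F + - (A 1F 1F * A 2F 0F))

  symmetric : Vec Carrier 6 → Matrix₃
  symmetric (y₀ ∷ y₁ ∷ y₂ ∷ y₃ ∷ y₄ ∷ y₅ ∷ []) i j =
    lookup (lookup ((y₀ ∷ y₁ ∷ y₂ ∷ []) ∷ (y₁ ∷ y₃ ∷ y₄ ∷ []) ∷ (y₂ ∷ y₄ ∷ y₅ ∷ []) ∷ []) i) j

  upperTriangle : Matrix₃ → Vec Carrier 6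
  upperTriangle M = M 0F 0F ∷ M 0F 1F ∷ M 0F 2F ∷ M 1F 1F ∷ M 1F 2F ∷ M 2F 2F ∷ []

  pairing : Vec Carrier 6 → Vec Carrier 6 → Carrier
  pairing (a₀₀ ∷ a₀₁ ∷ a₀₂ ∷ a₁₁ ∷ a₁₂ ∷ a₂₂ ∷ []) (y₀ ∷ y₁ ∷ y₂ ∷ y₃ ∷ y₄ ∷ y₅ ∷ []) =
    a₀₀ * y₀ + a₀₁ * y₁ + a₀₂ * y₂ + a₁₁ * y₃ + a₁₂ * y₄ + a₂₂ * y₅

-- Linear substitutions in quadratic and linear forms

module FormProperties {q} (F : FiniteField q) where
  open FieldProperties F
  open Vectors F
  open Geometry F using (identity)
  open Forms rawRing public
  open ≡-Reasoning

  polynomials : ℕ → RawRing _ _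
  polynomials n = record
    { Carrier = Polynomial n ; _≈_ = _≡_ ; _+_ = _:+_ ; _*_ = _:*_ ; -_ = :-_ ; 0# = con 0ℤ ; 1# = con 1ℤ }

  open IntegerSolver commutativeRing using () renaming (⟦_⟧ to ⟦_⟧ᴾ; ⟦_⟧↓ to ⟦_⟧⇓)

  module P {n} = Forms (polynomials n)

  proveAll : ∀ {n k} (ρ : Vec Carrier n) (es es′ : Vec (Polynomial n) k) →
             map (λ e → ⟦ e ⟧⇓ ρ) es ≡ map (λ e → ⟦ e ⟧⇓ ρ) es′ →
             map (λ e → ⟦ e ⟧ᴾ ρ) es ≡ map (λ e → ⟦ e ⟧ᴾ ρ) es′
  proveAll ρ []       []         _  = refl
  proveAll ρ (e ∷ es) (e′ ∷ es′) eq =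
    cong₂ _∷_ (prove ρ e e′ (∷-injectiveˡ eq)) (proveAll ρ es es′ (∷-injectiveʳ eq))

  entries : ∀ {a} {A : Set a} → (Fin 3 → Fin 3 → A) → Vec A 9
  entries A = concat (tabulate (λ i → tabulate (A i)))

  entries-cong : ∀ {A B : Matrix₃} → (∀ i j → A i j ≡ B i j) → entries A ≡ entries B
  entries-cong A≗B = cong concat (tabulate-cong (λ i → tabulate-cong (A≗B i)))

  fromEntries : Vec Carrier 9 → Matrix₃
  fromEntries v i j = lookup v (combine i j)

  -- Matrices are functions, and pointwise equality does not make them equal. Their vectors of nine
  -- entries are equal, and `pull` reads nothing else.
  pull-cong : ∀ {A B} → (∀ i j → A i j ≡ B i j) → ∀ f → pull A f ≡ pull B f
  pull-cong {A} {B} A≗B f@(_ ∷ _ ∷ _ ∷ _ ∷ _ ∷ _ ∷ []) =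
    cong (λ v → pull (fromEntries v) f) (entries-cong {A} {B} A≗B)

  pullLinear-cong : ∀ {A B} → (∀ i j → A i j ≡ B i j) → ∀ l → pullLinear A l ≡ pullLinear B l
  pullLinear-cong {A} {B} A≗B l@(_ ∷ _ ∷ _ ∷ []) =
    cong (λ v → pullLinear (fromEntries v) l) (entries-cong {A} {B} A≗B)

  private
    -- A generic matrix inside a longer list of variables: `k` variables precede its nine entries
    -- and `n` follow them.
    matrixᴾ : ∀ {n} k → Fin 3 → Fin 3 → Polynomial (k ℕ.+ (9 ℕ.+ n))
    matrixᴾ {n} k i j = var (k ↑ʳ (combine i j ↑ˡ n))

    vectorᴾ : ∀ {n} k m → Vec (Polynomial (k ℕ.+ (m ℕ.+ n))) m
    vectorᴾ {n} k m = tabulate (λ i → var (k ↑ʳ (i ↑ˡ n)))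

    identityᴾ : ∀ {n} → Fin 3 → Fin 3 → Polynomial n
    identityᴾ i j = lookup (lookup ((con 1ℤ ∷ con 0ℤ ∷ con 0ℤ ∷ []) ∷ (con 0ℤ ∷ con 1ℤ ∷ con 0ℤ ∷ []) ∷
                                    (con 0ℤ ∷ con 0ℤ ∷ con 1ℤ ∷ []) ∷ []) i) j

  pull-identity : ∀ f → pull identity f ≡ f
  pull-identity f@(_ ∷ _ ∷ _ ∷ _ ∷ _ ∷ _ ∷ []) =
    proveAll f (P.pull identityᴾ (vectorᴾ {0} 0 6)) (vectorᴾ {0} 0 6) refl

  pullLinear-identity : ∀ l → pullLinear identity l ≡ l
  pullLinear-identity l@(_ ∷ _ ∷ _ ∷ []) =
    proveAll l (P.pullLinear identityᴾ (vectorᴾ {0} 0 3)) (vectorᴾ {0} 0 3) refl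

  pull-∙ : ∀ A B f → pull B (pull A f) ≡ pull (A ∙ B) f
  pull-∙ A B f@(_ ∷ _ ∷ _ ∷ _ ∷ _ ∷ _ ∷ []) = proveAll (entries A ++ entries B ++ f)
    (P.pull Bᴾ (P.pull Aᴾ fᴾ)) (P.pull (P._∙_ Aᴾ Bᴾ) fᴾ) refl
    where
    Aᴾ = matrixᴾ {15} 0
    Bᴾ = matrixᴾ {6} 9
    fᴾ = vectorᴾ {0} 18 6

  pullLinear-∙ : ∀ A B l → pullLinear B (pullLinear A l) ≡ pullLinear (A ∙ B) l
  pullLinear-∙ A B l@(_ ∷ _ ∷ _ ∷ []) = proveAll (entries A ++ entries B ++ l)
    (P.pullLinear Bᴾ (P.pullLinear Aᴾ lᴾ)) (P.pullLinear (P._∙_ Aᴾ Bᴾ) lᴾ) refl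
    where
    Aᴾ = matrixᴾ {12} 0
    Bᴾ = matrixᴾ {3} 9
    lᴾ = vectorᴾ {0} 18 3

  pull-inverse : ∀ {A B} → (∀ i j → (A ∙ B) i j ≡ identity i j) → ∀ f → pull B (pull A f) ≡ f
  pull-inverse {A} {B} AB≡1 f = trans (pull-∙ A B f) (trans (pull-cong AB≡1 f) (pull-identity f))

  pullLinear-inverse : ∀ {A B} → (∀ i j → (A ∙ B) i j ≡ identity i j) → ∀ l → pullLinear B (pullLinear A l) ≡ l
  pullLinear-inverse {A} {B} AB≡1 l =
    trans (pullLinear-∙ A B l) (trans (pullLinear-cong AB≡1 l) (pullLinear-identity l))

  pull-⊗ : ∀ A l m → pull A (l ⊗ m) ≡ pullLinear A l ⊗ pullLinear A m
  pull-⊗ A l@(_ ∷ _ ∷ _ ∷ []) m@(_ ∷ _ ∷ _ ∷ []) = proveAll (entries A ++ l ++ m)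
    (P.pull Aᴾ (P.product lᴾ mᴾ)) (P.product (P.pullLinear Aᴾ lᴾ) (P.pullLinear Aᴾ mᴾ)) refl
    where
    Aᴾ = matrixᴾ {6} 0
    lᴾ = vectorᴾ {3} 9 3
    mᴾ = vectorᴾ {0} 12 3

  pull-⊙ : ∀ A c f → pull A (c ⊙ f) ≡ c ⊙ pull A f
  pull-⊙ A c f@(_ ∷ _ ∷ _ ∷ _ ∷ _ ∷ _ ∷ []) = proveAll (entries A ++ f ++ c ∷ [])
    (P.pull Aᴾ (map (cᴾ :*_) fᴾ)) (map (cᴾ :*_) (P.pull Aᴾ fᴾ)) refl
    where
    Aᴾ = matrixᴾ {7} 0
    fᴾ = vectorᴾ {1} 9 6
    cᴾ = var (15 ↑ʳ 0F)

  pullLinear-⊙ : ∀ A c l → pullLinear A (c ⊙ l) ≡ c ⊙ pullLinear A l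
  pullLinear-⊙ A c l@(_ ∷ _ ∷ _ ∷ []) = proveAll (entries A ++ l ++ c ∷ [])
    (P.pullLinear Aᴾ (map (cᴾ :*_) lᴾ)) (map (cᴾ :*_) (P.pullLinear Aᴾ lᴾ)) refl
    where
    Aᴾ = matrixᴾ {4} 0
    lᴾ = vectorᴾ {1} 9 3
    cᴾ = var (12 ↑ʳ 0F)

  ⊙-𝟎 : ∀ {n} (v : Vec Carrier n) → 0# ⊙ v ≡ 𝟎
  ⊙-𝟎 []      = refl
  ⊙-𝟎 (x ∷ v) = cong₂ _∷_ (zeroˡ x) (⊙-𝟎 v)

  pull-𝟎 : ∀ A → pull A 𝟎 ≡ 𝟎
  pull-𝟎 A = begin
    pull A 𝟎           ≡⟨ cong (pull A) (⊙-𝟎 𝟎) ⟨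
    pull A (0# ⊙ 𝟎)    ≡⟨ pull-⊙ A 0# 𝟎 ⟩
    0# ⊙ pull A 𝟎      ≡⟨ ⊙-𝟎 _ ⟩
    𝟎                  ∎

  pull-∼ : ∀ A {f g} → f ∼ g → pull A f ∼ pull A g
  pull-∼ A {f} (c , c≢0 , refl) = c , c≢0 , pull-⊙ A c f

  pullLinear-∼ : ∀ A {l m} → l ∼ m → pullLinear A l ∼ pullLinear A m
  pullLinear-∼ A {l} (c , c≢0 , refl) = c , c≢0 , pullLinear-⊙ A c l

  -- A polynomial identity with integer coefficients, hence valid also in characteristic 2, where a
  -- quadratic form need not have a symmetric matrix.
  discriminant-pull : ∀ A f → discriminant (pull A f) ≡ determinant A * determinant A * discriminant f
  discriminant-pull A f@(_ ∷ _ ∷ _ ∷ _ ∷ _ ∷ _ ∷ []) = prove (entries A ++ f)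
    (P.discriminant (P.pull Aᴾ fᴾ)) (P.determinant Aᴾ :* P.determinant Aᴾ :* P.discriminant fᴾ) refl
    where
    Aᴾ = matrixᴾ {6} 0
    fᴾ = vectorᴾ {0} 9 6

  discriminant-⊗ : ∀ l m → discriminant (l ⊗ m) ≡ 0#
  discriminant-⊗ l@(_ ∷ _ ∷ _ ∷ []) m@(_ ∷ _ ∷ _ ∷ []) = prove (l ++ m)
    (P.discriminant (P.product (vectorᴾ {3} 0 3) (vectorᴾ {0} 3 3))) (con 0ℤ) refl

  discriminant-⊙ : ∀ c f → discriminant (c ⊙ f) ≡ c * c * c * discriminant f
  discriminant-⊙ c f@(_ ∷ _ ∷ _ ∷ _ ∷ _ ∷ _ ∷ []) = prove (f ++ c ∷ [])
    (P.discriminant (map (cᴾ :*_) fᴾ)) (cᴾ :* cᴾ :* cᴾ :* P.discriminant fᴾ) refl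
    where
    fᴾ = vectorᴾ {1} 0 6
    cᴾ = var (6 ↑ʳ 0F)

  diagonal : Carrier → Carrier → Vec Carrier 6
  diagonal x y = x ∷ 0# ∷ 0# ∷ y ∷ 0# ∷ - y ∷ []

  -- Read as a matrix, `column A` is the transpose of `A`.
  congruent : Matrix₃ → Carrier → Carrier → Matrix₃
  congruent A x y = A ∙ symmetric (diagonal x y) ∙ column A

  private
    congruentᴾ : Fin 3 → Fin 3 → Polynomial 11
    congruentᴾ = P._∙_ (P._∙_ Aᴾ (P.symmetric (xᴾ ∷ con 0ℤ ∷ con 0ℤ ∷ yᴾ ∷ con 0ℤ ∷ :- yᴾ ∷ []))) (P.column Aᴾ)
      where
      Aᴾ = matrixᴾ {2} 0
      xᴾ = var (9 ↑ʳ 0F)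
      yᴾ = var (9 ↑ʳ 1F)

  congruent-symmetric : ∀ A x y i j → symmetric (upperTriangle (congruent A x y)) i j ≡ congruent A x y i j
  congruent-symmetric A x y 0F 0F = refl
  congruent-symmetric A x y 0F 1F = refl
  congruent-symmetric A x y 0F 2F = refl
  congruent-symmetric A x y 1F 0F = prove (entries A ++ x ∷ y ∷ []) (congruentᴾ 0F 1F) (congruentᴾ 1F 0F) refl
  congruent-symmetric A x y 1F 1F = refl
  congruent-symmetric A x y 1F 2F = refl
  congruent-symmetric A x y 2F 0F = prove (entries A ++ x ∷ y ∷ []) (congruentᴾ 0F 2F) (congruentᴾ 2F 0F) refl
  congruent-symmetric A x y 2F 1F = prove (entries A ++ x ∷ y ∷ []) (congruentᴾ 1F 2F) (congruentᴾ 2F 1F) refl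
  congruent-symmetric A x y 2F 2F = refl

  -- Pairing `f` with the rank one matrix of a vector `v` gives the value of `f` at `v`. For the
  -- columns α₀, α₁, α₂ of `A`, both sides are therefore `x f(α₀) + y f(α₁) - y f(α₂)`.
  pairing-congruent : ∀ A x y f → pairing f (upperTriangle (congruent A x y)) ≡ pairing (pull A f) (diagonal x y)
  pairing-congruent A x y f@(_ ∷ _ ∷ _ ∷ _ ∷ _ ∷ _ ∷ []) = prove (entries A ++ x ∷ y ∷ f)
    (P.pairing fᴾ (P.upperTriangle (P._∙_ (P._∙_ Aᴾ (P.symmetric d)) (P.column Aᴾ)))) (P.pairing (P.pull Aᴾ fᴾ) d) refl
    where
    Aᴾ = matrixᴾ {8} 0
    xᴾ = var (9 ↑ʳ 0F)
    yᴾ = var (9 ↑ʳ 1F)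
    fᴾ = vectorᴾ {0} 11 6
    d = xᴾ ∷ con 0ℤ ∷ con 0ℤ ∷ yᴾ ∷ con 0ℤ ∷ :- yᴾ ∷ []

  pairing-⊙ : ∀ f c v → pairing f (c ⊙ v) ≡ c * pairing f v
  pairing-⊙ f@(_ ∷ _ ∷ _ ∷ _ ∷ _ ∷ _ ∷ []) c v@(_ ∷ _ ∷ _ ∷ _ ∷ _ ∷ _ ∷ []) = prove (c ∷ f ++ v)
    (P.pairing fᴾ (map (var 0F :*_) vᴾ)) (var 0F :* P.pairing fᴾ vᴾ) refl
    where
    fᴾ = vectorᴾ {6} 1 6
    vᴾ = vectorᴾ {0} 7 6

  binary-⊗ : ∀ x y → 0# ∷ 0# ∷ 0# ∷ 1# ∷ x + y ∷ x * y ∷ [] ≡ (0# ∷ 1# ∷ x ∷ []) ⊗ (0# ∷ 1# ∷ y ∷ [])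
  binary-⊗ x y = proveAll (x ∷ y ∷ [])
    (con 0ℤ ∷ con 0ℤ ∷ con 0ℤ ∷ con 1ℤ ∷ var 0F :+ var 1F ∷ var 0F :* var 1F ∷ [])
    (P.product (con 0ℤ ∷ con 1ℤ ∷ var 0F ∷ []) (con 0ℤ ∷ con 1ℤ ∷ var 1F ∷ [])) refl

-- The hyperplanes through the representative line

module NormalForms {q} (F : FiniteField q) where
  open FieldProperties F
  open FormProperties F
  open Vectors F
  open ≡-Reasoning

  -- One value for each point of PG(3,q), sorted by the first nonzero one among b, c, d, e, so q³ +
  -- q² + q + 1 values in all. In `cone₁` the parameters `n` and `r` replace the last two free
  -- coefficients, so that `r` alone decides whether the form splits.
  NormalForm : Set
  NormalForm = (Carrier × Carrier × Carrier) ⊎ (Carrier × Carrier) ⊎ Carrier ⊎ ⊤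

  pattern cone₁ c n r = inj₁ (c , n , r)
  pattern cone₂ m r   = inj₂ (inj₁ (m , r))
  pattern binary e    = inj₂ (inj₂ (inj₁ e))
  pattern crossing    = inj₂ (inj₂ (inj₂ tt))

  -- In order: (X₁ + cX₂)(X₀ + cnX₁ + nX₂) + r(X₁² + cX₁X₂ + X₂²),
  -- X₂(X₀ + mX₁) + r(X₁² + X₂²), X₁² + eX₁X₂ + X₂² and X₁X₂.
  form : NormalForm → Vec Carrier 6
  form (cone₁ c n r) = 0# ∷ 1# ∷ c ∷ c * n + r ∷ n + c * (c * n + r) ∷ c * n + r ∷ []
  form (cone₂ m r)   = 0# ∷ 0# ∷ 1# ∷ r ∷ m ∷ r ∷ []
  form (binary e)    = 0# ∷ 0# ∷ 0# ∷ 1# ∷ e ∷ 1# ∷ []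
  form crossing      = 0# ∷ 0# ∷ 0# ∷ 0# ∷ 1# ∷ 0# ∷ []

  Balanced : Pred (Vec Carrier 6) 0ℓ
  Balanced (a₀₀ ∷ _ ∷ _ ∷ a₁₁ ∷ _ ∷ a₂₂ ∷ []) = a₀₀ ≡ 0# × a₁₁ ≡ a₂₂

  form-balanced : ∀ nf → Balanced (form nf)
  form-balanced (cone₁ c n r) = refl , refl
  form-balanced (cone₂ m r)   = refl , refl
  form-balanced (binary e)    = refl , refl
  form-balanced crossing      = refl , refl

  form≢𝟎 : ∀ nf → form nf ≢ 𝟎
  form≢𝟎 (cone₁ c n r) eq = 1≢0 (cong (λ v → lookup v 1F) eq)
  form≢𝟎 (cone₂ m r)   eq = 1≢0 (cong (λ v → lookup v 2F) eq)
  form≢𝟎 (binary e)    eq = 1≢0 (cong (λ v → lookup v 3F) eq)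
  form≢𝟎 crossing      eq = 1≢0 (cong (λ v → lookup v 4F) eq)

  normalise : ∀ g → g ≢ 𝟎 → Balanced g → ∃[ nf ] form nf ∼ g
  normalise (a₀₀ ∷ b ∷ c ∷ d ∷ e ∷ .d ∷ []) g≢0 (refl , refl) = byLeading (b ≟ 0#) (c ≟ 0#) (d ≟ 0#)
    where
    byLeading : Dec (b ≡ 0#) → Dec (c ≡ 0#) → Dec (d ≡ 0#) → ∃[ nf ] form nf ∼ (0# ∷ b ∷ c ∷ d ∷ e ∷ d ∷ [])
    byLeading (no b≢0) _ _ with b⁻¹ , bb⁻¹≡1 ← inverse b b≢0 = cone₁ c′ n r , b , b≢0 , sym (begin
      b ⊙ form (cone₁ c′ n r)
        ≡⟨ cong₂ (λ x y → b ⊙ (0# ∷ 1# ∷ c′ ∷ x ∷ y ∷ x ∷ []))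
             (solve 3 (λ c d e → c :* (e :- c :* d) :+ (d :- c :* (e :- c :* d)) := d) refl c′ d′ e′)
             (solve 3 (λ c d e → e :- c :* d :+ c :* (c :* (e :- c :* d) :+ (d :- c :* (e :- c :* d))) := e) refl c′ d′ e′) ⟩
      b ⊙ (0# ∷ 1# ∷ c′ ∷ d′ ∷ e′ ∷ d′ ∷ [])
        ≡⟨ cong₂ _∷_ (zeroʳ b) (cong₂ _∷_ (*-identityʳ b) (cong₂ _∷_ (x[yz]≡z bb⁻¹≡1 c) (cong₂ _∷_ (x[yz]≡z bb⁻¹≡1 d)
             (cong₂ _∷_ (x[yz]≡z bb⁻¹≡1 e) (cong₂ _∷_ (x[yz]≡z bb⁻¹≡1 d) refl))))) ⟩
      0# ∷ b ∷ c ∷ d ∷ e ∷ d ∷ [] ∎)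
      where
      c′ = b⁻¹ * c
      d′ = b⁻¹ * d
      e′ = b⁻¹ * e
      -- These solve `d′ = c′n + r` and `e′ = n + c′d′`.
      n = e′ - c′ * d′
      r = d′ - c′ * n
    byLeading (yes refl) (no c≢0) _ with c⁻¹ , cc⁻¹≡1 ← inverse c c≢0 = cone₂ (c⁻¹ * e) (c⁻¹ * d) , c , c≢0 ,
      cong₂ _∷_ (sym (zeroʳ c)) (cong₂ _∷_ (sym (zeroʳ c)) (cong₂ _∷_ (sym (*-identityʳ c)) (cong₂ _∷_ (sym (x[yz]≡z cc⁻¹≡1 d))
             (cong₂ _∷_ (sym (x[yz]≡z cc⁻¹≡1 e)) (cong₂ _∷_ (sym (x[yz]≡z cc⁻¹≡1 d)) refl)))))
    byLeading (yes refl) (yes refl) (no d≢0) with d⁻¹ , dd⁻¹≡1 ← inverse d d≢0 = binary (d⁻¹ * e) , d , d≢0 ,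
      cong₂ _∷_ (sym (zeroʳ d)) (cong₂ _∷_ (sym (zeroʳ d)) (cong₂ _∷_ (sym (zeroʳ d)) (cong₂ _∷_ (sym (*-identityʳ d))
             (cong₂ _∷_ (sym (x[yz]≡z dd⁻¹≡1 e)) (cong₂ _∷_ (sym (*-identityʳ d)) refl)))))
    byLeading (yes refl) (yes refl) (yes refl) = crossing , e , (λ { refl → g≢0 refl }) ,
      cong₂ _∷_ (sym (zeroʳ e)) (cong₂ _∷_ (sym (zeroʳ e)) (cong₂ _∷_ (sym (zeroʳ e)) (cong₂ _∷_ (sym (zeroʳ e))
             (cong₂ _∷_ (sym (*-identityʳ e)) (cong₂ _∷_ (sym (zeroʳ e)) refl)))))

  private
    at : ∀ i {f g : Vec Carrier 6} → f ≡ g → lookup f i ≡ lookup g i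
    at i = cong (λ v → lookup v i)

    zero-one : ∀ {k} → k ≢ 0# → 0# ≢ k * 1#
    zero-one k≢0 eq = k≢0 (trans (sym (*-identityʳ _)) (sym eq))

    one-zero : ∀ {k} → 1# ≢ k * 0#
    one-zero {k} eq = 1≢0 (trans eq (zeroʳ k))

    unscale : ∀ {k} {f g : Vec Carrier 6} → 1# ≡ k * 1# → f ≡ k ⊙ g → f ≡ g
    unscale {k} {f} {g} 1≡k f≡kg = trans f≡kg (trans (cong (_⊙ g) (trans (sym (*-identityʳ k)) (sym 1≡k))) (⊙-identity g))

    cone₁-injective : ∀ {c n r c′ n′ r′} → form (cone₁ c n r) ≡ form (cone₁ c′ n′ r′) →
                      (c , n , r) ≡ (c′ , n′ , r′)
    cone₁-injective {c} {n} {r} {c′} {n′} {r′} eq with refl ← at 2F eq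
      with refl ← AG.∙-cancelʳ (c * (c * n + r)) n n′
                    (trans (at 4F eq) (cong (λ d → n′ + c * d) (sym (at 3F eq))))
      with refl ← AG.∙-cancelˡ (c * n) r r′ (at 3F eq) = refl

  -- The first nonzero coefficient of each `form` is `1#`, and its position identifies the family.
  -- Proportional forms thus belong to the same family, with scalar 1.
  form-injective : ∀ x y → form x ∼ form y → x ≡ y
  form-injective (cone₁ _ _ _) (cone₁ _ _ _) (k , k≢0 , eq) = cong inj₁ (cone₁-injective (sym (unscale (at 1F eq) eq)))
  form-injective (cone₁ _ _ _) (cone₂ _ _)   (k , k≢0 , eq) = ⊥-elim (zero-one k≢0 (at 1F eq))
  form-injective (cone₁ _ _ _) (binary _)    (k , k≢0 , eq) = ⊥-elim (zero-one k≢0 (at 1F eq))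
  form-injective (cone₁ _ _ _) crossing      (k , k≢0 , eq) = ⊥-elim (zero-one k≢0 (at 1F eq))
  form-injective (cone₂ _ _)   (cone₁ _ _ _) (k , k≢0 , eq) = ⊥-elim (one-zero (at 1F eq))
  form-injective (cone₂ _ _)   (cone₂ _ _)   (k , k≢0 , eq) with eq′ ← unscale (at 2F eq) eq =
    cong₂ cone₂′ (sym (at 4F eq′)) (sym (at 3F eq′))
    where cone₂′ = λ m r → cone₂ m r
  form-injective (cone₂ _ _)   (binary _)    (k , k≢0 , eq) = ⊥-elim (zero-one k≢0 (at 2F eq))
  form-injective (cone₂ _ _)   crossing      (k , k≢0 , eq) = ⊥-elim (zero-one k≢0 (at 2F eq))
  form-injective (binary _)    (cone₁ _ _ _) (k , k≢0 , eq) = ⊥-elim (one-zero (at 1F eq))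
  form-injective (binary _)    (cone₂ _ _)   (k , k≢0 , eq) = ⊥-elim (one-zero (at 2F eq))
  form-injective (binary _)    (binary _)    (k , k≢0 , eq) = cong (λ e → binary e) (sym (at 4F (unscale (at 3F eq) eq)))
  form-injective (binary _)    crossing      (k , k≢0 , eq) = ⊥-elim (zero-one k≢0 (at 3F eq))
  form-injective crossing      (cone₁ _ _ _) (k , k≢0 , eq) = ⊥-elim (one-zero (at 1F eq))
  form-injective crossing      (cone₂ _ _)   (k , k≢0 , eq) = ⊥-elim (one-zero (at 2F eq))
  form-injective crossing      (binary _)    (k , k≢0 , eq) = ⊥-elim (one-zero (at 3F eq))
  form-injective crossing      crossing      _              = refl

  IsRootOf : Carrier → Carrier → Set
  IsRootOf e t = t * t + 1# ≡ e * t

  root-product : ∀ {e t} → IsRootOf e t → t * (e - t) ≡ 1#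
  root-product {e} {t} root = begin
    t * (e - t)                 ≡⟨ solve 2 (λ t e → t :* (e :- t) := e :* t :- t :* t) refl t e ⟩
    e * t - t * t               ≡⟨ cong (_- t * t) root ⟨
    t * t + 1# - t * t          ≡⟨ solve 1 (λ t → t :* t :+ con 1ℤ :- t :* t := con 1ℤ) refl t ⟩
    1#                          ∎

  -- The number of distinct t with X₁² + eX₁X₂ + X₂² = (X₁ + tX₂)(X₁ + t⁻¹X₂).
  NoRoot DoubleRoot TwoRoots : Pred Carrier 0ℓ
  NoRoot     e = ∀ t → ¬ IsRootOf e t
  DoubleRoot e = ∃[ t ] (t * t ≡ 1# × t + t ≡ e)
  TwoRoots   e = ∃[ t ] (IsRootOf e t × t * t ≢ 1#)

  -- Assembled from sums and products of predicates in the shape of `NormalForm`, so that their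
  -- sizes are sums and products too.
  IsDoubleLine IsRealPair IsImaginaryPair IsConic : Pred NormalForm 0ℓ
  IsDoubleLine    = ∅ ⟨⊎⟩ ∅ ⟨⊎⟩ DoubleRoot ⟨⊎⟩ ∅
  IsRealPair      = (U ⟨×⟩ U ⟨×⟩ (0# ≡_)) ⟨⊎⟩ (U ⟨×⟩ (0# ≡_)) ⟨⊎⟩ TwoRoots ⟨⊎⟩ U
  IsImaginaryPair = ∅ ⟨⊎⟩ ∅ ⟨⊎⟩ NoRoot ⟨⊎⟩ ∅
  IsConic         = (U ⟨×⟩ U ⟨×⟩ (_≢ 0#)) ⟨⊎⟩ (U ⟨×⟩ (_≢ 0#)) ⟨⊎⟩ ∅ ⟨⊎⟩ ∅

  discriminant-cone₁ : ∀ c n r → discriminant (form (cone₁ c n r)) ≡ - r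
  discriminant-cone₁ c n r = prove (c ∷ n ∷ r ∷ [])
    (P.discriminant (con 0ℤ ∷ con 1ℤ ∷ c′ ∷ c′ :* n′ :+ r′ ∷ n′ :+ c′ :* (c′ :* n′ :+ r′) ∷ c′ :* n′ :+ r′ ∷ []))
    (:- r′) refl
    where
    c′ = var 0F
    n′ = var 1F
    r′ = var 2F

  discriminant-cone₂ : ∀ m r → discriminant (form (cone₂ m r)) ≡ - r
  discriminant-cone₂ m r = prove (m ∷ r ∷ [])
    (P.discriminant (con 0ℤ ∷ con 0ℤ ∷ con 1ℤ ∷ var 1F ∷ var 0F ∷ var 1F ∷ [])) (:- var 1F) refl

  discriminant-binary : ∀ x e y → discriminant (0# ∷ 0# ∷ 0# ∷ x ∷ e ∷ y ∷ []) ≡ 0#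
  discriminant-binary x e y = prove (x ∷ e ∷ y ∷ [])
    (P.discriminant (con 0ℤ ∷ con 0ℤ ∷ con 0ℤ ∷ var 0F ∷ var 1F ∷ var 2F ∷ [])) (con 0ℤ) refl

  private
    -0≡0 : - 0# ≡ 0#
    -0≡0 = AG.ε⁻¹≈ε

    -≡0 : ∀ {x} → - x ≡ 0# → 0# ≡ x
    -≡0 {x} -x≡0 = trans (sym -0≡0) (trans (cong -_ (sym -x≡0)) (AG.⁻¹-involutive x))

  conic⇒ : ∀ nf → discriminant (form nf) ≢ 0# → IsConic nf
  conic⇒ (cone₁ c n r) d≢0 = _ , _ , λ { refl → d≢0 (trans (discriminant-cone₁ c n 0#) -0≡0) }
  conic⇒ (cone₂ m r)   d≢0 = _ , λ { refl → d≢0 (trans (discriminant-cone₂ m 0#) -0≡0) }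
  conic⇒ (binary e)    d≢0 = d≢0 (discriminant-binary 1# e 1#)
  conic⇒ crossing      d≢0 = d≢0 (discriminant-binary 0# 1# 0#)

  conic⇐ : ∀ nf → IsConic nf → discriminant (form nf) ≢ 0#
  conic⇐ (cone₁ c n r) (_ , _ , r≢0) d≡0 = r≢0 (sym (-≡0 (trans (sym (discriminant-cone₁ c n r)) d≡0)))
  conic⇐ (cone₂ m r)   (_ , r≢0)     d≡0 = r≢0 (sym (-≡0 (trans (sym (discriminant-cone₂ m r)) d≡0)))
  conic⇐ (binary e)    ()
  conic⇐ crossing      ()

  private
    -- The identity `(2cxy)² = cx² · 4cy²` makes the mixed coefficient of a scaled square vanish
    -- together with an outer one.
    no-square : ∀ c x y → 0# ≡ c * (x * x) → 1# ≢ c * (x * y + y * x)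
    no-square c x y sq≡0 cross≡1 = 1≢0 (begin
      1#                                           ≡⟨ *-identityˡ 1# ⟨
      1# * 1#                                      ≡⟨ cong₂ _*_ cross≡1 cross≡1 ⟩
      c * (x * y + y * x) * (c * (x * y + y * x))  ≡⟨ solve 3 (λ c x y →
          c :* (x :* y :+ y :* x) :* (c :* (x :* y :+ y :* x)) :=
          c :* (x :* x) :* (c :* (y :* y :+ y :* y :+ (y :* y :+ y :* y)))) refl c x y ⟩
      c * (x * x) * (c * (y * y + y * y + (y * y + y * y))) ≡⟨ cong (_* _) sq≡0 ⟨
      0# * (c * (y * y + y * y + (y * y + y * y)))     ≡⟨ zeroˡ _ ⟩
      0#                                           ∎)

  doubleLine⇒ : ∀ nf c l → form nf ≡ c ⊙ (l ⊗ l) → IsDoubleLine nf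
  doubleLine⇒ (cone₁ _ _ _) c (l₀ ∷ l₁ ∷ l₂ ∷ []) eq = no-square c l₀ l₁ (at 0F eq) (at 1F eq)
  doubleLine⇒ (cone₂ _ _)   c (l₀ ∷ l₁ ∷ l₂ ∷ []) eq = no-square c l₀ l₂ (at 0F eq) (at 2F eq)
  -- Both outer coefficients of `c(l₁X₁ + l₂X₂)²` are 1, so `t = cl₁l₂` satisfies
  -- `t² = cl₁² · cl₂² = 1`.
  doubleLine⇒ (binary e)    c (l₀ ∷ l₁ ∷ l₂ ∷ []) eq = c * (l₁ * l₂)
    , (begin
      c * (l₁ * l₂) * (c * (l₁ * l₂))
        ≡⟨ solve 3 (λ c x y → c :* (x :* y) :* (c :* (x :* y)) := c :* (x :* x) :* (c :* (y :* y))) refl c l₁ l₂ ⟩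
      c * (l₁ * l₁) * (c * (l₂ * l₂))  ≡⟨ cong₂ _*_ (at 3F eq) (at 5F eq) ⟨
      1# * 1#                          ≡⟨ *-identityˡ 1# ⟩
      1#                               ∎)
    , (begin
      c * (l₁ * l₂) + c * (l₁ * l₂)
        ≡⟨ solve 3 (λ c x y → c :* (x :* y) :+ c :* (x :* y) := c :* (x :* y :+ y :* x)) refl c l₁ l₂ ⟩
      c * (l₁ * l₂ + l₂ * l₁)          ≡⟨ at 4F eq ⟨
      e                                ∎)
  doubleLine⇒ crossing      c (l₀ ∷ l₁ ∷ l₂ ∷ []) eq = no-square c l₁ l₂ (at 3F eq) (at 4F eq)

  doubleLine⇐ : ∀ nf → IsDoubleLine nf → ∃[ c ] ∃[ l ] form nf ≡ c ⊙ (l ⊗ l)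
  doubleLine⇐ (cone₁ _ _ _) ()
  doubleLine⇐ (cone₂ _ _)   ()
  doubleLine⇐ (binary e)    (t , tt≡1 , refl) = 1# , (0# ∷ 1# ∷ t ∷ []) , (begin
    0# ∷ 0# ∷ 0# ∷ 1# ∷ t + t ∷ 1# ∷ []            ≡⟨ cong (λ x → 0# ∷ 0# ∷ 0# ∷ 1# ∷ t + t ∷ x ∷ []) tt≡1 ⟨
    0# ∷ 0# ∷ 0# ∷ 1# ∷ t + t ∷ t * t ∷ []         ≡⟨ binary-⊗ t t ⟩
    (0# ∷ 1# ∷ t ∷ []) ⊗ (0# ∷ 1# ∷ t ∷ [])        ≡⟨ ⊙-identity _ ⟨
    1# ⊙ ((0# ∷ 1# ∷ t ∷ []) ⊗ (0# ∷ 1# ∷ t ∷ [])) ∎)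
  doubleLine⇐ crossing      ()

  private
    scaled-singular : ∀ {k} l m nf → form nf ≡ k ⊙ (l ⊗ m) → discriminant (form nf) ≡ 0#
    scaled-singular {k} l m nf eq = begin
      discriminant (form nf)          ≡⟨ cong discriminant eq ⟩
      discriminant (k ⊙ (l ⊗ m))      ≡⟨ discriminant-⊙ k (l ⊗ m) ⟩
      k * k * k * discriminant (l ⊗ m) ≡⟨ cong (k * k * k *_) (discriminant-⊗ l m) ⟩
      k * k * k * 0#                  ≡⟨ zeroʳ _ ⟩
      0#                              ∎

    -- Restricted to `X₀` and `X₁` the product is `X₁²`, so both factors are multiples of `X₁`.
    -- Concretely, multiplying `l₀²` or `m₀²` by `kl₁m₁ = 1` yields a combination of the two
    -- vanishing coefficients.
    factors-at-0 : ∀ {k l₀ l₁ m₀ m₁} → 0# ≡ k * (l₀ * m₀) → 0# ≡ k * (l₀ * m₁ + l₁ * m₀) →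
                   1# ≡ k * (l₁ * m₁) → l₀ ≡ 0# × m₀ ≡ 0#
    factors-at-0 {k} {l₀} {l₁} {m₀} {m₁} e₀ e₁ e₃ =
        square-zero (begin
          l₀ * l₀
            ≡⟨ *-identityˡ _ ⟨
          1# * (l₀ * l₀)
            ≡⟨ cong (_* (l₀ * l₀)) e₃ ⟩
          k * (l₁ * m₁) * (l₀ * l₀)
            ≡⟨ solve 5 (λ k l₀ l₁ m₀ m₁ → k :* (l₁ :* m₁) :* (l₀ :* l₀) :=
                 k :* (l₀ :* m₁ :+ l₁ :* m₀) :* (l₀ :* l₁) :- k :* (l₀ :* m₀) :* (l₁ :* l₁)) refl k l₀ l₁ m₀ m₁ ⟩
          k * (l₀ * m₁ + l₁ * m₀) * (l₀ * l₁) - k * (l₀ * m₀) * (l₁ * l₁)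
            ≡⟨ cong₂ (λ x y → x * (l₀ * l₁) - y * (l₁ * l₁)) e₁ e₀ ⟨
          0# * (l₀ * l₁) - 0# * (l₁ * l₁)
            ≡⟨ solve 2 (λ x y → con 0ℤ :* x :- con 0ℤ :* y := con 0ℤ) refl (l₀ * l₁) (l₁ * l₁) ⟩
          0# ∎)
      , square-zero (begin
          m₀ * m₀
            ≡⟨ *-identityˡ _ ⟨
          1# * (m₀ * m₀)
            ≡⟨ cong (_* (m₀ * m₀)) e₃ ⟩
          k * (l₁ * m₁) * (m₀ * m₀)
            ≡⟨ solve 5 (λ k l₀ l₁ m₀ m₁ → k :* (l₁ :* m₁) :* (m₀ :* m₀) :=
                 k :* (l₀ :* m₁ :+ l₁ :* m₀) :* (m₀ :* m₁) :- k :* (l₀ :* m₀) :* (m₁ :* m₁)) refl k l₀ l₁ m₀ m₁ ⟩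
          k * (l₀ * m₁ + l₁ * m₀) * (m₀ * m₁) - k * (l₀ * m₀) * (m₁ * m₁)
            ≡⟨ cong₂ (λ x y → x * (m₀ * m₁) - y * (m₁ * m₁)) e₁ e₀ ⟨
          0# * (m₀ * m₁) - 0# * (m₁ * m₁)
            ≡⟨ solve 2 (λ x y → con 0ℤ :* x :- con 0ℤ :* y := con 0ℤ) refl (m₀ * m₁) (m₁ * m₁) ⟩
          0# ∎)

  realPair⇒ : ∀ nf k l m → ¬ l ∼ m → form nf ≡ k ⊙ (l ⊗ m) → IsRealPair nf
  realPair⇒ (cone₁ c n r) k l m _ eq =
    _ , _ , -≡0 (trans (sym (discriminant-cone₁ c n r)) (scaled-singular l m (cone₁ c n r) eq))
  realPair⇒ (cone₂ m r)   k l l′ _ eq =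
    _ , -≡0 (trans (sym (discriminant-cone₂ m r)) (scaled-singular l l′ (cone₂ m r) eq))
  realPair⇒ (binary e)    k (l₀ ∷ l₁ ∷ l₂ ∷ []) (m₀ ∷ m₁ ∷ m₂ ∷ []) l≁m eq
    with refl , refl ← factors-at-0 {k} {l₀} {l₁} {m₀} {m₁} (at 0F eq) (at 1F eq) (at 3F eq) = t , root , t²≢1
    where
    -- As `kl₁m₁ = 1`, these are the quotients `l₂/l₁` and `m₂/m₁`, and the form is
    -- `(X₁ + tX₂)(X₁ + t′X₂)`.
    t = k * (l₂ * m₁)
    t′ = k * (l₁ * m₂)
    tt′≡1 : t * t′ ≡ 1#
    tt′≡1 = begin
      t * t′                          ≡⟨ solve 5 (λ k l₁ l₂ m₁ m₂ → k :* (l₂ :* m₁) :* (k :* (l₁ :* m₂)) :=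
                                           k :* (l₁ :* m₁) :* (k :* (l₂ :* m₂))) refl k l₁ l₂ m₁ m₂ ⟩
      k * (l₁ * m₁) * (k * (l₂ * m₂)) ≡⟨ cong₂ _*_ (at 3F eq) (at 5F eq) ⟨
      1# * 1#                         ≡⟨ *-identityˡ 1# ⟩
      1#                              ∎
    root : IsRootOf e t
    root = begin
      t * t + 1#                      ≡⟨ cong (t * t +_) tt′≡1 ⟨
      t * t + t * t′
        ≡⟨ solve 5 (λ k l₁ l₂ m₁ m₂ → let t = k :* (l₂ :* m₁) ; t′ = k :* (l₁ :* m₂) in
                                           t :* t :+ t :* t′ := k :* (l₁ :* m₂ :+ l₂ :* m₁) :* t) refl k l₁ l₂ m₁ m₂ ⟩
      k * (l₁ * m₂ + l₂ * m₁) * t     ≡⟨ cong (_* t) (at 4F eq) ⟨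
      e * t                           ∎
    m₁≢0 : m₁ ≢ 0#
    m₁≢0 refl = one-zero (trans (at 3F eq) (trans (cong (k *_) (zeroʳ l₁)) refl))
    k≢0 : k ≢ 0#
    k≢0 refl = 1≢0 (trans (at 3F eq) (zeroˡ _))
    t²≢1 : t * t ≢ 1#
    t²≢1 t²≡1 = l≁m (s , *-≢0 m₁≢0 (*-≢0 k≢0 m₁≢0) ,
      cong₂ _∷_ (sym (zeroʳ s)) (cong₂ _∷_ m₁≡ (cong₂ _∷_ m₂≡ refl)))
      where
      -- The quotient `m₁/l₁`, since `km₁` inverts `l₁`.
      s = m₁ * (k * m₁)
      t≡t′ : t ≡ t′
      t≡t′ = *-cancelˡ (λ t≡0 → 1≢0 (trans (sym t²≡1) (trans (cong (_* t) t≡0) (zeroˡ t)))) (trans t²≡1 (sym tt′≡1))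
      m₁≡ : m₁ ≡ s * l₁
      m₁≡ = begin
        m₁                   ≡⟨ *-identityʳ m₁ ⟨
        m₁ * 1#              ≡⟨ cong (m₁ *_) (at 3F eq) ⟩
        m₁ * (k * (l₁ * m₁)) ≡⟨ solve 3 (λ k l m → m :* (k :* (l :* m)) := m :* (k :* m) :* l) refl k l₁ m₁ ⟩
        s * l₁               ∎
      m₂≡ : m₂ ≡ s * l₂
      m₂≡ = begin
        m₂                     ≡⟨ *-identityˡ m₂ ⟨
        1# * m₂                ≡⟨ cong (_* m₂) (at 3F eq) ⟩
        k * (l₁ * m₁) * m₂
          ≡⟨ solve 4 (λ k l₁ m₁ m₂ → k :* (l₁ :* m₁) :* m₂ := m₁ :* (k :* (l₁ :* m₂))) refl k l₁ m₁ m₂ ⟩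
        m₁ * t′                ≡⟨ cong (m₁ *_) t≡t′ ⟨
        m₁ * t                 ≡⟨ solve 3 (λ k l m → m :* (k :* (l :* m)) := m :* (k :* m) :* l) refl k l₂ m₁ ⟩
        s * l₂                 ∎
  realPair⇒ crossing      k l m _ eq = tt

  realPair⇐ : ∀ nf → IsRealPair nf → ∃[ l ] ∃[ m ] (¬ l ∼ m × form nf ≡ l ⊗ m)
  realPair⇐ (cone₁ c n r) (_ , _ , refl) =
    (0# ∷ 1# ∷ c ∷ []) , (1# ∷ c * n ∷ n ∷ []) , (λ (k , _ , eq) → one-zero {k} (cong (λ v → lookup v 0F) eq)) ,
    proveAll (c ∷ n ∷ [])
      (con 0ℤ ∷ con 1ℤ ∷ c′ ∷ c′ :* n′ :+ con 0ℤ ∷ n′ :+ c′ :* (c′ :* n′ :+ con 0ℤ) ∷ c′ :* n′ :+ con 0ℤ ∷ [])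
      (P.product (con 0ℤ ∷ con 1ℤ ∷ c′ ∷ []) (con 1ℤ ∷ c′ :* n′ ∷ n′ ∷ [])) refl
    where
    c′ = var 0F
    n′ = var 1F
  realPair⇐ (cone₂ m r)   (_ , refl) =
    (0# ∷ 0# ∷ 1# ∷ []) , (1# ∷ m ∷ 0# ∷ []) , (λ (k , _ , eq) → one-zero {k} (cong (λ v → lookup v 0F) eq)) ,
    proveAll (m ∷ [])
      (con 0ℤ ∷ con 0ℤ ∷ con 1ℤ ∷ con 0ℤ ∷ var 0F ∷ con 0ℤ ∷ [])
      (P.product (con 0ℤ ∷ con 0ℤ ∷ con 1ℤ ∷ []) (con 1ℤ ∷ var 0F ∷ con 0ℤ ∷ [])) refl
  realPair⇐ (binary e)    (t , root , t²≢1) =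
    (0# ∷ 1# ∷ t ∷ []) , (0# ∷ 1# ∷ e - t ∷ []) , distinct , (begin
      0# ∷ 0# ∷ 0# ∷ 1# ∷ e ∷ 1# ∷ []
        ≡⟨ cong₂ (λ x y → 0# ∷ 0# ∷ 0# ∷ 1# ∷ x ∷ y ∷ [])
             (solve 2 (λ t e → e := t :+ (e :- t)) refl t e) (sym (root-product root)) ⟩
      0# ∷ 0# ∷ 0# ∷ 1# ∷ t + (e - t) ∷ t * (e - t) ∷ []
        ≡⟨ binary-⊗ t (e - t) ⟩
      (0# ∷ 1# ∷ t ∷ []) ⊗ (0# ∷ 1# ∷ e - t ∷ []) ∎)
    where
    distinct : ¬ (0# ∷ 1# ∷ t ∷ []) ∼ (0# ∷ 1# ∷ e - t ∷ [])
    distinct (k , _ , eq) = t²≢1 (begin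
      t * t                       ≡⟨ cong (t *_) (begin
        t           ≡⟨ *-identityˡ t ⟨
        1# * t      ≡⟨ cong (_* t) (trans (cong (λ v → lookup v 1F) eq) (*-identityʳ k)) ⟩
        k * t       ≡⟨ cong (λ v → lookup v 2F) eq ⟨
        e - t       ∎) ⟩
      t * (e - t)                 ≡⟨ root-product root ⟩
      1#                          ∎)
  realPair⇐ crossing      _ =
    (0# ∷ 1# ∷ 0# ∷ []) , (0# ∷ 0# ∷ 1# ∷ []) , (λ (k , k≢0 , eq) → zero-one k≢0 (cong (λ v → lookup v 1F) eq)) ,
    proveAll [] (con 0ℤ ∷ con 0ℤ ∷ con 0ℤ ∷ con 0ℤ ∷ con 1ℤ ∷ con 0ℤ ∷ [])
      (P.product (con 0ℤ ∷ con 1ℤ ∷ con 0ℤ ∷ []) (con 0ℤ ∷ con 0ℤ ∷ con 1ℤ ∷ [])) refl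

-- Pairs of conjugate imaginary lines

module ImaginaryPairs {q} (F : FiniteField q) (F² : QuadraticExtension F) (primePower : PrimePower q) where
  open QuadraticExtension F² using (ι; conjugate) renaming (E to 𝔼)
  open Extension F F²
  open FormProperties F using (pull; Matrix₃)
  open NormalForms F
  module VE = Vectors 𝔼
  module FE = FormProperties 𝔼
  open ≡-Reasoning

  private
    ι-+-cong : ∀ {x y x′ y′} → ι x ≡ x′ → ι y ≡ y′ → ι (x F.+ y) ≡ x′ E.+ y′
    ι-+-cong eq eq′ = trans (ι-+ _ _) (cong₂ E._+_ eq eq′)

    ι-*-cong : ∀ {x y x′ y′} → ι x ≡ x′ → ι y ≡ y′ → ι (x F.* y) ≡ x′ E.* y′
    ι-*-cong eq eq′ = trans (ι-* _ _) (cong₂ E._*_ eq eq′)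

    ι-quadratic : ∀ f x → ι (FormProperties.quadratic F f x) ≡ FE.quadratic (map ι f) (ι ∘ x)
    ι-quadratic (_ ∷ _ ∷ _ ∷ _ ∷ _ ∷ _ ∷ []) x =
      ι-+-cong (ι-+-cong (ι-+-cong (ι-+-cong (ι-+-cong term term) term) term) term) term
      where
      term : ∀ {a x y} → ι (a F.* (x F.* y)) ≡ ι a E.* (ι x E.* ι y)
      term = ι-*-cong refl (ι-* _ _)

    ι-polar : ∀ f x y → ι (FormProperties.polar F f x y) ≡ FE.polar (map ι f) (ι ∘ x) (ι ∘ y)
    ι-polar (_ ∷ _ ∷ _ ∷ _ ∷ _ ∷ _ ∷ []) x y =
      ι-+-cong (ι-+-cong (ι-+-cong (ι-+-cong (ι-+-cong square cross) cross) square) cross) square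
      where
      square : ∀ {a x y} → ι ((a F.+ a) F.* (x F.* y)) ≡ (ι a E.+ ι a) E.* (ι x E.* ι y)
      square = ι-*-cong (ι-+ _ _) (ι-* _ _)
      cross : ∀ {a x y z w} → ι (a F.* (x F.* y F.+ z F.* w)) ≡ ι a E.* (ι x E.* ι y E.+ ι z E.* ι w)
      cross = ι-*-cong refl (ι-+-cong (ι-* _ _) (ι-* _ _))

  ιᴹ : Matrix₃ → FE.Matrix₃
  ιᴹ A i j = ι (A i j)

  map-ι-pull : ∀ A f → map ι (pull A f) ≡ FE.pull (ιᴹ A) (map ι f)
  map-ι-pull A f =
    cong₂ _∷_ (ι-quadratic f _) (cong₂ _∷_ (ι-polar f _ _) (cong₂ _∷_ (ι-polar f _ _)
      (cong₂ _∷_ (ι-quadratic f _) (cong₂ _∷_ (ι-polar f _ _) (cong (_∷ []) (ι-quadratic f _))))))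

  ιᴹ-inverse : ∀ {A B} → (∀ i j → FormProperties._∙_ F A B i j ≡ Geometry.identity F i j) →
               ∀ i j → (ιᴹ A FE.∙ ιᴹ B) i j ≡ Geometry.identity 𝔼 i j
  ιᴹ-inverse {A} {B} AB≡1 i j = begin
    (ιᴹ A FE.∙ ιᴹ B) i j
      ≡⟨ ι-+-cong (ι-* _ _) (ι-+-cong (ι-* _ _) (ι-+-cong (ι-* _ _) ι-0)) ⟨
    ι (FormProperties._∙_ F A B i j)     ≡⟨ cong ι (AB≡1 i j) ⟩
    ι (Geometry.identity F i j)          ≡⟨ ι-identity i j ⟩
    Geometry.identity 𝔼 i j              ∎
    where
    ι-identity : ∀ i j → ι (Geometry.identity F i j) ≡ Geometry.identity 𝔼 i j
    ι-identity 0F 0F = ι-1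
    ι-identity 0F 1F = ι-0
    ι-identity 0F 2F = ι-0
    ι-identity 1F 0F = ι-0
    ι-identity 1F 1F = ι-1
    ι-identity 1F 2F = ι-0
    ι-identity 2F 0F = ι-0
    ι-identity 2F 1F = ι-0
    ι-identity 2F 2F = ι-1

  -- Conjugation is additive and multiplicative and fixes the entries of `ιᴹ A`, so it commutes with
  -- substitutions defined over `F`.
  conjugate-pullLinear : ∀ A l → map conjugate (FE.pullLinear (ιᴹ A) l) ≡ FE.pullLinear (ιᴹ A) (map conjugate l)
  conjugate-pullLinear A (_ ∷ _ ∷ _ ∷ []) = cong₂ _∷_ (value 0F) (cong₂ _∷_ (value 1F) (cong (_∷ []) (value 2F)))
    where
    term : ∀ l x → conjugate (l E.* ι x) ≡ conjugate l E.* ι x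
    term l x = trans (conjugate-* l (ι x)) (cong (conjugate l E.*_) (conjugate-ι x))
    value : ∀ {l₀ l₁ l₂} j → conjugate (l₀ E.* ι (A 0F j) E.+ l₁ E.* ι (A 1F j) E.+ l₂ E.* ι (A 2F j)) ≡
            conjugate l₀ E.* ι (A 0F j) E.+ conjugate l₁ E.* ι (A 1F j) E.+ conjugate l₂ E.* ι (A 2F j)
    value j = trans (conjugate-+ primePower _ _)
      (cong₂ E._+_ (trans (conjugate-+ primePower _ _) (cong₂ E._+_ (term _ _) (term _ _))) (term _ _))

  -- H₂,ᵢ of Distribution, with a scalar that need not lie in F.
  ImaginaryPair : Vec F.Carrier 6 → Set
  ImaginaryPair a = ∃[ c ] Σ[ l ∈ Vec E.Carrier 3 ]
    (¬ (l VE.∼ map conjugate l) × map ι a ≡ c VE.⊙ (l VE.⊗ map conjugate l))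

  private
    at : ∀ i {f g : Vec E.Carrier 6} → f ≡ g → lookup f i ≡ lookup g i
    at i = cong (λ v → lookup v i)

    -- The product `x E.* conjugate x` unfolds to the power of `x` with exponent `suc q`.
    norm-zero : ∀ {x} → x E.* conjugate x ≡ E.0# → x ≡ E.0#
    norm-zero = E.^-zero (suc q)

    conjugate-0 : conjugate E.0# ≡ E.0#
    conjugate-0 = trans (cong conjugate (sym ι-0)) (trans (conjugate-ι F.0#) ι-0)

    -- The vanishing norm term forces `c` or `x` to be zero, and either one kills the mixed
    -- coefficient.
    no-norm : ∀ c x y → ι F.0# ≡ c E.* (x E.* conjugate x) → ι F.1# ≢ c E.* (x E.* conjugate y E.+ y E.* conjugate x)
    no-norm c x y norm≡0 cross≡1 with E.*-zero⇒ _ _ (trans (sym norm≡0) ι-0)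
    ... | inj₁ refl = E.1≢0 (trans (sym ι-1) (trans cross≡1 (E.zeroˡ _)))
    ... | inj₂ xx̄≡0 with refl ← norm-zero {x} xx̄≡0 = E.1≢0 (begin
      E.1#                                                    ≡⟨ ι-1 ⟨
      ι F.1#                                                  ≡⟨ cross≡1 ⟩
      c E.* (E.0# E.* conjugate y E.+ y E.* conjugate E.0#)
        ≡⟨ cong (λ z → c E.* (E.0# E.* conjugate y E.+ y E.* z)) conjugate-0 ⟩
      c E.* (E.0# E.* conjugate y E.+ y E.* E.0#)             ≡⟨ E.solve 3 (λ c y y′ →
        c E.:* (E.con 0ℤ E.:* y′ E.:+ y E.:* E.con 0ℤ) E.:= E.con 0ℤ) refl c y (conjugate y) ⟩
      E.0#                                                    ∎)

  -- A root `t` in `F` gives the binary form a zero with coordinates in `F`. There `l` vanishes,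
  -- hence its conjugate does too, and both being free of `X₀` they are proportional.
  imaginaryPair⇒ : ∀ nf → ImaginaryPair (form nf) → IsImaginaryPair nf
  imaginaryPair⇒ (cone₁ _ _ _) (c , (l₀ ∷ l₁ ∷ l₂ ∷ []) , _ , eq) = no-norm c l₀ l₁ (at 0F eq) (at 1F eq)
  imaginaryPair⇒ (cone₂ _ _)   (c , (l₀ ∷ l₁ ∷ l₂ ∷ []) , _ , eq) = no-norm c l₀ l₂ (at 0F eq) (at 2F eq)
  imaginaryPair⇒ crossing      (c , (l₀ ∷ l₁ ∷ l₂ ∷ []) , _ , eq) = no-norm c l₁ l₂ (at 3F eq) (at 4F eq)
  imaginaryPair⇒ (binary e)    (c , l@(l₀ ∷ l₁ ∷ l₂ ∷ []) , l≁l̄ , eq) t root = l≁l̄ (s , s≢0 ,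
      cong₂ _∷_ l̄₀≡ (cong₂ _∷_ l̄₁≡ (cong (_∷ []) l̄₂≡)))
    where
    τ = ι t
    l̄₁ = conjugate l₁
    l̄₂ = conjugate l₂
    -- The quotient `l̄₁/l₁`, since `cl̄₁` inverts `l₁`.
    s = l̄₁ E.* (c E.* l̄₁)
    cl₁l̄₁≡1 : c E.* (l₁ E.* l̄₁) ≡ E.1#
    cl₁l̄₁≡1 = trans (sym (at 3F eq)) ι-1
    c≢0 : c ≢ E.0#
    c≢0 refl = E.0≢1 (trans (sym (E.zeroˡ _)) cl₁l̄₁≡1)
    l̄₁≢0 : l̄₁ ≢ E.0#
    l̄₁≢0 l̄₁≡0 = E.0≢1 (trans (sym (trans (cong (λ z → c E.* (l₁ E.* z)) l̄₁≡0)
      (E.solve 2 (λ c x → c E.:* (x E.:* E.con 0ℤ) E.:= E.con 0ℤ) refl c l₁))) cl₁l̄₁≡1)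
    s≢0 : s ≢ E.0#
    s≢0 = E.*-≢0 l̄₁≢0 (E.*-≢0 c≢0 l̄₁≢0)
    l₀≡0 : l₀ ≡ E.0#
    l₀≡0 = norm-zero ([ (λ c≡0 → contradiction c≡0 c≢0) , (λ z → z) ]′ (E.*-zero⇒ _ _ (trans (sym (at 0F eq)) ι-0)))
    l̄₀≡ : conjugate l₀ ≡ s E.* l₀
    l̄₀≡ = trans (trans (cong conjugate l₀≡0) conjugate-0) (sym (trans (cong (s E.*_) l₀≡0) (E.zeroʳ s)))
    l̄₁≡ : l̄₁ ≡ s E.* l₁
    l̄₁≡ = begin
      l̄₁                           ≡⟨ E.*-identityʳ l̄₁ ⟨
      l̄₁ E.* E.1#                  ≡⟨ cong (l̄₁ E.*_) cl₁l̄₁≡1 ⟨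
      l̄₁ E.* (c E.* (l₁ E.* l̄₁))
        ≡⟨ E.solve 3 (λ c x y → y E.:* (c E.:* (x E.:* y)) E.:= y E.:* (c E.:* y) E.:* x) refl c l₁ l̄₁ ⟩
      s E.* l₁                     ∎
    -- With the sign inside `ι`, the coefficient is visibly fixed by conjugation.
    w = l₂ E.+ ι (F.- t) E.* l₁
    w̄≡ : conjugate w ≡ l̄₂ E.- τ E.* l̄₁
    w̄≡ = begin
      conjugate w                                   ≡⟨ conjugate-+ primePower _ _ ⟩
      l̄₂ E.+ conjugate (ι (F.- t) E.* l₁)           ≡⟨ cong (l̄₂ E.+_) (conjugate-* _ _) ⟩
      l̄₂ E.+ conjugate (ι (F.- t)) E.* l̄₁
        ≡⟨ cong (λ z → l̄₂ E.+ z E.* l̄₁) (trans (conjugate-ι _) (ι-neg t)) ⟩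
      l̄₂ E.+ (E.- τ) E.* l̄₁
        ≡⟨ E.solve 3 (λ x t y → x E.:+ (E.:- t) E.:* y E.:= x E.:- t E.:* y) refl l̄₂ τ l̄₁ ⟩
      l̄₂ E.- τ E.* l̄₁                               ∎
    τ-root : τ E.* τ E.+ E.1# ≡ ι e E.* τ
    τ-root = trans (sym (ι-+-cong (ι-* t t) ι-1)) (trans (cong ι root) (ι-* e t))
    -- The value of the form at the zero (-t, 1) is both 0 and c·w·w̄.
    cww̄≡0 : c E.* (w E.* conjugate w) ≡ E.0#
    cww̄≡0 = begin
      c E.* (w E.* conjugate w)
        ≡⟨ cong₂ (λ x y → c E.* ((l₂ E.+ x E.* l₁) E.* y)) (ι-neg t) w̄≡ ⟩
      c E.* ((l₂ E.+ (E.- τ) E.* l₁) E.* (l̄₂ E.- τ E.* l̄₁))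
        ≡⟨ E.solve 6 (λ c x y x̄ ȳ t → c E.:* ((y E.:+ (E.:- t) E.:* x) E.:* (ȳ E.:- t E.:* x̄)) E.:=
             c E.:* (y E.:* ȳ) E.:+ c E.:* (x E.:* x̄) E.:* (t E.:* t) E.:- c E.:* (x E.:* ȳ E.:+ y E.:* x̄) E.:* t)
             refl c l₁ l₂ l̄₁ l̄₂ τ ⟩
      c E.* (l₂ E.* l̄₂) E.+ c E.* (l₁ E.* l̄₁) E.* (τ E.* τ) E.- c E.* (l₁ E.* l̄₂ E.+ l₂ E.* l̄₁) E.* τ
        ≡⟨ cong₂ E._-_ (cong₂ (λ x y → x E.+ y E.* (τ E.* τ)) (trans (sym (at 5F eq)) ι-1) cl₁l̄₁≡1) (cong (E._* τ) (sym (at 4F eq))) ⟩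
      E.1# E.+ E.1# E.* (τ E.* τ) E.- ι e E.* τ
        ≡⟨ cong (λ z → E.1# E.+ E.1# E.* (τ E.* τ) E.- z) τ-root ⟨
      E.1# E.+ E.1# E.* (τ E.* τ) E.- (τ E.* τ E.+ E.1#)
        ≡⟨ E.solve 1 (λ t → E.con 1ℤ E.:+ E.con 1ℤ E.:* (t E.:* t) E.:- (t E.:* t E.:+ E.con 1ℤ) E.:= E.con 0ℤ) refl τ ⟩
      E.0# ∎
    w≡0 : w ≡ E.0#
    w≡0 = norm-zero ([ (λ c≡0 → contradiction c≡0 c≢0) , (λ z → z) ]′ (E.*-zero⇒ _ _ cww̄≡0))
    l₂≡ : l₂ ≡ τ E.* l₁
    l₂≡ = E.x-y≡0⇒x≡y (begin
      l₂ E.- τ E.* l₁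
        ≡⟨ E.solve 3 (λ x t y → x E.:- t E.:* y E.:= x E.:+ (E.:- t) E.:* y) refl l₂ τ l₁ ⟩
      l₂ E.+ (E.- τ) E.* l₁      ≡⟨ cong (λ z → l₂ E.+ z E.* l₁) (ι-neg t) ⟨
      w                          ≡⟨ w≡0 ⟩
      E.0#                       ∎)
    l̄₂≡ : l̄₂ ≡ s E.* l₂
    l̄₂≡ = begin
      l̄₂                         ≡⟨ E.x-y≡0⇒x≡y (trans (sym w̄≡) (trans (cong conjugate w≡0) conjugate-0)) ⟩
      τ E.* l̄₁                   ≡⟨ cong (τ E.*_) l̄₁≡ ⟩
      τ E.* (s E.* l₁)           ≡⟨ E.solve 3 (λ t s x → t E.:* (s E.:* x) E.:= s E.:* (t E.:* x)) refl τ s l₁ ⟩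
      s E.* (τ E.* l₁)           ≡⟨ cong (s E.*_) l₂≡ ⟨
      s E.* l₂                   ∎

  private
    binary-conjugates : ∀ e η → conjugate η ≢ η → η E.+ conjugate η ≡ ι e → η E.* conjugate η ≡ E.1# →
      ∃[ l ] (¬ (l VE.∼ map conjugate l) × map ι (form (binary e)) ≡ l VE.⊗ map conjugate l)
    binary-conjugates e η η̄≢η η+η̄≡e ηη̄≡1 =
      (E.0# ∷ E.1# ∷ η ∷ []) , distinct , (begin
        ι F.0# ∷ ι F.0# ∷ ι F.0# ∷ ι F.1# ∷ ι e ∷ ι F.1# ∷ []
          ≡⟨ cong₂ (λ o i → o ∷ o ∷ o ∷ i ∷ ι e ∷ i ∷ []) ι-0 ι-1 ⟩
        E.0# ∷ E.0# ∷ E.0# ∷ E.1# ∷ ι e ∷ E.1# ∷ []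
          ≡⟨ cong₂ (λ x y → E.0# ∷ E.0# ∷ E.0# ∷ E.1# ∷ x ∷ y ∷ []) η+η̄≡e ηη̄≡1 ⟨
        E.0# ∷ E.0# ∷ E.0# ∷ E.1# ∷ η E.+ conjugate η ∷ η E.* conjugate η ∷ []
          ≡⟨ FE.binary-⊗ η (conjugate η) ⟩
        (E.0# ∷ E.1# ∷ η ∷ []) VE.⊗ (E.0# ∷ E.1# ∷ conjugate η ∷ [])
          ≡⟨ cong₂ (λ o i → (E.0# ∷ E.1# ∷ η ∷ []) VE.⊗ (o ∷ i ∷ conjugate η ∷ [])) conjugate-0 (E.1^n≡1 q) ⟨
        (E.0# ∷ E.1# ∷ η ∷ []) VE.⊗ map conjugate (E.0# ∷ E.1# ∷ η ∷ []) ∎)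
      where
      distinct : ¬ (E.0# ∷ E.1# ∷ η ∷ []) VE.∼ map conjugate (E.0# ∷ E.1# ∷ η ∷ [])
      distinct (k , _ , eq) = η̄≢η (begin
        conjugate η     ≡⟨ cong (λ v → lookup v 2F) eq ⟩
        k E.* η         ≡⟨ cong (E._* η) (E.*-identityʳ k) ⟨
        k E.* E.1# E.* η ≡⟨ cong (E._* η) (trans (sym (E.1^n≡1 q)) (cong (λ v → lookup v 1F) eq)) ⟨
        E.1# E.* η      ≡⟨ E.*-identityˡ η ⟩
        η               ∎)

  imaginaryPair⇐ : ∀ nf → IsImaginaryPair nf → ∃[ l ] (¬ (l VE.∼ map conjugate l) × map ι (form nf) ≡ l VE.⊗ map conjugate l)
  imaginaryPair⇐ (cone₁ _ _ _) ()
  imaginaryPair⇐ (cone₂ _ _)   ()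
  imaginaryPair⇐ (binary e)    noRoot =
    let η , η̄≢η , η+η̄≡e , ηη̄≡1 = conjugate-root primePower e noRoot
    in binary-conjugates e η η̄≢η η+η̄≡e ηη̄≡1
  imaginaryPair⇐ crossing      ()

-- Counting

module RootCounts {q} (F : FiniteField q) where
  open FieldProperties F
  open NormalForms F using (IsRootOf; root-product; NoRoot; DoubleRoot; TwoRoots)
  open HasSize
  open ≡-Reasoning

  SquareRootOfOne : Pred Carrier 0ℓ
  SquareRootOfOne t = t * t ≡ 1#

  root≢0 : ∀ {e t} → IsRootOf e t → t ≢ 0#
  root≢0 root refl = 0≢1 (trans (sym (zeroˡ _)) (root-product root))

  otherRoot : ∀ {e t} → IsRootOf e t → IsRootOf e (e - t)
  otherRoot {e} {t} root = begin
    (e - t) * (e - t) + 1#               ≡⟨ cong ((e - t) * (e - t) +_) (root-product root) ⟨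
    (e - t) * (e - t) + t * (e - t)
      ≡⟨ solve 2 (λ e t → (e :- t) :* (e :- t) :+ t :* (e :- t) := e :* (e :- t)) refl e t ⟩
    e * (e - t)                          ∎

  root-determines : ∀ {e e′ t} → IsRootOf e t → IsRootOf e′ t → e ≡ e′
  root-determines {e} {e′} {t} r r′ = *-cancelˡ (root≢0 r) (trans (*-comm t e) (trans (trans (sym r) r′) (*-comm e′ t)))

  only-roots : ∀ {e t u} → IsRootOf e t → IsRootOf e u → u ≡ t ⊎ u ≡ e - t
  only-roots {e} {t} {u} rt ru = Sum.map x-y≡0⇒x≡y x-y≡0⇒x≡y (*-zero⇒ (u - t) (u - (e - t)) (begin
    (u - t) * (u - (e - t))
      ≡⟨ solve 3 (λ e t u → (u :- t) :* (u :- (e :- t)) := u :* u :- e :* u :+ t :* (e :- t)) refl e t u ⟩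
    u * u - e * u + t * (e - t)           ≡⟨ cong₂ (λ x y → u * u - x + y) (sym ru) (root-product rt) ⟩
    u * u - (u * u + 1#) + 1#
      ≡⟨ solve 1 (λ u → u :* u :- (u :* u :+ con 1ℤ) :+ con 1ℤ := con 0ℤ) refl u ⟩
    0#                                    ∎))

  selfInverse : ∀ {e t} → IsRootOf e t → t ≡ e - t → t * t ≡ 1#
  selfInverse {e} {t} root t≡ = trans (cong (t *_) t≡) (root-product root)

  otherRoot-square : ∀ {e t} → IsRootOf e t → (e - t) * (e - t) ≡ 1# → t * t ≡ 1#
  otherRoot-square {e} {t} root sq = begin
    t * t                               ≡⟨ *-identityʳ _ ⟨
    t * t * 1#                          ≡⟨ cong (t * t *_) sq ⟨
    t * t * ((e - t) * (e - t))
      ≡⟨ solve 2 (λ t s → t :* t :* (s :* s) := t :* s :* (t :* s)) refl t (e - t) ⟩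
    t * (e - t) * (t * (e - t))         ≡⟨ cong₂ _*_ (root-product root) (root-product root) ⟩
    1# * 1#                             ≡⟨ *-identityˡ 1# ⟩
    1#                                  ∎

  double-isRoot : ∀ {t} → t * t ≡ 1# → IsRootOf (t + t) t
  double-isRoot {t} sq = trans (cong (t * t +_) (sym sq)) (sym (distribʳ t t t))

  -- The roots t ≠ ±1 are paired by t ↦ t⁻¹ = e - t.
  size-simpleRoots : ∀ {n} → HasSize TwoRoots n → HasSize (λ t → t ≢ 0# × t * t ≢ 1#) (n ℕ.+ n)
  size-simpleRoots {n} s = size-family (↔-sym +↔⊎) root
    (λ i → root≢0 (root-isRoot i) , root-simple i) (λ {i} {j} → root-injective i j) root-complete
    where
    e : Fin n → Carrier
    e = element s
    t : Fin n → Carrier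
    t i = proj₁ (sound s i)
    t-isRoot : ∀ i → IsRootOf (e i) (t i)
    t-isRoot i = proj₁ (proj₂ (sound s i))

    root : Fin n ⊎ Fin n → Carrier
    root (inj₁ i) = t i
    root (inj₂ i) = e i - t i

    index : Fin n ⊎ Fin n → Fin n
    index = [ (λ i → i) , (λ i → i) ]′

    root-isRoot : ∀ i → IsRootOf (e (index i)) (root i)
    root-isRoot (inj₁ i) = t-isRoot i
    root-isRoot (inj₂ i) = otherRoot (t-isRoot i)

    root-simple : ∀ i → root i * root i ≢ 1#
    root-simple (inj₁ i) = proj₂ (proj₂ (sound s i))
    root-simple (inj₂ i) = proj₂ (proj₂ (sound s i)) ∘ otherRoot-square (t-isRoot i)

    index-determined : ∀ i j → root i ≡ root j → index i ≡ index j
    index-determined i j eq =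
      injective s (root-determines (root-isRoot i) (subst (IsRootOf (e (index j))) (sym eq) (root-isRoot j)))

    unpaired : ∀ i j → i ≡ j → t i ≢ e j - t j
    unpaired i .i refl = root-simple (inj₁ i) ∘ selfInverse (t-isRoot i)

    root-injective : ∀ i j → root i ≡ root j → i ≡ j
    root-injective (inj₁ i) (inj₁ j) eq = cong inj₁ (index-determined (inj₁ i) (inj₁ j) eq)
    root-injective (inj₂ i) (inj₂ j) eq = cong inj₂ (index-determined (inj₂ i) (inj₂ j) eq)
    root-injective (inj₁ i) (inj₂ j) eq = ⊥-elim (unpaired i j (index-determined (inj₁ i) (inj₂ j) eq) eq)
    root-injective (inj₂ i) (inj₁ j) eq =
      ⊥-elim (unpaired j i (sym (index-determined (inj₂ i) (inj₁ j) eq)) (sym eq))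

    root-complete : ∀ {u} → u ≢ 0# × u * u ≢ 1# → ∃[ i ] root i ≡ u
    root-complete {u} (u≢0 , u²≢1) with u⁻¹ , uu⁻¹≡1 ← inverse u u≢0 = located (complete s (u , u-isRoot , u²≢1))
      where
      u-isRoot : IsRootOf (u + u⁻¹) u
      u-isRoot = trans (cong (u * u +_) (trans (sym uu⁻¹≡1) (*-comm u u⁻¹))) (sym (distribʳ u u u⁻¹))
      located : ∃[ i ] e i ≡ u + u⁻¹ → ∃[ i ] root i ≡ u
      located (i , eᵢ≡) =
        [ (λ eq → inj₁ i , sym eq) , (λ eq → inj₂ i , sym eq) ]′
          (only-roots (t-isRoot i) (subst (λ e → IsRootOf e u) (sym eᵢ≡) u-isRoot))

  square-roots : ∀ {t} → t * t ≡ 1# → 1# ≡ t ⊎ - 1# ≡ t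
  square-roots {t} sq = Sum.map (λ eq → sym (x-y≡0⇒x≡y eq)) (λ eq → sym (x-y≡0⇒x≡y eq)) (*-zero⇒ (t - 1#) (t - - 1#) (begin
    (t - 1#) * (t - - 1#)
      ≡⟨ solve 1 (λ t → (t :- con 1ℤ) :* (t :- (:- con 1ℤ)) := t :* t :- con 1ℤ) refl t ⟩
    t * t - 1#                ≡⟨ x≡y⇒x-y≡0 sq ⟩
    0#                        ∎))

  -1²≡1 : - 1# * - 1# ≡ 1#
  -1²≡1 = solve 0 (:- con 1ℤ :* :- con 1ℤ := con 1ℤ) refl

  size-square-roots : HasSize SquareRootOfOne 1 × 1# ≡ - 1# ⊎ HasSize SquareRootOfOne 2 × 1# ≢ - 1#
  size-square-roots with 1# ≟ - 1#
  ... | yes 1≡-1 = inj₁ (size-cong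
          ((λ { refl → *-identityˡ 1# }) , (λ sq → [ (λ eq → eq) , trans 1≡-1 ]′ (square-roots sq)))
          (size-singleton 1#) , 1≡-1)
  ... | no  1≢-1 = inj₂ (size-cong
          ((λ { (inj₁ refl) → *-identityˡ 1# ; (inj₂ refl) → -1²≡1 }) , square-roots)
          (size-∪ (λ (eq , eq′) → 1≢-1 (trans eq (sym eq′))) (size-singleton 1#) (size-singleton (- 1#))) , 1≢-1)

  -- `DoubleRoot` is the image of the square roots of one under doubling. Doubling is injective on
  -- them: in characteristic 2 there is only one, and otherwise 2 is invertible.
  size-doubleRoot : HasSize DoubleRoot 1 × HasSize SquareRootOfOne 1 ⊎
                    HasSize DoubleRoot 2 × HasSize SquareRootOfOne 2
  size-doubleRoot = Sum.map
    (λ (s , 1≡-1) → size-image (λ t → t + t) (λ p p′ _ → trans (unique 1≡-1 p) (sym (unique 1≡-1 p′))) s , s)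
    (λ (s , 1≢-1) → size-image (λ t → t + t) (λ {t} {u} _ _ eq → halve 1≢-1 t u eq) s , s)
    size-square-roots
    where
    unique : 1# ≡ - 1# → ∀ {t} → t * t ≡ 1# → t ≡ 1#
    unique 1≡-1 sq = [ sym , (λ eq → sym (trans 1≡-1 eq)) ]′ (square-roots sq)
    2≢0 : 1# ≢ - 1# → 1# + 1# ≢ 0#
    2≢0 1≢-1 2≡0 = 1≢-1 (x-y≡0⇒x≡y (trans (solve 0 (con 1ℤ :- (:- con 1ℤ) := con 1ℤ :+ con 1ℤ) refl) 2≡0))
    halve : 1# ≢ - 1# → ∀ t u → t + t ≡ u + u → t ≡ u
    halve 1≢-1 t u eq = *-cancelˡ (2≢0 1≢-1) (begin
      (1# + 1#) * t   ≡⟨ solve 1 (λ t → (con 1ℤ :+ con 1ℤ) :* t := t :+ t) refl t ⟩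
      t + t           ≡⟨ eq ⟩
      u + u           ≡⟨ solve 1 (λ t → (con 1ℤ :+ con 1ℤ) :* t := t :+ t) refl u ⟨
      (1# + 1#) * u   ∎)

  isRoot? : ∀ e t → Dec (IsRootOf e t)
  isRoot? e t = t * t + 1# ≟ e * t

  noRoot? : Decidable NoRoot
  noRoot? e = map′ (λ ∄ t root → ∄ (t , root)) (λ noRoot (t , root) → noRoot t root) (¬? (any? (isRoot? e)))

  twoRoots? : Decidable TwoRoots
  twoRoots? e = any? (λ t → isRoot? e t ×-dec ¬? (t * t ≟ 1#))

  size-nonzero : ∃[ k ] HasSize (_≢ 0#) k × q ≡ suc k
  size-nonzero = let k , s = size-decidable size-Carrier (λ x → ¬? (x ≟ 0#)) in k , s ,
    size-unique size-Carrier (size-cong (_ , λ {x} _ → zero-or-not x)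
      (size-∪ (λ (0≡x , x≢0) → x≢0 (sym 0≡x)) (size-singleton 0#) s))
    where
    zero-or-not : ∀ x → 0# ≡ x ⊎ x ≢ 0#
    zero-or-not x with x ≟ 0#
    ... | yes x≡0 = inj₁ (sym x≡0)
    ... | no  x≢0 = inj₂ x≢0

  count-nonzero : ∀ {d n} → HasSize SquareRootOfOne d → HasSize TwoRoots n → q ≡ suc (d ℕ.+ (n ℕ.+ n))
  count-nonzero s s₂ = let k , sₖ , q≡ = size-nonzero in trans q≡ (cong suc (size-unique sₖ (size-cong
    ( (λ { {t} (inj₁ sq) refl → 0≢1 (trans (sym (zeroˡ t)) sq) ; (inj₂ (t≢0 , _)) → t≢0 }) , split)
    (size-∪ (λ (sq , _ , ¬sq) → ¬sq sq) s (size-simpleRoots s₂)))))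
    where
    split : ∀ {t} → t ≢ 0# → t * t ≡ 1# ⊎ (t ≢ 0# × t * t ≢ 1#)
    split {t} t≢0 with t * t ≟ 1#
    ... | yes sq = inj₁ sq
    ... | no ¬sq = inj₂ (t≢0 , ¬sq)

  -- Double and simple roots never share an `e`: if `u² = 1`, the roots for `e = u + u` are `u` and
  -- `u + u - u`, which is `u` again.
  count-all : ∀ {d m n} → HasSize NoRoot m → HasSize DoubleRoot d → HasSize TwoRoots n → q ≡ m ℕ.+ (d ℕ.+ n)
  count-all s₀ s₁ s₂ = size-unique size-Carrier (size-cong (_ , λ {e} _ → classify e)
    (size-∪ (λ { (none , inj₁ (t , sq , refl)) → none t (double-isRoot sq)
               ; (none , inj₂ (t , root , _)) → none t root }) s₀
      (size-∪ (λ { ((u , sq , refl) , (t , root , ¬sq)) → ¬sq (double-unique sq root) }) s₁ s₂)))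
    where
    double-unique : ∀ {t u} → u * u ≡ 1# → IsRootOf (u + u) t → t * t ≡ 1#
    double-unique {t} {u} sq root = trans (cong (λ z → z * z) t≡u) sq
      where
      t≡u : t ≡ u
      t≡u = [ (λ eq → eq) , (λ eq → trans eq (solve 1 (λ u → u :+ u :- u := u) refl u)) ]′
              (only-roots (double-isRoot sq) root)
    classify : ∀ e → NoRoot e ⊎ DoubleRoot e ⊎ TwoRoots e
    classify e with any? (isRoot? e)
    ... | no ∄           = inj₁ (λ t root → ∄ (t , root))
    ... | yes (t , root) with t * t ≟ 1#
    ...   | no ¬sq = inj₂ (inj₂ (t , root , ¬sq))
    ...   | yes sq = inj₂ (inj₁ (t , sq , root-determines (double-isRoot sq) root))

  -- With `m` elements lacking a root, counting all `e` gives `q = m + d + n`, and counting zero and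
  -- the nonzero `t` gives `q = 1 + d + 2n`. The difference is `m = 1 + n`, whatever `d` is.
  size-noRoot : ∀ {d n} → HasSize DoubleRoot d → HasSize SquareRootOfOne d → HasSize TwoRoots n →
                HasSize NoRoot (suc n)
  size-noRoot {d} {n} s₁ s s₂ = subst (HasSize NoRoot) m≡1+n s₀
    where
    m = proj₁ (size-decidable size-Carrier noRoot?)
    s₀ = proj₂ (size-decidable size-Carrier noRoot?)
    m≡1+n : m ≡ suc n
    m≡1+n = ℕ.+-cancelʳ-≡ (d ℕ.+ n) m (suc n) (begin
      m ℕ.+ (d ℕ.+ n)          ≡⟨ count-all s₀ s₁ s₂ ⟨
      q                        ≡⟨ count-nonzero s s₂ ⟩
      suc (d ℕ.+ (n ℕ.+ n))
        ≡⟨ cong suc (NS.solve 2 (λ d n → d NS.:+ (n NS.:+ n) NS.:= n NS.:+ (d NS.:+ n)) refl d n) ⟩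
      suc n ℕ.+ (d ℕ.+ n)      ∎)
      where module NS = Data.Nat.Solver.+-*-Solver

-- Transport from the representative line to an arbitrary line of its orbit

module Counting {q} (F : FiniteField q) (F² : QuadraticExtension F) (primePower : PrimePower q)
                (L : Geometry.Line F) (L∈o₈,₁ : Geometry.o₈,₁ F L) where
  open FieldProperties F
  open FormProperties F
  open NormalForms F
  open ImaginaryPairs F F² primePower
  open Vectors F
  open Geometry F using (Contains; evaluate; HyperplaneCount; identity)
  open Distribution F F²
  open QuadraticExtension F² using (ι; conjugate)
  open HasSize
  open ≡-Reasoning

  A B : Matrix₃
  A = proj₁ (proj₁ L∈o₈,₁)
  B = proj₁ (proj₂ (proj₁ L∈o₈,₁))

  AB≡1 : ∀ i j → (A ∙ B) i j ≡ identity i j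
  AB≡1 = proj₁ (proj₂ (proj₂ (proj₁ L∈o₈,₁)))

  BA≡1 : ∀ i j → (B ∙ A) i j ≡ identity i j
  BA≡1 = proj₂ (proj₂ (proj₂ (proj₁ L∈o₈,₁)))

  pullB-pullA : ∀ f → pull B (pull A f) ≡ f
  pullB-pullA = pull-inverse {A} {B} AB≡1

  pullA-pullB : ∀ f → pull A (pull B f) ≡ f
  pullA-pullB = pull-inverse {B} {A} BA≡1

  evaluate≡pairing : ∀ f v → evaluate f v ≡ pairing f v
  evaluate≡pairing (_ ∷ _ ∷ _ ∷ _ ∷ _ ∷ _ ∷ []) (_ ∷ _ ∷ _ ∷ _ ∷ _ ∷ _ ∷ []) = refl

  diagonal≢𝟎 : ∀ {x y} → ¬ (x ≡ 0# × y ≡ 0#) → diagonal x y ≢ 𝟎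
  diagonal≢𝟎 xy≢0 eq = xy≢0 (cong (λ v → lookup v 0F) eq , cong (λ v → lookup v 3F) eq)

  contains⇒vanishes : ∀ f → Contains f L → ∀ x y → ¬ (x ≡ 0# × y ≡ 0#) → pairing (pull A f) (diagonal x y) ≡ 0#
  contains⇒vanishes f L⊂f x y xy≢0 = trans (sym (pairing-congruent A x y f)) (vanishes (≡-dec _≟_ v 𝟎))
    where
    v = upperTriangle (congruent A x y)
    -- A point requires a nonzero vector. If `v` is zero the pairing vanishes at once, which spares
    -- a proof that congruence by `A` keeps matrices nonzero.
    vanishes : Dec (v ≡ 𝟎) → pairing f v ≡ 0#
    vanishes (yes v≡0) = begin
      pairing f v          ≡⟨ cong (pairing f) (trans v≡0 (sym (⊙-𝟎 𝟎))) ⟩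
      pairing f (0# ⊙ 𝟎)   ≡⟨ pairing-⊙ f 0# 𝟎 ⟩
      0# * pairing f 𝟎     ≡⟨ zeroˡ _ ⟩
      0#                   ∎
    vanishes (no v≢0) = trans (sym (evaluate≡pairing f v)) (L⊂f (v , v≢0)
      (Equivalence.from (proj₂ L∈o₈,₁ (v , v≢0))
        ((diagonal x y , diagonal≢𝟎 xy≢0) , (x , y , xy≢0 , refl) , 1# , 1≢0 ,
         λ i j → trans (congruent-symmetric A x y i j) (sym (*-identityˡ _)))))

  -- The representative line is spanned by diag(1, 0, 0) and diag(0, 1, -1), on which a form takes
  -- the values `a₀₀` and `a₁₁ - a₂₂`.
  contains⇒balanced : ∀ f → Contains f L → Balanced (pull A f)
  contains⇒balanced f L⊂f = balanced (pull A f) (contains⇒vanishes f L⊂f)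
    where
    balanced : ∀ g → (∀ x y → ¬ (x ≡ 0# × y ≡ 0#) → pairing g (diagonal x y) ≡ 0#) → Balanced g
    balanced g@(a ∷ b ∷ c ∷ d ∷ e ∷ f ∷ []) vanishes =
      trans (prove g (var 0F) (P.pairing gᴾ (con 1ℤ ∷ con 0ℤ ∷ con 0ℤ ∷ con 0ℤ ∷ con 0ℤ ∷ :- con 0ℤ ∷ [])) refl)
            (vanishes 1# 0# (1≢0 ∘ proj₁)) ,
      x-y≡0⇒x≡y (trans (prove g (var 3F :- var 5F) (P.pairing gᴾ (con 0ℤ ∷ con 0ℤ ∷ con 0ℤ ∷ con 1ℤ ∷ con 0ℤ ∷ :- con 1ℤ ∷ [])) refl)
            (vanishes 0# 1# (1≢0 ∘ proj₂)))
      where gᴾ = var 0F ∷ var 1F ∷ var 2F ∷ var 3F ∷ var 4F ∷ var 5F ∷ []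

  pairing-balanced : ∀ g → Balanced g → ∀ x y → pairing g (diagonal x y) ≡ 0#
  pairing-balanced (_ ∷ b ∷ c ∷ d ∷ e ∷ _ ∷ []) (refl , refl) x y = prove (b ∷ c ∷ d ∷ e ∷ x ∷ y ∷ [])
    (P.pairing (con 0ℤ ∷ var 0F ∷ var 1F ∷ var 2F ∷ var 3F ∷ var 2F ∷ [])
               (var 4F ∷ con 0ℤ ∷ con 0ℤ ∷ var 5F ∷ con 0ℤ ∷ :- var 5F ∷ [])) (con 0ℤ) refl

  balanced⇒contains : ∀ f → Balanced (pull A f) → Contains f L
  balanced⇒contains f balanced P@(v@(_ ∷ _ ∷ _ ∷ _ ∷ _ ∷ _ ∷ []) , _) P∈L =
    vanishes (Equivalence.to (proj₂ L∈o₈,₁ P) P∈L)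
    where
    vanishes : P ∈ Geometry.image F (proj₁ L∈o₈,₁) (Geometry.representative₈,₁ F) → evaluate f v ≡ 0#
    vanishes (_ , (x , y , _ , refl) , c , _ , v≡) = begin
      evaluate f v                              ≡⟨ evaluate≡pairing f v ⟩
      pairing f v                               ≡⟨ cong (pairing f) v≡c⊙ ⟩
      pairing f (c ⊙ w)                         ≡⟨ pairing-⊙ f c w ⟩
      c * pairing f w                           ≡⟨ cong (c *_) (pairing-congruent A x y f) ⟩
      c * pairing (pull A f) (diagonal x y)     ≡⟨ cong (c *_) (pairing-balanced (pull A f) balanced x y) ⟩
      c * 0#                                    ≡⟨ zeroʳ c ⟩
      0#                                        ∎
      where
      w = upperTriangle (congruent A x y)
      v≡c⊙ : v ≡ c ⊙ w
      v≡c⊙ = cong₂ _∷_ (v≡ 0F 0F) (cong₂ _∷_ (v≡ 0F 1F) (cong₂ _∷_ (v≡ 0F 2F)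
               (cong₂ _∷_ (v≡ 1F 1F) (cong₂ _∷_ (v≡ 1F 2F) (cong (_∷ []) (v≡ 2F 2F))))))

  pullB≢𝟎 : ∀ {f} → f ≢ 𝟎 → pull B f ≢ 𝟎
  pullB≢𝟎 {f} f≢0 eq = f≢0 (begin
    f                    ≡⟨ pullA-pullB f ⟨
    pull A (pull B f)    ≡⟨ cong (pull A) eq ⟩
    pull A 𝟎             ≡⟨ pull-𝟎 A ⟩
    𝟎                    ∎)

  pullA≢𝟎 : ∀ {f} → f ≢ 𝟎 → pull A f ≢ 𝟎
  pullA≢𝟎 {f} f≢0 eq = f≢0 (trans (sym (pullB-pullA f)) (trans (cong (pull B) eq) (pull-𝟎 B)))

  -- A hyperplane `f` is numbered by the normal form of `pull A f`, which `form-injective` makes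
  -- independent of the scalar. Since `B` undoes `A`, the hyperplane of a normal form is recovered
  -- as `pull B (form nf)`.
  hyperplaneCount : ∀ {H : Pred (Vec Carrier 6) 0ℓ} {P : Pred NormalForm 0ℓ} {n} → HasSize P n →
    (∀ f nf → form nf ∼ pull A f → H f → P nf) → (∀ nf → P nf → H (pull B (form nf))) →
    HyperplaneCount (λ f → H f × Contains f L) n
  hyperplaneCount {H} {P} {n} s H⇒P P⇒H = record
    { to = index
    ; cong = λ {f} {g} → index-cong f g
    ; bijective = (λ {f} {g} → index-injective f g) , index-surjective
    }
    where
    Hyperplane : Set
    Hyperplane = Σ[ f ∈ Vec Carrier 6 ] (f ≢ 𝟎 × H f × Contains f L)

    normalForm : (h : Hyperplane) → ∃[ nf ] form nf ∼ pull A (proj₁ h)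
    normalForm (f , f≢0 , _ , L⊂f) = normalise (pull A f) (pullA≢𝟎 f≢0) (contains⇒balanced f L⊂f)

    located : (h : Hyperplane) → ∃[ i ] element s i ≡ proj₁ (normalForm h)
    located h@(f , _ , Hf , _) = complete s (H⇒P f _ (proj₂ (normalForm h)) Hf)

    index : Hyperplane → Fin n
    index h = proj₁ (located h)

    form-index : ∀ h → form (element s (index h)) ∼ pull A (proj₁ h)
    form-index h = subst (λ nf → form nf ∼ pull A (proj₁ h)) (sym (proj₂ (located h))) (proj₂ (normalForm h))

    index-cong : ∀ h h′ → proj₁ h ∼ proj₁ h′ → index h ≡ index h′
    index-cong h h′ h∼h′ = injective s (form-injective _ _
      (∼-trans (form-index h) (∼-trans (pull-∼ A h∼h′) (∼-sym (form-index h′)))))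

    index-injective : ∀ h h′ → index h ≡ index h′ → proj₁ h ∼ proj₁ h′
    index-injective h h′ eq = subst₂ _∼_ (pullB-pullA (proj₁ h)) (pullB-pullA (proj₁ h′)) (pull-∼ B (∼-trans (∼-sym (form-index h))
      (subst (λ i → form (element s i) ∼ pull A (proj₁ h′)) (sym eq) (form-index h′))))

    index-surjective : ∀ i → ∃[ h ] ∀ {h′ : Hyperplane} → proj₁ h′ ∼ proj₁ h → index h′ ≡ i
    index-surjective i = h , λ {h′} h′∼h → trans (index-cong h′ h h′∼h) (injective s (form-injective _ _
      (subst (form (element s (index h)) ∼_) (pullA-pullB (form nf)) (form-index h))))
      where
      nf = element s i
      h : Hyperplane
      h = pull B (form nf) , pullB≢𝟎 (form≢𝟎 nf) , P⇒H nf (sound s i) ,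
          balanced⇒contains (pull B (form nf)) (subst Balanced (sym (pullA-pullB (form nf))) (form-balanced nf))

  count-H₁ : ∀ {n} → HasSize IsDoubleLine n → HyperplaneCount (λ f → H₁ f × Contains f L) n
  count-H₁ s = hyperplaneCount {H = H₁} s H₁⇒ H₁⇐
    where
    H₁⇒ : ∀ f nf → form nf ∼ pull A f → H₁ f → IsDoubleLine nf
    H₁⇒ _ nf nf∼ (c , l , refl) = let k , _ , eq = ∼-sym nf∼ in doubleLine⇒ nf (k * c) (pullLinear A l) (begin
      form nf                                          ≡⟨ eq ⟩
      k ⊙ pull A (c ⊙ (l ⊗ l))
        ≡⟨ cong (k ⊙_) (trans (pull-⊙ A c (l ⊗ l)) (cong (c ⊙_) (pull-⊗ A l l))) ⟩
      k ⊙ (c ⊙ (pullLinear A l ⊗ pullLinear A l))      ≡⟨ ⊙-assoc k c _ ⟩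
      (k * c) ⊙ (pullLinear A l ⊗ pullLinear A l)      ∎)
    H₁⇐ : ∀ nf → IsDoubleLine nf → H₁ (pull B (form nf))
    H₁⇐ nf p = let c , l , eq = doubleLine⇐ nf p in c , pullLinear B l , (begin
      pull B (form nf)                           ≡⟨ cong (pull B) eq ⟩
      pull B (c ⊙ (l ⊗ l))                       ≡⟨ trans (pull-⊙ B c (l ⊗ l)) (cong (c ⊙_) (pull-⊗ B l l)) ⟩
      c ⊙ (pullLinear B l ⊗ pullLinear B l)      ∎)

  count-H₂,ᵣ : ∀ {n} → HasSize IsRealPair n → HyperplaneCount (λ f → H₂,ᵣ f × Contains f L) n
  count-H₂,ᵣ s = hyperplaneCount {H = H₂,ᵣ} s H₂,ᵣ⇒ H₂,ᵣ⇐
    where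
    H₂,ᵣ⇒ : ∀ f nf → form nf ∼ pull A f → H₂,ᵣ f → IsRealPair nf
    H₂,ᵣ⇒ _ nf nf∼ (l , m , l≁m , refl) = let k , _ , eq = ∼-sym nf∼ in
      realPair⇒ nf k (pullLinear A l) (pullLinear A m)
        (l≁m ∘ subst₂ _∼_ (pullLinear-inverse {A} {B} AB≡1 l) (pullLinear-inverse {A} {B} AB≡1 m) ∘ pullLinear-∼ B)
        (trans eq (cong (k ⊙_) (pull-⊗ A l m)))
    H₂,ᵣ⇐ : ∀ nf → IsRealPair nf → H₂,ᵣ (pull B (form nf))
    H₂,ᵣ⇐ nf p = let l , m , l≁m , eq = realPair⇐ nf p in pullLinear B l , pullLinear B m ,
      (l≁m ∘ subst₂ _∼_ (pullLinear-inverse {B} {A} BA≡1 l) (pullLinear-inverse {B} {A} BA≡1 m) ∘ pullLinear-∼ A) ,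
      trans (cong (pull B) eq) (pull-⊗ B l m)

  count-H₂,ᵢ : ∀ {n} → HasSize IsImaginaryPair n → HyperplaneCount (λ f → H₂,ᵢ f × Contains f L) n
  count-H₂,ᵢ s = hyperplaneCount {H = H₂,ᵢ} s H₂,ᵢ⇒ H₂,ᵢ⇐
    where
    open Extension F F² using (ι-*; ι-1)
    AB≡1′ = ιᴹ-inverse {A} {B} AB≡1
    BA≡1′ = ιᴹ-inverse {B} {A} BA≡1

    map-ι-⊙ : ∀ {n} c (v : Vec Carrier n) → map ι (c ⊙ v) ≡ ι c VE.⊙ map ι v
    map-ι-⊙ c []      = refl
    map-ι-⊙ c (x ∷ v) = cong₂ _∷_ (ι-* c x) (map-ι-⊙ c v)

    pull-conjugates : ∀ A l → FE.pull (ιᴹ A) (l VE.⊗ map conjugate l) ≡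
                      FE.pullLinear (ιᴹ A) l VE.⊗ map conjugate (FE.pullLinear (ιᴹ A) l)
    pull-conjugates A l = trans (FE.pull-⊗ (ιᴹ A) l (map conjugate l))
      (cong (FE.pullLinear (ιᴹ A) l VE.⊗_) (sym (conjugate-pullLinear A l)))

    distinct : ∀ {A B} → (∀ i j → (ιᴹ A FE.∙ ιᴹ B) i j ≡ Geometry.identity (QuadraticExtension.E F²) i j) → ∀ l →
               ¬ l VE.∼ map conjugate l →
               ¬ FE.pullLinear (ιᴹ A) l VE.∼ map conjugate (FE.pullLinear (ιᴹ A) l)
    distinct {A} {B} inv l l≁l̄ p = l≁l̄ (subst₂ VE._∼_
      (FE.pullLinear-inverse {ιᴹ A} {ιᴹ B} inv l)
      (trans (cong (FE.pullLinear (ιᴹ B)) (conjugate-pullLinear A l))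
             (FE.pullLinear-inverse {ιᴹ A} {ιᴹ B} inv (map conjugate l)))
      (FE.pullLinear-∼ (ιᴹ B) p))

    H₂,ᵢ⇒ : ∀ f nf → form nf ∼ pull A f → H₂,ᵢ f → IsImaginaryPair nf
    H₂,ᵢ⇒ f nf nf∼ (c , l , l≁l̄ , ιf≡) = imaginaryPair⇒ nf
      (ι k E.* ι c , l′ , distinct {A} {B} AB≡1′ l l≁l̄ , (begin
        map ι (form nf)                                             ≡⟨ cong (map ι) eq ⟩
        map ι (k ⊙ pull A f)                                        ≡⟨ map-ι-⊙ k (pull A f) ⟩
        ι k VE.⊙ map ι (pull A f)                                   ≡⟨ cong (ι k VE.⊙_) (map-ι-pull A f) ⟩
        ι k VE.⊙ FE.pull (ιᴹ A) (map ι f)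
          ≡⟨ cong (λ v → ι k VE.⊙ FE.pull (ιᴹ A) v) ιf≡ ⟩
        ι k VE.⊙ FE.pull (ιᴹ A) (ι c VE.⊙ (l VE.⊗ map conjugate l))
          ≡⟨ cong (ι k VE.⊙_) (FE.pull-⊙ (ιᴹ A) (ι c) (l VE.⊗ map conjugate l)) ⟩
        ι k VE.⊙ (ι c VE.⊙ FE.pull (ιᴹ A) (l VE.⊗ map conjugate l)) ≡⟨ VE.⊙-assoc (ι k) (ι c) _ ⟩
        (ι k E.* ι c) VE.⊙ FE.pull (ιᴹ A) (l VE.⊗ map conjugate l)
          ≡⟨ cong ((ι k E.* ι c) VE.⊙_) (pull-conjugates A l) ⟩
        (ι k E.* ι c) VE.⊙ (l′ VE.⊗ map conjugate l′)               ∎))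
      where
      module E = FiniteField (QuadraticExtension.E F²)
      k = proj₁ (∼-sym nf∼)
      eq = proj₂ (proj₂ (∼-sym nf∼))
      l′ = FE.pullLinear (ιᴹ A) l

    H₂,ᵢ⇐ : ∀ nf → IsImaginaryPair nf → H₂,ᵢ (pull B (form nf))
    H₂,ᵢ⇐ nf p = 1# , l′ , distinct {B} {A} BA≡1′ l (proj₁ (proj₂ pair)) , (begin
      map ι (pull B (form nf))                        ≡⟨ map-ι-pull B (form nf) ⟩
      FE.pull (ιᴹ B) (map ι (form nf))                ≡⟨ cong (FE.pull (ιᴹ B)) (proj₂ (proj₂ pair)) ⟩
      FE.pull (ιᴹ B) (l VE.⊗ map conjugate l)         ≡⟨ pull-conjugates B l ⟩
      l′ VE.⊗ map conjugate l′                        ≡⟨ VE.⊙-identity _ ⟨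
      FiniteField.1# (QuadraticExtension.E F²) VE.⊙ (l′ VE.⊗ map conjugate l′)
        ≡⟨ cong (VE._⊙ (l′ VE.⊗ map conjugate l′)) ι-1 ⟨
      ι 1# VE.⊙ (l′ VE.⊗ map conjugate l′)            ∎)
      where
      pair = imaginaryPair⇐ nf p
      l = proj₁ pair
      l′ = FE.pullLinear (ιᴹ B) l

  count-H₃ : ∀ {n} → HasSize IsConic n → HyperplaneCount (λ f → H₃ f × Contains f L) n
  count-H₃ s = hyperplaneCount {H = H₃} s H₃⇒ H₃⇐
    where
    H₃≡ : ∀ f → H₃ f ≡ (discriminant f ≢ 0#)
    H₃≡ (_ ∷ _ ∷ _ ∷ _ ∷ _ ∷ _ ∷ []) = refl

    singular-pull : ∀ M f → discriminant f ≡ 0# → discriminant (pull M f) ≡ 0#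
    singular-pull M f eq = trans (discriminant-pull M f) (trans (cong (determinant M * determinant M *_) eq) (zeroʳ _))

    singular-∼ : ∀ {f g} → f ∼ g → discriminant f ≡ 0# → discriminant g ≡ 0#
    singular-∼ {f} (c , _ , refl) eq = trans (discriminant-⊙ c f) (trans (cong (c * c * c *_) eq) (zeroʳ _))

    H₃⇒ : ∀ f nf → form nf ∼ pull A f → H₃ f → IsConic nf
    H₃⇒ f nf nf∼ f∈H₃ = conic⇒ nf λ eq → subst (λ P → P) (H₃≡ f) f∈H₃
      (trans (cong discriminant (sym (pullB-pullA f))) (singular-pull B (pull A f) (singular-∼ nf∼ eq)))

    H₃⇐ : ∀ nf → IsConic nf → H₃ (pull B (form nf))
    H₃⇐ nf p = subst (λ P → P) (sym (H₃≡ (pull B (form nf)))) λ eq → conic⇐ nf p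
      (trans (cong discriminant (sym (pullA-pullB (form nf)))) (singular-pull A (pull B (form nf)) eq))

  open RootCounts F

  size-⊤ : HasSize (U {A = ⊤}) 1
  size-⊤ = size-cong (_ , λ _ → refl) (size-singleton tt)

  -- Among the real pairs, q² + q are cones with `r = 0`, `n` come from `TwoRoots`, and one is
  -- `X₁X₂`. The conics are the q²(q - 1) + q(q - 1) cones with nonzero `r`.
  distribution : ∀ {d n} → HasSize DoubleRoot d → HasSize SquareRootOfOne d → HasSize TwoRoots n →
    HasOD₄ L (d ∷ q ℕ.^ 2 ℕ.+ (q ℕ.+ suc n) ∷ suc n ∷ q ℕ.^ 3 ℕ.∸ q ∷ [])
  distribution {d} {n} s₁ s s₂ =
      subst (HyperplaneCount _) (ℕ.+-identityʳ d)
        (count-H₁ (size-⟨⊎⟩ size-∅ (size-⟨⊎⟩ size-∅ (size-⟨⊎⟩ s₁ size-∅))))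
    , subst (HyperplaneCount _) real≡
        (count-H₂,ᵣ (size-⟨⊎⟩ (size-⟨×⟩ size-Carrier (size-⟨×⟩ size-Carrier (size-singleton 0#)))
                    (size-⟨⊎⟩ (size-⟨×⟩ size-Carrier (size-singleton 0#)) (size-⟨⊎⟩ s₂ size-⊤))))
    , subst (HyperplaneCount _) (ℕ.+-identityʳ (suc n))
        (count-H₂,ᵢ (size-⟨⊎⟩ size-∅ (size-⟨⊎⟩ size-∅ (size-⟨⊎⟩ (size-noRoot s₁ s s₂) size-∅))))
    , subst (HyperplaneCount _) (conic≡ (proj₂ (proj₂ size-nonzero)))
        (count-H₃ (size-⟨⊎⟩ (size-⟨×⟩ size-Carrier (size-⟨×⟩ size-Carrier size-units))
                  (size-⟨⊎⟩ (size-⟨×⟩ size-Carrier size-units) (size-⟨⊎⟩ size-∅ size-∅))))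
    where
    k = proj₁ size-nonzero
    size-units = proj₁ (proj₂ size-nonzero)
    open Data.Nat.Solver.+-*-Solver using () renaming (solve to solveℕ; _:+_ to _⊞_; _:*_ to _⊠_; _:=_ to _≔_; con to conℕ)
    real≡ : q ℕ.* (q ℕ.* 1) ℕ.+ (q ℕ.* 1 ℕ.+ (n ℕ.+ 1)) ≡ q ℕ.^ 2 ℕ.+ (q ℕ.+ suc n)
    real≡ = solveℕ 2 (λ q n → q ⊠ (q ⊠ conℕ 1) ⊞ (q ⊠ conℕ 1 ⊞ (n ⊞ conℕ 1)) ≔ q ⊠ (q ⊠ conℕ 1) ⊞ (q ⊞ (conℕ 1 ⊞ n))) refl q n
    conic≡ : ∀ {q k} → q ≡ suc k → q ℕ.* (q ℕ.* k) ℕ.+ (q ℕ.* k ℕ.+ 0) ≡ q ℕ.^ 3 ℕ.∸ q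
    conic≡ {q} {k} refl = begin
      -- Adding and removing `q` turns truncated subtraction into an identity of polynomials.
      q ℕ.* (q ℕ.* k) ℕ.+ (q ℕ.* k ℕ.+ 0)               ≡⟨ ℕ.m+n∸n≡m _ q ⟨
      q ℕ.* (q ℕ.* k) ℕ.+ (q ℕ.* k ℕ.+ 0) ℕ.+ q ℕ.∸ q   ≡⟨ cong (ℕ._∸ q) (solveℕ 1 (λ k → let q = conℕ 1 ⊞ k in
          q ⊠ (q ⊠ k) ⊞ (q ⊠ k ⊞ conℕ 0) ⊞ q ≔ q ⊠ (q ⊠ (q ⊠ conℕ 1))) refl k) ⟩
      q ℕ.^ 3 ℕ.∸ q                                     ∎

-- The closed formulas for even and odd q

open import Data.Nat using (ℕ; _+_; _*_; _∸_; _^_)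

lemma4p4 : (q : ℕ) → PrimePower q →
    (F : FiniteField q) (F² : QuadraticExtension F) →
    (L : Geometry.Line F) → Geometry.o₈,₁ F L →
    (2 ∣ q →
    Distribution.HasOD₄ F F² L
    (1 ∷ q ^ 2 + (3 * q) / 2 ∷ q / 2 ∷ q ^ 3 ∸ q ∷ [])) ×
    (¬ (2 ∣ q) →
    Distribution.HasOD₄ F F² L
    (2 ∷ q ^ 2 + (3 * q ∸ 1) / 2 ∷ (q ∸ 1) / 2 ∷ q ^ 3 ∸ q ∷ []))
lemma4p4 q primePower F F² L L∈o₈,₁ = [ characteristic2 , oddCharacteristic ]′ size-doubleRoot
  where
  open FieldProperties F using (size-Carrier)
  open NormalForms F using (DoubleRoot)
  open RootCounts F
  open Counting F F² primePower L L∈o₈,₁ using (distribution)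
  open Distribution F F² using (HasOD₄)
  open ≡-Reasoning
  open Data.Nat.Solver.+-*-Solver using (solve; _:+_; _:*_; _:=_; con)

  n = proj₁ (size-decidable size-Carrier twoRoots?)
  s₂ = proj₂ (size-decidable size-Carrier twoRoots?)

  half : ∀ m {k} → k ≡ m * 2 → m ≡ k / 2
  half m refl = sym (m*n/n≡m m 2)

  resize : ∀ {h₁ a b a′ b′} → a ≡ a′ → b ≡ b′ →
           HasOD₄ L (h₁ ∷ q ^ 2 + a ∷ b ∷ q ^ 3 ∸ q ∷ []) →
           HasOD₄ L (h₁ ∷ q ^ 2 + a′ ∷ b′ ∷ q ^ 3 ∸ q ∷ [])
  resize refl refl od = od

  Conclusion : Set
  Conclusion =
    (2 ∣ q → HasOD₄ L (1 ∷ q ^ 2 + (3 * q) / 2 ∷ q / 2 ∷ q ^ 3 ∸ q ∷ [])) ×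
    (¬ (2 ∣ q) → HasOD₄ L (2 ∷ q ^ 2 + (3 * q ∸ 1) / 2 ∷ (q ∸ 1) / 2 ∷ q ^ 3 ∸ q ∷ []))

  -- The cases are separated by the number of square roots of one. The count of nonzero elements
  -- then yields the parity of `q`, which makes the other half of the conclusion vacuous.
  characteristic2 : HasSize DoubleRoot 1 × HasSize SquareRootOfOne 1 → Conclusion
  characteristic2 (s₁ , s) =
      (λ _ → resize (half (q + suc n) 3q≡) (half (suc n) q≡2[1+n]) (distribution s₁ s s₂))
    , (λ q-odd → contradiction (divides (suc n) q≡2[1+n]) q-odd)
    where
    -- Hence `suc n` is `q / 2`, and `q + suc n` is half of `3 * q`.
    q≡ : q ≡ 2 + (n + n)
    q≡ = count-nonzero s s₂
    q≡2[1+n] : q ≡ suc n * 2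
    q≡2[1+n] = trans q≡ (solve 1 (λ n → con 2 :+ (n :+ n) := (con 1 :+ n) :* con 2) refl n)
    3q≡ : 3 * q ≡ (q + suc n) * 2
    3q≡ = begin
      3 * q                        ≡⟨ cong (3 *_) q≡ ⟩
      3 * (2 + (n + n))            ≡⟨ solve 1 (λ n → con 3 :* (con 2 :+ (n :+ n)) :=
                                        (con 2 :+ (n :+ n) :+ (con 1 :+ n)) :* con 2) refl n ⟩
      (2 + (n + n) + suc n) * 2    ≡⟨ cong (λ q → (q + suc n) * 2) q≡ ⟨
      (q + suc n) * 2              ∎

  oddCharacteristic : HasSize DoubleRoot 2 × HasSize SquareRootOfOne 2 → Conclusion
  oddCharacteristic (s₁ , s) =
      (λ { (divides m q≡2m) → ⊥-elim (ℕ.even≢odd m (suc n) (begin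
           2 * m              ≡⟨ ℕ.*-comm 2 m ⟩
           m * 2              ≡⟨ q≡2m ⟨
           q                  ≡⟨ q≡1+2[1+n] ⟩
           suc (suc n * 2)    ≡⟨ cong suc (ℕ.*-comm (suc n) 2) ⟩
           suc (2 * suc n)    ∎)) })
    , (λ _ → resize (half (q + suc n) 3q-1≡) (half (suc n) (cong (_∸ 1) q≡1+2[1+n])) (distribution s₁ s s₂))
    where
    -- Hence `suc n` is half of `q - 1`, and `q + suc n` is half of `3 * q - 1`.
    q≡ : q ≡ 3 + (n + n)
    q≡ = count-nonzero s s₂
    q≡1+2[1+n] : q ≡ suc (suc n * 2)
    q≡1+2[1+n] = trans q≡ (solve 1 (λ n → con 3 :+ (n :+ n) := con 1 :+ (con 1 :+ n) :* con 2) refl n)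
    3q-1≡ : 3 * q ∸ 1 ≡ (q + suc n) * 2
    3q-1≡ = begin
      3 * q ∸ 1                    ≡⟨ cong (λ q → 3 * q ∸ 1) q≡ ⟩
      3 * (3 + (n + n)) ∸ 1        ≡⟨ cong (_∸ 1) (solve 1 (λ n → con 3 :* (con 3 :+ (n :+ n)) :=
                                        con 1 :+ (con 3 :+ (n :+ n) :+ (con 1 :+ n)) :* con 2) refl n) ⟩
      (3 + (n + n) + suc n) * 2    ≡⟨ cong (λ q → (q + suc n) * 2) q≡ ⟨
      (q + suc n) * 2              ∎
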